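{- Let $q$ be a prime power and let $n,k,\delta$ be positive integers with $n\geq2k\geq 2\delta$. Then $$\bar{A}_q(n,2\delta,k)\geq q^{(n-k)(k-\delta+1)}+A^R_q(k\times (n-k), \delta, [0,k-\delta]).$$
   Context: $\mathcal G_q(n,k)$ is the set of $k$-dimensional subspaces of $\mathbb F_q^n$, with subspace distance $d_S(\mathcal U,\mathcal V)=\dim\mathcal U+\dim\mathcal V-2\dim(\mathcal U\cap\mathcal V)$. An $(n,d,k)_q$-CDC is a subset of $\mathcal G_q(n,k)$ with pairwise subspace distance at least $d$. An MRD$[k\times(n-k),\delta]_q$ code is an $\mathbb F_q$-linear subspace of $\mathbb F_q^{k\times(n-k)}$ of dimension $\max\{k,n-k\}(\min\{k,n-k\}-\delta+1)$ whose nonzero elements all have rank at least $\delta$. A lifted MRD code is $\{\mathrm{rowspace}(\boldsymbol I_k\mid\boldsymbol A):\boldsymbol A\in\mathcal D\}$ for such $\mathcal D$. $\bar A_q(n,2\delta,k)$ denotes the maximum number of codewords of an $(n,2\delta,k)_q$-CDC containing a lifted MRD code (of size $q^{(n-k)(k-\delta+1)}$) as a subset. For $K\subseteq\{0,\dots,n-k\}$, $A^R_q(k\times(n-k),\delta,K)$ is the maximum size of a set of matrices in $\mathbb F_q^{k\times(n-k)}$, each of rank in $K$, with pairwise rank distance $\mathrm{rank}(\boldsymbol D_1-\boldsymbol D_2)\ge\delta$. $[a,b]$ denotes the integers $x$ with $a\le x\le b$. -}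

module Defs where

open import Data.Nat using (ℕ; zero; suc; _+_; _*_; _∸_; _≤_; _⊔_; _⊓_)
open import Data.Nat.Properties using (m+[n∸m]≡n)
open import Data.Fin using (Fin; splitAt; cast)
import Data.Fin as Fin
open import Data.Sum using (inj₁; inj₂)
open import Data.Product using (Σ; ∃; ∃-syntax; _×_; _,_)
open import Relation.Binary.PropositionalEquality using (_≡_; _≢_; sym)
open import Relation.Binary.Definitions using (DecidableEquality)
open import Relation.Nullary using (¬_; yes; no)
open import Algebra.Structures using (IsCommutativeRing)
open import Function.Bundles using (_↔_)

record FiniteField : Set₁ where
  field
    Carrier : Set
    _⊕_ : Carrier → Carrier → Carrier
    _⊗_ : Carrier → Carrier → Carrier
    ⊖_  : Carrier → Carrier
    0#  : Carrier
    1#  : Carrier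
    isCommutativeRing : IsCommutativeRing _≡_ _⊕_ _⊗_ ⊖_ 0# 1#
    0≢1 : 0# ≢ 1#
    inverse : ∀ x → x ≢ 0# → ∃[ y ] (x ⊗ y ≡ 1#)
    _≟_ : DecidableEquality Carrier
    size : ℕ
    enumeration : Fin size ↔ Carrier

module _ (F : FiniteField) where
  open FiniteField F renaming (_⊕_ to _+F_; _⊗_ to _*F_)

  ∑ : (r : ℕ) → (Fin r → Carrier) → Carrier
  ∑ zero    f = 0#
  ∑ (suc r) f = f Fin.zero +F ∑ r (λ i → f (Fin.suc i))

  Vector : ℕ → Set
  Vector n = Fin n → Carrier

  Matrix : ℕ → ℕ → Set
  Matrix m n = Fin m → Fin n → Carrier

  lincomb : ∀ {r n} → (Fin r → Carrier) → (Fin r → Vector n) → Vector n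
  lincomb {r} c v j = ∑ r (λ i → c i *F v i j)

  LinIndep : ∀ {r n} → (Fin r → Vector n) → Set
  LinIndep {r} {n} v = ∀ (c : Fin r → Carrier) →
    (∀ j → lincomb c v j ≡ 0#) → ∀ i → c i ≡ 0#

  HasDimAtLeast : ∀ {n} → (Vector n → Set) → ℕ → Set
  HasDimAtLeast {n} U d = Σ (Fin d → Vector n) λ v → LinIndep v × (∀ i → U (v i))

  HasDim : ∀ {n} → (Vector n → Set) → ℕ → Set
  HasDim U d = HasDimAtLeast U d × ¬ HasDimAtLeast U (suc d)

  RowSpace : ∀ {m n} → Matrix m n → Vector n → Set
  RowSpace {m} A x = Σ (Fin m → Carrier) λ c → ∀ j → lincomb c A j ≡ x j

  HasRank : ∀ {m n} → Matrix m n → ℕ → Set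
  HasRank A r = HasDim (RowSpace A) r

  RankIn : ∀ {m n} → Matrix m n → ℕ → ℕ → Set
  RankIn A a b = ∃[ r ] (HasRank A r × a ≤ r × r ≤ b)

  _-M_ : ∀ {m n} → Matrix m n → Matrix m n → Matrix m n
  (A -M B) i j = A i j +F (⊖ B i j)

  RankDistAtLeast : ∀ {m n} → Matrix m n → Matrix m n → ℕ → Set
  RankDistAtLeast A B δ = ∃[ r ] (HasRank (A -M B) r × δ ≤ r)

  HasSubspaceDist : ∀ {a b n} → Matrix a n → Matrix b n → ℕ → Set
  HasSubspaceDist A B d = ∃[ u ] ∃[ v ] ∃[ w ]
    (HasDim (RowSpace A) u × HasDim (RowSpace B) v ×
     HasDim (λ x → RowSpace A x × RowSpace B x) w × d ≡ (u + v) ∸ (2 * w))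

  SameRowSpace : ∀ {a b n} → Matrix a n → Matrix b n → Set
  SameRowSpace {n = n} A B = ∀ (x : Vector n) →
    (RowSpace A x → RowSpace B x) × (RowSpace B x → RowSpace A x)

  -- an (n, d, k)_q constant dimension code, given as a family of t matrices
  -- of size k × n whose row spaces are the codewords: each row space is
  -- k-dimensional and distinct codewords have subspace distance ≥ d.
  -- (For d ≥ 1 distinct indices automatically give distinct subspaces.)
  IsCDC : ∀ {t} (n d k : ℕ) → (Fin t → Matrix k n) → Set
  IsCDC n d k C = (∀ i → HasRank (C i) k) ×
    (∀ i j → i ≢ j → ∃[ e ] (HasSubspaceDist (C i) (C j) e × d ≤ e))

  InSpan : ∀ {b m n} → (Fin b → Matrix m n) → Matrix m n → Set
  InSpan {b} B A = Σ (Fin b → Carrier) λ c →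
    ∀ i j → ∑ b (λ l → c l *F B l i j) ≡ A i j

  LinIndepMat : ∀ {b m n} → (Fin b → Matrix m n) → Set
  LinIndepMat {b} B = ∀ (c : Fin b → Carrier) →
    (∀ i j → ∑ b (λ l → c l *F B l i j) ≡ 0#) → ∀ l → c l ≡ 0#

  IsMRD : (k m δ : ℕ) → (Fin ((k ⊔ m) * (suc (k ⊓ m) ∸ δ)) → Matrix k m) → Set
  IsMRD k m δ B = LinIndepMat B ×
    (∀ A → InSpan B A → (∃[ i ] ∃[ j ] (A i j ≢ 0#)) →
       ∃[ r ] (HasRank A r × δ ≤ r))

  idEntry : ∀ {k} → Fin k → Fin k → Carrier
  idEntry i i' with i Fin.≟ i'
  ... | yes _ = 1#
  ... | no  _ = 0#

  lift : ∀ {n k} → k ≤ n → Matrix k (n ∸ k) → Matrix k n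
  lift {n} {k} k≤n A i j with splitAt k (cast (sym (m+[n∸m]≡n k≤n)) j)
  ... | inj₁ i' = idEntry i i'
  ... | inj₂ j' = A i j'

-- Lifting an MRD code gives the row spaces of (I ∣ A), and the given rank metric code is placed on the other
-- side as the row spaces of (D ∣ I). Two row spaces of the same kind meet in the left kernel of the difference of
-- their matrices. A vector in the row spaces of (I ∣ A) and (D ∣ I) is determined by its first k coordinates, which
-- are those of a vector in the row space of D, so here the intersection has dimension at most rank D ≤ k − δ.
--
-- The MRD code is Gabidulin's: evaluations of linearized polynomials Σ fᵢ x^(q^i), i ≤ k − δ, at k independent
-- elements of an extension of degree m = n − k. That extension is the set of roots of X^(q^m) − X in a finite field
-- obtained by adjoining roots one at a time. No characteristic is used: (x + y)^q = x^q + y^q because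
-- (X + 1)^q − X^q − 1 vanishes on all q elements of F and has degree less than q, so its coefficients are zero.
module Submission where

open import Defs
open import Algebra.Bundles using (CommutativeRing; RawRing)
open import Algebra.Structures using (IsCommutativeRing)
open import Algebra.Solver.Ring.AlmostCommutativeRing using (fromCommutativeRing; _-Raw-AlmostCommutative⟶_)
import Algebra.Solver.Ring
import Algebra.Properties.Ring
import Algebra.Properties.AbelianGroup
import Algebra.Properties.Semiring.Exp
import Algebra.Properties.Semiring.Mult
import Algebra.Properties.Semiring.Sum
import Algebra.Properties.CommutativeMonoid.Sum
import Algebra.Properties.CommutativeSemiring.Binomial
import Algebra.Properties.CommutativeSemiring.Exp
open import Data.Fin using (Fin; zero; suc; toℕ; _↑ˡ_; _↑ʳ_; splitAt; cast; combine; remQuot; funToFin; finToFun)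
import Data.Fin as Fin
import Data.Fin.Properties as Finₚ
open import Data.Fin.Permutation using (Permutation; permutation; _⟨$⟩ʳ_)
open import Data.List using (List; []; _∷_)
import Data.List as List
import Data.List.Properties as Listₚ
open import Data.Maybe using (Maybe; just; nothing)
open import Data.Nat using (ℕ; zero; suc; _+_; _*_; _∸_; _^_; _≤_; _<_; z≤n; s≤s)
import Data.Nat as ℕ
import Data.Nat.Properties as ℕₚ
open import Data.Nat.Combinatorics using (_C_; nCn≡1)
open import Data.Product using (Σ; ∃; ∃-syntax; _×_; _,_; proj₁; proj₂)
open import Data.Sum using (_⊎_; inj₁; inj₂; [_,_]′; swap)
open import Data.Vec using (Vec; []; _∷_)
import Data.Vec as Vec
import Data.Vec.Properties as Vecₚ
import Data.Vec.Functional as Vector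
open import Function using (_∘_; id; case_of_)
open import Function.Bundles using (Inverse; mk↔ₛ′)
open import Level using (0ℓ)
import Relation.Binary.PropositionalEquality
open import Relation.Binary.PropositionalEquality using (_≡_; _≢_; refl; sym; trans; cong; cong₂; subst; module ≡-Reasoning)
open import Relation.Nullary using (¬_; Dec; yes; no; contradiction)
import Relation.Binary.Reasoning.Setoid
import Relation.Nullary.Decidable as Decidable

-- Vectors of length r over F are numbered by `Fin (size ^ r)`. Membership in a span is therefore
-- decided by search, bases are found by exhaustion, and counting takes the place of elimination.
-- The field that holds the roots may be larger than the extension of degree m, since no irreducible
-- polynomial of degree m is at hand to start from. The code sees only the roots of X^(q^m) - X in
-- it: r < m independent roots account for q^r < q^m of them, which leaves room for one more, while
-- m independent roots span all of them, so that coordinates turn roots into rows of length m.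
-- Additivity of x ↦ x^q is used in two kinds of rings: in fields, where it closes the roots under
-- F-linear combinations, and in polynomial rings, where it replaces the derivative in excluding
-- double roots. It is therefore reduced to binomial coefficients that vanish in F, which vanish in
-- every ring that receives F. On the coding side, the estimates bound the size of independent
-- families in a kernel or an intersection; ranks and distances are derived from such bounds.

-- A ring solver with integer coefficients.

-- The coefficient (a , b) stands for the integer a − b.
module Solver {c ℓ} (R : CommutativeRing c ℓ) where
  private
    open module R = CommutativeRing R hiding (_+_; _*_; -_; zero)
    open CommutativeRing R using () renaming (_+_ to infixl 6 _⊕_; _*_ to infixl 7 _⊗_; -_ to infix 8 ⊖_)
    open Algebra.Properties.Ring R.ring using (-‿distribˡ-*; -‿distribʳ-*; -‿involutive)
    open Algebra.Properties.AbelianGroup R.+-abelianGroup using (⁻¹-∙-comm)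
    open Algebra.Properties.Semiring.Mult R.semiring using (×-homo-+; ×1-homo-*) renaming (_×_ to _·_)
    open import Relation.Binary.Reasoning.Setoid R.setoid

    -- Cancelling common successors leaves one pair per integer, so that the normal forms of the two
    -- sides of an identity can agree by `refl`.
    reduce : ℕ × ℕ → ℕ × ℕ
    reduce (suc a , suc b) = reduce (a , b)
    reduce (zero  , b)     = zero , b
    reduce (suc a , zero)  = suc a , zero

    Coefficient : RawRing 0ℓ 0ℓ
    Coefficient = record
      { Carrier = ℕ × ℕ
      ; _≈_ = _≡_
      ; _+_ = λ (a , b) (a′ , b′) → reduce (a + a′ , b + b′)
      ; _*_ = λ (a , b) (a′ , b′) → reduce (a * a′ + b * b′ , a * b′ + b * a′)
      ; -_  = λ (a , b) → b , a
      ; 0#  = 0 , 0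
      ; 1#  = 1 , 0
      }

    ι : ℕ → R.Carrier
    ι n = n · R.1#

    ⟦_⟧ : ℕ × ℕ → R.Carrier
    ⟦ a , b ⟧ = ι a ⊕ ⊖ ι b

    interchange : ∀ w x y z → (w ⊕ x) ⊕ (y ⊕ z) ≈ (w ⊕ y) ⊕ (x ⊕ z)
    interchange w x y z = begin
      (w ⊕ x) ⊕ (y ⊕ z) ≈⟨ R.+-assoc w x (y ⊕ z) ⟩
      w ⊕ (x ⊕ (y ⊕ z)) ≈⟨ R.+-congˡ (R.+-assoc x y z) ⟨
      w ⊕ ((x ⊕ y) ⊕ z) ≈⟨ R.+-congˡ (R.+-congʳ (R.+-comm x y)) ⟩
      w ⊕ ((y ⊕ x) ⊕ z) ≈⟨ R.+-congˡ (R.+-assoc y x z) ⟩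
      w ⊕ (y ⊕ (x ⊕ z)) ≈⟨ R.+-assoc w y (x ⊕ z) ⟨
      (w ⊕ y) ⊕ (x ⊕ z) ∎

    sub-interchange : ∀ w x y z → (w ⊕ x) ⊕ ⊖ (y ⊕ z) ≈ (w ⊕ ⊖ y) ⊕ (x ⊕ ⊖ z)
    sub-interchange w x y z = R.trans (R.+-congˡ (R.sym (⁻¹-∙-comm y z))) (interchange w x (⊖ y) (⊖ z))

    reduce-correct : ∀ a b → ⟦ reduce (a , b) ⟧ ≈ ⟦ a , b ⟧
    reduce-correct (suc a) (suc b) = begin
      ⟦ reduce (a , b) ⟧                   ≈⟨ reduce-correct a b ⟩
      ι a ⊕ ⊖ ι b                          ≈⟨ R.+-identityˡ _ ⟨
      R.0# ⊕ (ι a ⊕ ⊖ ι b)                 ≈⟨ R.+-congʳ (R.-‿inverseʳ R.1#) ⟨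
      R.1# ⊕ ⊖ R.1# ⊕ (ι a ⊕ ⊖ ι b)        ≈⟨ sub-interchange R.1# (ι a) R.1# (ι b) ⟨
      R.1# ⊕ ι a ⊕ ⊖ (R.1# ⊕ ι b)          ∎
    reduce-correct zero    b       = R.refl
    reduce-correct (suc a) zero    = R.refl

    +-homo : ∀ x y → ⟦ RawRing._+_ Coefficient x y ⟧ ≈ ⟦ x ⟧ ⊕ ⟦ y ⟧
    +-homo (a , b) (a′ , b′) = R.trans (reduce-correct (a + a′) (b + b′)) (R.trans
      (R.+-cong (×-homo-+ R.1# a a′) (R.-‿cong (×-homo-+ R.1# b b′)))
      (sub-interchange (ι a) (ι a′) (ι b) (ι b′)))

    *-homo : ∀ x y → ⟦ RawRing._*_ Coefficient x y ⟧ ≈ ⟦ x ⟧ ⊗ ⟦ y ⟧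
    *-homo (a , b) (a′ , b′) = begin
      ⟦ reduce (a * a′ + b * b′ , a * b′ + b * a′) ⟧
        ≈⟨ reduce-correct (a * a′ + b * b′) (a * b′ + b * a′) ⟩
      ι (a * a′ + b * b′) ⊕ ⊖ ι (a * b′ + b * a′)
        ≈⟨ R.+-cong (two a a′ b b′) (R.-‿cong (two a b′ b a′)) ⟩
      (A ⊗ A′ ⊕ B ⊗ B′) ⊕ ⊖ (A ⊗ B′ ⊕ B ⊗ A′)
        ≈⟨ sub-interchange _ _ _ _ ⟩
      (A ⊗ A′ ⊕ ⊖ (A ⊗ B′)) ⊕ (B ⊗ B′ ⊕ ⊖ (B ⊗ A′))
        ≈⟨ R.+-cong (R.+-congˡ (-‿distribʳ-* A B′)) (R.trans (R.+-comm _ _) (R.+-cong (-‿distribˡ-* B A′) (R.sym neg-neg))) ⟩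
      (A ⊗ A′ ⊕ A ⊗ ⊖ B′) ⊕ (⊖ B ⊗ A′ ⊕ ⊖ B ⊗ ⊖ B′)
        ≈⟨ R.+-cong (R.distribˡ A A′ (⊖ B′)) (R.distribˡ (⊖ B) A′ (⊖ B′)) ⟨
      A ⊗ (A′ ⊕ ⊖ B′) ⊕ ⊖ B ⊗ (A′ ⊕ ⊖ B′)
        ≈⟨ R.distribʳ (A′ ⊕ ⊖ B′) A (⊖ B) ⟨
      (A ⊕ ⊖ B) ⊗ (A′ ⊕ ⊖ B′) ∎
      where
      A = ι a
      B = ι b
      A′ = ι a′
      B′ = ι b′
      two : ∀ p q r s → ι (p * q + r * s) ≈ ι p ⊗ ι q ⊕ ι r ⊗ ι s
      two p q r s = R.trans (×-homo-+ R.1# (p * q) (r * s)) (R.+-cong (×1-homo-* p q) (×1-homo-* r s))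
      neg-neg : ⊖ B ⊗ ⊖ B′ ≈ B ⊗ B′
      neg-neg = R.trans (R.sym (-‿distribˡ-* B (⊖ B′)))
        (R.trans (R.-‿cong (R.sym (-‿distribʳ-* B B′))) (-‿involutive (B ⊗ B′)))

    morphism : Coefficient -Raw-AlmostCommutative⟶ fromCommutativeRing R
    morphism = record
      { ⟦_⟧    = ⟦_⟧
      ; +-homo = +-homo
      ; *-homo = *-homo
      ; -‿homo = λ (a , b) → R.trans (R.+-comm _ _)
          (R.trans (R.+-congˡ (R.sym (-‿involutive _))) (⁻¹-∙-comm _ _))
      ; 0-homo = R.-‿inverseʳ R.0#
      ; 1-homo = R.trans (R.+-cong (R.+-identityʳ R.1#) (neg-zero)) (R.+-identityʳ R.1#)
      }
      where
      neg-zero : ⊖ R.0# ≈ R.0#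
      neg-zero = R.trans (R.sym (R.+-identityˡ _)) (R.-‿inverseʳ R.0#)

    coefficient≟ : ∀ x y → Maybe (⟦ x ⟧ ≈ ⟦ y ⟧)
    coefficient≟ (a , b) (a′ , b′) with a + b′ ℕₚ.≟ a′ + b
    ... | no _ = nothing
    ... | yes e = just (begin
      ι a ⊕ ⊖ ι b                        ≈⟨ R.+-identityʳ _ ⟨
      ι a ⊕ ⊖ ι b ⊕ R.0#                 ≈⟨ R.+-congˡ (R.-‿inverseʳ (ι b′)) ⟨
      ι a ⊕ ⊖ ι b ⊕ (ι b′ ⊕ ⊖ ι b′)      ≈⟨ interchange _ _ _ _ ⟩
      ι a ⊕ ι b′ ⊕ (⊖ ι b ⊕ ⊖ ι b′)      ≈⟨ R.+-cong eq (R.+-comm _ _) ⟩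
      ι a′ ⊕ ι b ⊕ (⊖ ι b′ ⊕ ⊖ ι b)      ≈⟨ interchange _ _ _ _ ⟩
      ι a′ ⊕ ⊖ ι b′ ⊕ (ι b ⊕ ⊖ ι b)      ≈⟨ R.+-congˡ (R.-‿inverseʳ (ι b)) ⟩
      ι a′ ⊕ ⊖ ι b′ ⊕ R.0#               ≈⟨ R.+-identityʳ _ ⟩
      ι a′ ⊕ ⊖ ι b′                      ∎)
      where
      eq : ι a ⊕ ι b′ ≈ ι a′ ⊕ ι b
      eq = R.trans (R.sym (×-homo-+ R.1# a b′)) (R.trans (R.reflexive (cong ι e)) (×-homo-+ R.1# a′ b))

  open Algebra.Solver.Ring Coefficient (fromCommutativeRing R) morphism coefficient≟ public
    using (solve; _:=_; _:+_; _:*_; _:-_; :-_; con)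

-- Identities used for polynomials, proved over an abstract ring where the solver has nothing to compute.
module RingIdentities {c ℓ} (R : CommutativeRing c ℓ) where
  open CommutativeRing R using (Carrier; _≈_) renaming (refl to ≈-refl; _+_ to infixl 6 _⊕_; _*_ to infixl 7 _⊗_; -_ to infix 8 ⊖_)
  open Solver R

  exchange-factors : ∀ a b h w → a ⊗ (b ⊗ (h ⊗ w)) ≈ b ⊗ (a ⊗ h ⊗ w)
  exchange-factors = solve 4 (λ a b h w → a :* (b :* (h :* w)) := b :* (a :* h :* w)) ≈-refl

  exchange-summands : ∀ x y z → x ⊕ (y ⊕ z) ≈ y ⊕ x ⊕ z
  exchange-summands = solve 3 (λ x y z → x :+ (y :+ z) := y :+ x :+ z) ≈-refl

  euclid-step : ∀ u s v r → ⊖ (u ⊗ s) ⊗ v ≈ u ⊗ r ⊕ ⊖ (u ⊗ (s ⊗ v ⊕ r))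
  euclid-step = solve 4 (λ u s v r → :- (u :* s) :* v := u :* r :- u :* (s :* v :+ r)) ≈-refl

  collect : ∀ o t g u → o ⊕ t ⊗ g ⊕ ⊖ (u ⊗ g) ≈ o ⊕ (t ⊕ ⊖ u) ⊗ g
  collect = solve 4 (λ o t g u → o :+ t :* g :- u :* g := o :+ (t :- u) :* g) ≈-refl

  separate : ∀ t p o a u → t ⊗ (p ⊕ ⊖ o ⊕ ⊖ u) ≈ (t ⊗ p ⊕ a) ⊕ ⊖ (t ⊗ o ⊕ a) ⊕ ⊖ (t ⊗ u)
  separate = solve 5 (λ t p o a u → t :* (p :- o :- u) := (t :* p :+ a) :- (t :* o :+ a) :- t :* u) ≈-refl

-- Finite fields: sums and the enumeration of vectors.

module FieldTheory (F : FiniteField) where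
  open FiniteField F public using (Carrier; size; enumeration; 0≢1; inverse) renaming (_≟_ to infix 4 _≟F_)

  ring : CommutativeRing 0ℓ 0ℓ
  ring = record { isCommutativeRing = FiniteField.isCommutativeRing F }

  open CommutativeRing ring public
    using (0#; 1#; +-identityˡ; +-identityʳ; +-assoc; +-comm; *-assoc; *-comm; *-identityˡ; *-identityʳ;
           distribˡ; distribʳ; zeroˡ; zeroʳ; -‿inverseˡ; -‿inverseʳ; semiring)
    renaming (_+_ to infixl 6 _⊕_; _*_ to infixl 7 _⊗_; -_ to infix 8 ⊖_)
  open Algebra.Properties.Semiring.Exp semiring public using () renaming (_^_ to infixr 9 _^F_)
  open Solver ring public
  open ≡-Reasoning

  ⊕-interchange : ∀ w x y z → (w ⊕ x) ⊕ (y ⊕ z) ≡ (w ⊕ y) ⊕ (x ⊕ z)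
  ⊕-interchange = solve 4 (λ w x y z → (w :+ x) :+ (y :+ z) := (w :+ y) :+ (x :+ z)) refl

  x⊖y⊕y≡x : ∀ x y → x ⊕ ⊖ y ⊕ y ≡ x
  x⊖y⊕y≡x = solve 2 (λ x y → x :- y :+ y := x) refl

  x⊖y≡0⇒x≡y : ∀ {x y} → x ⊕ ⊖ y ≡ 0# → x ≡ y
  x⊖y≡0⇒x≡y {x} {y} e = begin
    x             ≡⟨ x⊖y⊕y≡x x y ⟨
    x ⊕ ⊖ y ⊕ y   ≡⟨ cong (_⊕ y) e ⟩
    0# ⊕ y        ≡⟨ +-identityˡ y ⟩
    y             ∎

  x≡y⇒x⊖y≡0 : ∀ {x y} → x ≡ y → x ⊕ ⊖ y ≡ 0#
  x≡y⇒x⊖y≡0 {x} refl = -‿inverseʳ x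

  x⊗y≡0⇒y≡0 : ∀ {x y} → x ≢ 0# → x ⊗ y ≡ 0# → y ≡ 0#
  x⊗y≡0⇒y≡0 {x} {y} x≢0 e with inverse x x≢0
  ... | x⁻¹ , i = begin
    y               ≡⟨ *-identityˡ y ⟨
    1# ⊗ y          ≡⟨ cong (_⊗ y) i ⟨
    x ⊗ x⁻¹ ⊗ y     ≡⟨ solve 3 (λ x z y → x :* z :* y := z :* (x :* y)) refl x x⁻¹ y ⟩
    x⁻¹ ⊗ (x ⊗ y)   ≡⟨ cong (x⁻¹ ⊗_) e ⟩
    x⁻¹ ⊗ 0#        ≡⟨ zeroʳ x⁻¹ ⟩
    0#              ∎

  ⊗-cancelˡ : ∀ {x y z} → x ≢ 0# → x ⊗ y ≡ x ⊗ z → y ≡ z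
  ⊗-cancelˡ {x} {y} {z} x≢0 e = x⊖y≡0⇒x≡y (x⊗y≡0⇒y≡0 x≢0 (trans
    (solve 3 (λ x y z → x :* (y :- z) := x :* y :- x :* z) refl x y z) (x≡y⇒x⊖y≡0 e)))

  ∑-cong : ∀ r {f g : Fin r → Carrier} → (∀ i → f i ≡ g i) → ∑ F r f ≡ ∑ F r g
  ∑-cong zero    e = refl
  ∑-cong (suc r) e = cong₂ _⊕_ (e zero) (∑-cong r (e ∘ suc))

  ∑-0 : ∀ r {f : Fin r → Carrier} → (∀ i → f i ≡ 0#) → ∑ F r f ≡ 0#
  ∑-0 zero    e = refl
  ∑-0 (suc r) e = trans (cong₂ _⊕_ (e zero) (∑-0 r (e ∘ suc))) (+-identityˡ 0#)

  ∑-⊕ : ∀ r (f g : Fin r → Carrier) → ∑ F r (λ i → f i ⊕ g i) ≡ ∑ F r f ⊕ ∑ F r g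
  ∑-⊕ zero    f g = sym (+-identityˡ 0#)
  ∑-⊕ (suc r) f g = trans (cong ((f zero ⊕ g zero) ⊕_) (∑-⊕ r (f ∘ suc) (g ∘ suc))) (⊕-interchange _ _ _ _)

  ∑-⊗ˡ : ∀ r x (f : Fin r → Carrier) → ∑ F r (λ i → x ⊗ f i) ≡ x ⊗ ∑ F r f
  ∑-⊗ˡ zero    x f = sym (zeroʳ x)
  ∑-⊗ˡ (suc r) x f = trans (cong (x ⊗ f zero ⊕_) (∑-⊗ˡ r x (f ∘ suc))) (sym (distribˡ x _ _))

  ∑-⊗ʳ : ∀ r x (f : Fin r → Carrier) → ∑ F r (λ i → f i ⊗ x) ≡ ∑ F r f ⊗ x
  ∑-⊗ʳ r x f = trans (∑-cong r (λ i → *-comm (f i) x)) (trans (∑-⊗ˡ r x f) (*-comm x _))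

  ∑-⊖ : ∀ r (f : Fin r → Carrier) → ∑ F r (λ i → ⊖ f i) ≡ ⊖ ∑ F r f
  ∑-⊖ r f = begin
    ∑ F r (λ i → ⊖ f i)       ≡⟨ ∑-cong r (λ i → sym (trans (solve 2 (λ o x → :- o :* x := :- (o :* x)) refl 1# (f i)) (cong ⊖_ (*-identityˡ (f i))))) ⟩
    ∑ F r (λ i → ⊖ 1# ⊗ f i)  ≡⟨ ∑-⊗ˡ r (⊖ 1#) f ⟩
    ⊖ 1# ⊗ ∑ F r f            ≡⟨ solve 2 (λ o x → :- o :* x := :- (o :* x)) refl 1# (∑ F r f) ⟩
    ⊖ (1# ⊗ ∑ F r f)          ≡⟨ cong ⊖_ (*-identityˡ _) ⟩
    ⊖ ∑ F r f                 ∎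

  ∑-swap : ∀ r s (f : Fin r → Fin s → Carrier) →
    ∑ F r (λ i → ∑ F s (f i)) ≡ ∑ F s (λ j → ∑ F r (λ i → f i j))
  ∑-swap zero    s f = sym (∑-0 s (λ _ → refl))
  ∑-swap (suc r) s f = trans (cong (∑ F s (f zero) ⊕_) (∑-swap r s (f ∘ suc)))
    (sym (∑-⊕ s (f zero) (λ j → ∑ F r (λ i → f (suc i) j))))

  ∑-+ : ∀ r s (f : Fin (r + s) → Carrier) →
    ∑ F (r + s) f ≡ ∑ F r (λ i → f (i ↑ˡ s)) ⊕ ∑ F s (λ j → f (r ↑ʳ j))
  ∑-+ zero    s f = sym (+-identityˡ _)
  ∑-+ (suc r) s f = trans (cong (f zero ⊕_) (∑-+ r s (f ∘ suc))) (sym (+-assoc _ _ _))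

  ∑-* : ∀ r s (f : Fin (r * s) → Carrier) →
    ∑ F (r * s) f ≡ ∑ F r (λ i → ∑ F s (λ j → f (combine i j)))
  ∑-* zero    s f = refl
  ∑-* (suc r) s f = trans (∑-+ s (r * s) f) (cong (∑ F s (λ j → f (j ↑ˡ r * s)) ⊕_) (∑-* r s (λ i → f (s ↑ʳ i))))

  idEntry-suc : ∀ {n} (i j : Fin n) → idEntry F (Fin.suc i) (suc j) ≡ idEntry F i j
  idEntry-suc i j with i Fin.≟ j
  ... | yes _ = refl
  ... | no  _ = refl

  ∑-idEntryʳ : ∀ {n} (c : Fin n → Carrier) j → ∑ F n (λ i → c i ⊗ idEntry F i j) ≡ c j
  ∑-idEntryʳ {suc n} c zero = trans (cong₂ _⊕_ (*-identityʳ _) (∑-0 n (λ i → zeroʳ _))) (+-identityʳ _)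
  ∑-idEntryʳ {suc n} c (suc j) = begin
    c zero ⊗ 0# ⊕ ∑ F n (λ i → c (suc i) ⊗ idEntry F (Fin.suc i) (suc j))
      ≡⟨ cong₂ _⊕_ (zeroʳ _) (∑-cong n (λ i → cong (c (suc i) ⊗_) (idEntry-suc i j))) ⟩
    0# ⊕ ∑ F n (λ i → c (suc i) ⊗ idEntry F i j)
      ≡⟨ +-identityˡ _ ⟩
    ∑ F n (λ i → c (suc i) ⊗ idEntry F i j)
      ≡⟨ ∑-idEntryʳ (c ∘ suc) j ⟩
    c (suc j) ∎

  ∑-idEntryˡ : ∀ {n} (f : Fin n → Carrier) i → ∑ F n (λ j → idEntry F i j ⊗ f j) ≡ f i
  ∑-idEntryˡ {suc n} f zero = trans (cong₂ _⊕_ (*-identityˡ _) (∑-0 n (λ j → zeroˡ _))) (+-identityʳ _)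
  ∑-idEntryˡ {suc n} f (suc i) = begin
    0# ⊗ f zero ⊕ ∑ F n (λ j → idEntry F (Fin.suc i) (suc j) ⊗ f (suc j))
      ≡⟨ cong₂ _⊕_ (zeroˡ _) (∑-cong n (λ j → cong (_⊗ f (suc j)) (idEntry-suc i j))) ⟩
    0# ⊕ ∑ F n (λ j → idEntry F i j ⊗ f (suc j))
      ≡⟨ +-identityˡ _ ⟩
    ∑ F n (λ j → idEntry F i j ⊗ f (suc j))
      ≡⟨ ∑-idEntryˡ (f ∘ suc) i ⟩
    f (suc i) ∎

  sum≡∑ : ∀ r (f : Fin r → Carrier) → Algebra.Properties.Semiring.Sum.sum semiring f ≡ ∑ F r f
  sum≡∑ zero    f = refl
  sum≡∑ (suc r) f = cong (f zero ⊕_) (sum≡∑ r (f ∘ suc))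

  fromFin : Fin size → Carrier
  fromFin = Inverse.to enumeration

  toFin : Carrier → Fin size
  toFin = Inverse.from enumeration

  fromFin-toFin : ∀ x → fromFin (toFin x) ≡ x
  fromFin-toFin x = Inverse.inverseˡ enumeration refl

  toFin-fromFin : ∀ i → toFin (fromFin i) ≡ i
  toFin-fromFin i = Inverse.inverseʳ enumeration refl

  2≤size : 2 ≤ size
  2≤size with size ℕ.≤? 1
  ... | no s≰1 = ℕₚ.≰⇒> s≰1
  ... | yes s≤1 with Finₚ.pigeonhole (s≤s s≤1) (λ { zero → toFin 0# ; (suc zero) → toFin 1# })
  ...   | zero , suc zero , _ , e = contradiction
            (trans (sym (fromFin-toFin 0#)) (trans (cong fromFin e) (fromFin-toFin 1#))) 0≢1
  ...   | zero , zero , () , _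
  ...   | suc zero , suc zero , s≤s () , _

  size≢0 : ℕ.NonZero size
  size≢0 = ℕ.>-nonZero (ℕₚ.≤-trans (s≤s z≤n) 2≤size)

  size^-cancel-≤ : ∀ {m n} → size ^ m ≤ size ^ n → m ≤ n
  size^-cancel-≤ {m} {n} le with m ℕ.≤? n
  ... | yes m≤n = m≤n
  ... | no  m≰n = contradiction le (ℕₚ.<⇒≱ (ℕₚ.^-monoʳ-< size 2≤size (ℕₚ.≰⇒> m≰n)))

  encode : ∀ {r} → (Fin r → Carrier) → Fin (size ^ r)
  encode c = funToFin (toFin ∘ c)

  decode : ∀ {r} → Fin (size ^ r) → (Fin r → Carrier)
  decode i j = fromFin (finToFun i j)

  decode-encode : ∀ {r} (c : Fin r → Carrier) j → decode (encode c) j ≡ c j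
  decode-encode c j = trans (cong fromFin (Finₚ.finToFun-funToFin (toFin ∘ c) j)) (fromFin-toFin (c j))

  funToFin-cong : ∀ {m n} {f g : Fin m → Fin n} → (∀ i → f i ≡ g i) → funToFin f ≡ funToFin g
  funToFin-cong {zero}  e = refl
  funToFin-cong {suc m} e = cong₂ combine (e zero) (funToFin-cong (e ∘ suc))

  decode-injective : ∀ {r} {i j : Fin (size ^ r)} → (∀ l → decode {r} i l ≡ decode {r} j l) → i ≡ j
  decode-injective {r} {i} {j} e = begin
    i                                ≡⟨ Finₚ.funToFin-finToFin {r} i ⟨
    funToFin (finToFun {size} {r} i) ≡⟨ funToFin-cong {r} {f = finToFun {size} {r} i} {finToFun j} (λ l → trans (sym (toFin-fromFin _)) (trans (cong toFin (e l)) (toFin-fromFin _))) ⟩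
    funToFin (finToFun {size} {r} j) ≡⟨ Finₚ.funToFin-finToFin {r} j ⟩
    j                                ∎

  encode-injective : ∀ {r} {c d : Fin r → Carrier} → encode c ≡ encode d → ∀ i → c i ≡ d i
  encode-injective {c = c} {d} e i =
    trans (sym (decode-encode c i)) (trans (cong (λ x → decode x i) e) (decode-encode d i))

  -- Transported along `encode` and `decode`, `g` becomes an injection between finite sets of sizes
  -- q^e and q^d, and exponents can be compared because q ≥ 2.
  injective⇒≤ : ∀ {d e} (g : (Fin e → Carrier) → (Fin d → Carrier)) →
    (∀ b c → (∀ j → g b j ≡ g c j) → ∀ i → b i ≡ c i) → e ≤ d
  injective⇒≤ {d} {e} g inj = size^-cancel-≤ (Finₚ.injective⇒≤
    {f = λ (i : Fin (size ^ e)) → encode {d} (g (decode i))}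
    (λ {i} {j} eq → decode-injective {e} (inj (decode i) (decode j) (encode-injective {d} eq))))

  -- A search through the q^n codes. `resp` enters because `decode (encode x)` agrees with `x` only
  -- pointwise.
  any-vector? : ∀ {n} {P : (Fin n → Carrier) → Set} → (∀ {x y} → (∀ i → x i ≡ y i) → P x → P y) →
    (∀ x → Dec (P x)) → Dec (∃ P)
  any-vector? {n} resp P? with Finₚ.any? (λ (i : Fin (size ^ n)) → P? (decode i))
  ... | yes (i , p) = yes (decode i , p)
  ... | no ¬p = no λ (x , p) → ¬p (encode x , resp (sym ∘ decode-encode x) p)

-- Linear algebra: dimension, bases, rank and nullity.

module LinearAlgebra (F : FiniteField) where
  open FieldTheory F
  open ≡-Reasoning

  lincomb-congˡ : ∀ {r n} (v : Fin r → Vector F n) {c d : Fin r → Carrier} →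
    (∀ i → c i ≡ d i) → ∀ j → lincomb F c v j ≡ lincomb F d v j
  lincomb-congˡ {r} v c≗d j = ∑-cong r (λ i → cong (_⊗ v i j) (c≗d i))

  lincomb-congʳ : ∀ {r n} (c : Fin r → Carrier) {v w : Fin r → Vector F n} →
    (∀ i j → v i j ≡ w i j) → ∀ j → lincomb F c v j ≡ lincomb F c w j
  lincomb-congʳ {r} c v≗w j = ∑-cong r (λ i → cong (c i ⊗_) (v≗w i j))

  lincomb-lincomb : ∀ {r s n} (c : Fin r → Carrier) (M : Fin r → Vector F s) (w : Fin s → Vector F n) j →
    lincomb F c (λ i → lincomb F (M i) w) j ≡ lincomb F (lincomb F c M) w j
  lincomb-lincomb {r} {s} c M w j = begin
    ∑ F r (λ i → c i ⊗ ∑ F s (λ l → M i l ⊗ w l j))     ≡⟨ ∑-cong r (λ i → sym (∑-⊗ˡ s (c i) (λ l → M i l ⊗ w l j))) ⟩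
    ∑ F r (λ i → ∑ F s (λ l → c i ⊗ (M i l ⊗ w l j)))   ≡⟨ ∑-swap r s _ ⟩
    ∑ F s (λ l → ∑ F r (λ i → c i ⊗ (M i l ⊗ w l j)))   ≡⟨ ∑-cong s (λ l → ∑-cong r (λ i → sym (*-assoc _ _ _))) ⟩
    ∑ F s (λ l → ∑ F r (λ i → c i ⊗ M i l ⊗ w l j))     ≡⟨ ∑-cong s (λ l → ∑-⊗ʳ r (w l j) (λ i → c i ⊗ M i l)) ⟩
    ∑ F s (λ l → ∑ F r (λ i → c i ⊗ M i l) ⊗ w l j)     ∎

  lincomb-⊖ : ∀ {r n} (c d : Fin r → Carrier) (v : Fin r → Vector F n) j →
    lincomb F (λ i → c i ⊕ ⊖ d i) v j ≡ lincomb F c v j ⊕ ⊖ lincomb F d v j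
  lincomb-⊖ {r} c d v j = begin
    ∑ F r (λ i → (c i ⊕ ⊖ d i) ⊗ v i j)
      ≡⟨ ∑-cong r (λ i → solve 3 (λ c d v → (c :- d) :* v := c :* v :- d :* v) refl (c i) (d i) (v i j)) ⟩
    ∑ F r (λ i → c i ⊗ v i j ⊕ ⊖ (d i ⊗ v i j))
      ≡⟨ ∑-⊕ r _ _ ⟩
    ∑ F r (λ i → c i ⊗ v i j) ⊕ ∑ F r (λ i → ⊖ (d i ⊗ v i j))
      ≡⟨ cong (∑ F r (λ i → c i ⊗ v i j) ⊕_) (∑-⊖ r _) ⟩
    ∑ F r (λ i → c i ⊗ v i j) ⊕ ⊖ ∑ F r (λ i → d i ⊗ v i j) ∎

  lincomb-0 : ∀ {r n} {c : Fin r → Carrier} (v : Fin r → Vector F n) → (∀ i → c i ≡ 0#) → ∀ j → lincomb F c v j ≡ 0#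
  lincomb-0 {r} v c≡0 j = ∑-0 r (λ i → trans (cong (_⊗ v i j) (c≡0 i)) (zeroˡ _))

  lincomb-++ : ∀ {r s n} (c : Fin (r + s) → Carrier) (v : Fin r → Vector F n) (w : Fin s → Vector F n) j →
    lincomb F c (v Vector.++ w) j ≡ lincomb F (λ i → c (i ↑ˡ s)) v j ⊕ lincomb F (λ i → c (r ↑ʳ i)) w j
  lincomb-++ {r} {s} c v w j = trans (∑-+ r s _) (cong₂ _⊕_
    (∑-cong r (λ i → cong (λ x → c (i ↑ˡ s) ⊗ [ v , w ]′ x j) (Finₚ.splitAt-↑ˡ r i s)))
    (∑-cong s (λ i → cong (λ x → c (r ↑ʳ i) ⊗ [ v , w ]′ x j) (Finₚ.splitAt-↑ʳ r s i))))

  lincomb-++-++ : ∀ {r s n} (b : Fin r → Carrier) (d : Fin s → Carrier) (v : Fin r → Vector F n) (w : Fin s → Vector F n) j →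
    lincomb F (b Vector.++ d) (v Vector.++ w) j ≡ lincomb F b v j ⊕ lincomb F d w j
  lincomb-++-++ {r} {s} b d v w j = trans (lincomb-++ (b Vector.++ d) v w j) (cong₂ _⊕_
    (lincomb-congˡ v (λ i → cong [ b , d ]′ (Finₚ.splitAt-↑ˡ r i s)) j)
    (lincomb-congˡ w (λ i → cong [ b , d ]′ (Finₚ.splitAt-↑ʳ r s i)) j))

  LinIndep⇒injective : ∀ {r n} {v : Fin r → Vector F n} → LinIndep F v → ∀ {c d} →
    (∀ j → lincomb F c v j ≡ lincomb F d v j) → ∀ i → c i ≡ d i
  LinIndep⇒injective {v = v} ind {c} {d} e i = x⊖y≡0⇒x≡y
    (ind (λ i → c i ⊕ ⊖ d i) (λ j → trans (lincomb-⊖ c d v j) (x≡y⇒x⊖y≡0 (e j))) i)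

  -- Sending coefficients with respect to v to coefficients with respect to w is injective,
  -- so this is a comparison of q ^ e with q ^ d.
  LinIndep⇒≤ : ∀ {d e n} {v : Fin e → Vector F n} {w : Fin d → Vector F n} →
    LinIndep F v → (∀ i → RowSpace F w (v i)) → e ≤ d
  LinIndep⇒≤ {d} {e} {v = v} {w} ind inSpan = injective⇒≤ (λ c → lincomb F c M) (λ b c eq →
    LinIndep⇒injective {v = v} ind (λ j → trans (rewrite-in-w b j)
      (trans (lincomb-congˡ w eq j) (sym (rewrite-in-w c j)))))
    where
    M : Fin e → Vector F d
    M i = proj₁ (inSpan i)
    rewrite-in-w : ∀ c j → lincomb F c v j ≡ lincomb F (lincomb F c M) w j
    rewrite-in-w c j = trans (lincomb-congʳ c (λ i j → sym (proj₂ (inSpan i) j)) j) (lincomb-lincomb c M w j)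

  idEntry-LinIndep : ∀ {n} → LinIndep F (idEntry F {n})
  idEntry-LinIndep c e i = trans (sym (∑-idEntryʳ c i)) (e i)

  LinIndep⇒≤n : ∀ {e n} {v : Fin e → Vector F n} → LinIndep F v → e ≤ n
  LinIndep⇒≤n {v = v} ind = LinIndep⇒≤ ind (λ i → v i , ∑-idEntryʳ (v i))

  RowSpace? : ∀ {r n} (v : Fin r → Vector F n) x → Dec (RowSpace F v x)
  RowSpace? v x = any-vector? (λ c≗d e j → trans (lincomb-congˡ v (sym ∘ c≗d) j) (e j))
    (λ c → Finₚ.all? (λ j → lincomb F c v j ≟F x j))

  -- A nonzero coefficient of `x` in a relation could be inverted, which would place `x` in the span
  -- of `v`; with that coefficient zero, the relation involves `v` alone.
  LinIndep-∷ : ∀ {r n} {v : Fin r → Vector F n} {x} → LinIndep F v → ¬ RowSpace F v x → LinIndep F (x Vector.∷ v)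
  LinIndep-∷ {r} {n} {v} {x} ind x∉ c e = λ { zero → c₀≡0 ; (suc i) → ind (c ∘ suc) rest i }
    where
    c₀≡0 : c zero ≡ 0#
    c₀≡0 with c zero ≟F 0#
    ... | yes c₀≡0 = c₀≡0
    ... | no c₀≢0 with inverse (c zero) c₀≢0
    ...   | y , cy≡1 = contradiction ((λ i → ⊖ y ⊗ c (suc i)) , eq) x∉
      where
      eq : ∀ j → lincomb F (λ i → ⊖ y ⊗ c (suc i)) v j ≡ x j
      eq j = begin
        ∑ F r (λ i → ⊖ y ⊗ c (suc i) ⊗ v i j)     ≡⟨ ∑-cong r (λ i → *-assoc _ _ _) ⟩
        ∑ F r (λ i → ⊖ y ⊗ (c (suc i) ⊗ v i j))   ≡⟨ ∑-⊗ˡ r (⊖ y) _ ⟩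
        ⊖ y ⊗ S                                   ≡⟨ solve 4 (λ y S c x → :- y :* S := c :* y :* x :- y :* (c :* x :+ S)) refl y S (c zero) (x j) ⟩
        c zero ⊗ y ⊗ x j ⊕ ⊖ (y ⊗ (c zero ⊗ x j ⊕ S)) ≡⟨ cong₂ (λ a b → a ⊗ x j ⊕ ⊖ (y ⊗ b)) cy≡1 (e j) ⟩
        1# ⊗ x j ⊕ ⊖ (y ⊗ 0#)                     ≡⟨ cong₂ (λ a b → a ⊕ ⊖ b) (*-identityˡ (x j)) (zeroʳ y) ⟩
        x j ⊕ ⊖ 0#                                ≡⟨ cong (_⊕ ⊖ 0#) (+-identityʳ (x j)) ⟨
        x j ⊕ 0# ⊕ ⊖ 0#                           ≡⟨ solve 2 (λ x z → x :+ z :- z := x) refl (x j) 0# ⟩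
        x j                                       ∎
        where
        S = lincomb F (c ∘ suc) v j
    rest : ∀ j → lincomb F (c ∘ suc) v j ≡ 0#
    rest j = begin
      lincomb F (c ∘ suc) v j                   ≡⟨ +-identityˡ _ ⟨
      0# ⊕ lincomb F (c ∘ suc) v j              ≡⟨ cong (_⊕ lincomb F (c ∘ suc) v j) (trans (cong (_⊗ x j) c₀≡0) (zeroˡ (x j))) ⟨
      c zero ⊗ x j ⊕ lincomb F (c ∘ suc) v j    ≡⟨ e j ⟩
      0#                                        ∎

  record Basis {n} (U : Vector F n → Set) : Set where
    field
      dim      : ℕ
      vectors  : Fin dim → Vector F n
      linIndep : LinIndep F vectors
      member   : ∀ i → U (vectors i)
      spanning : ∀ x → U x → RowSpace F vectors x

    hasDim : HasDim F U dim
    hasDim = (vectors , linIndep , member) ,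
      λ (v , ind , v∈U) → contradiction (LinIndep⇒≤ ind (λ i → spanning (v i) (v∈U i))) (ℕₚ.<-irrefl refl)

  -- Vectors of `U` outside the current span are added as long as there are any. The invariant
  -- `n < fuel + r` makes running out of fuel impossible: more than `n` vectors of length `n` would
  -- be independent.
  basis : ∀ {n} (U : Vector F n → Set) → (∀ {x y} → (∀ i → x i ≡ y i) → U x → U y) → (∀ x → Dec (U x)) → Basis U
  basis {n} U resp U? = extend (suc n) {0} (λ ()) (λ _ _ ()) (λ ()) (ℕₚ.≤-reflexive (sym (ℕₚ.+-identityʳ (suc n))))
    where
    extend : ∀ fuel {r} (v : Fin r → Vector F n) → LinIndep F v → (∀ i → U (v i)) → n < fuel + r → Basis U
    extend zero v ind v∈U n<r = contradiction (LinIndep⇒≤n ind) (ℕₚ.<⇒≱ n<r)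
    extend (suc fuel) {r} v ind v∈U n<
      with any-vector? {P = λ x → U x × ¬ RowSpace F v x}
             (λ x≗y (x∈U , x∉) → resp x≗y x∈U , λ (c , e) → x∉ (c , λ j → trans (e j) (sym (x≗y j))))
             (λ x → U? x Decidable.×-dec Decidable.¬? (RowSpace? v x))
    ... | yes (x , x∈U , x∉) = extend fuel (x Vector.∷ v) (LinIndep-∷ ind x∉)
            (λ { zero → x∈U ; (suc i) → v∈U i }) (subst (n <_) (sym (ℕₚ.+-suc fuel r)) n<)
    ... | no none = record
            { vectors = v ; linIndep = ind ; member = v∈U
            ; spanning = λ x x∈U → Decidable.decidable-stable (RowSpace? v x) (λ x∉ → none (x , x∈U , x∉)) }

  HasDimAtLeast-≤ : ∀ {n} {U : Vector F n → Set} {d e} → d ≤ e → HasDimAtLeast F U e → HasDimAtLeast F U d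
  HasDimAtLeast-≤ {U = U} d≤e = go (ℕₚ.≤⇒≤′ d≤e)
    where
    go : ∀ {d e} → d ℕ.≤′ e → HasDimAtLeast F U e → HasDimAtLeast F U d
    go (ℕ.≤′-reflexive refl) h = h
    go (ℕ.≤′-step d≤e) (v , ind , v∈U) = go d≤e (v ∘ suc , tail-ind , v∈U ∘ suc)
      where
      tail-ind : LinIndep F (v ∘ suc)
      tail-ind c eq i = ind (0# Vector.∷ c) (λ j → trans (cong (_⊕ lincomb F c (v ∘ suc) j) (zeroˡ _)) (trans (+-identityˡ _) (eq j))) (suc i)

  HasDim⇒≤ : ∀ {n} {U : Vector F n → Set} {d e} → HasDim F U d → HasDimAtLeast F U e → e ≤ d
  HasDim⇒≤ {U = U} {d} {e} (_ , ¬more) h with e ℕ.≤? d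
  ... | yes e≤d = e≤d
  ... | no  e≰d = contradiction (HasDimAtLeast-≤ {U = U} (ℕₚ.≰⇒> e≰d) h) ¬more

  Kernel : ∀ {k m} → Matrix F k m → Vector F k → Set
  Kernel A u = ∀ j → lincomb F u A j ≡ 0#

  -- One half of rank-nullity. In a relation between kernel vectors and preimages, applying `A`
  -- removes the kernel part, so the coefficients of the preimages vanish, and then the others do.
  kernel+image≤ : ∀ {k m w r} (A : Matrix F k m) {u : Fin w → Vector F k} {t : Fin r → Vector F k} →
    LinIndep F u → (∀ i → Kernel A (u i)) → LinIndep F (λ i → lincomb F (t i) A) → w + r ≤ k
  kernel+image≤ {k} {m} {w} {r} A {u} {t} u-ind u∈ker tA-ind = LinIndep⇒≤n {v = u Vector.++ t} ind
    where
    ind : LinIndep F (u Vector.++ t)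
    ind c e i = subst (λ i → c i ≡ 0#) (Finₚ.join-splitAt w r i) (c≡0 (splitAt w i))
      where
      c₁ : Fin w → Carrier
      c₁ i = c (i ↑ˡ r)
      c₂ : Fin r → Carrier
      c₂ i = c (w ↑ʳ i)
      e′ : ∀ l → lincomb F c₁ u l ⊕ lincomb F c₂ t l ≡ 0#
      e′ l = trans (sym (lincomb-++ c u t l)) (e l)
      c₂≡0 : ∀ i → c₂ i ≡ 0#
      c₂≡0 = tA-ind c₂ λ j → begin
        lincomb F c₂ (λ i → lincomb F (t i) A) j                         ≡⟨ lincomb-lincomb c₂ t A j ⟩
        lincomb F (lincomb F c₂ t) A j                                   ≡⟨ +-identityˡ _ ⟨
        0# ⊕ lincomb F (lincomb F c₂ t) A j                              ≡⟨ cong (_⊕ lincomb F (lincomb F c₂ t) A j) (trans (sym (lincomb-lincomb c₁ u A j)) (∑-0 w (λ i → trans (cong (c₁ i ⊗_) (u∈ker i j)) (zeroʳ (c₁ i))))) ⟨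
        lincomb F (lincomb F c₁ u) A j ⊕ lincomb F (lincomb F c₂ t) A j  ≡⟨ ∑-⊕ k _ _ ⟨
        ∑ F k (λ l → lincomb F c₁ u l ⊗ A l j ⊕ lincomb F c₂ t l ⊗ A l j) ≡⟨ ∑-cong k (λ l → sym (distribʳ (A l j) _ _)) ⟩
        ∑ F k (λ l → (lincomb F c₁ u l ⊕ lincomb F c₂ t l) ⊗ A l j)      ≡⟨ lincomb-0 A e′ j ⟩
        0#                                                               ∎
      c₁≡0 : ∀ i → c₁ i ≡ 0#
      c₁≡0 = u-ind c₁ λ l → begin
        lincomb F c₁ u l                      ≡⟨ +-identityʳ _ ⟨
        lincomb F c₁ u l ⊕ 0#                 ≡⟨ cong (lincomb F c₁ u l ⊕_) (lincomb-0 t c₂≡0 l) ⟨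
        lincomb F c₁ u l ⊕ lincomb F c₂ t l   ≡⟨ e′ l ⟩
        0#                                    ∎
      c≡0 : ∀ x → c (Fin.join w r x) ≡ 0#
      c≡0 (inj₁ i) = c₁≡0 i
      c≡0 (inj₂ i) = c₂≡0 i

  rowSpaceBasis : ∀ {k m} (A : Matrix F k m) → Basis (RowSpace F A)
  rowSpaceBasis A = basis (RowSpace F A) (λ x≗y (c , e) → c , λ j → trans (e j) (x≗y j)) (RowSpace? A)

  -- The other half. Subtracting from `x` a combination of preimages with the same image leaves a
  -- kernel vector, so a basis of the kernel and preimages of a basis of the row space together span
  -- everything; comparison with the unit vectors gives the inequality.
  rank-nullity : ∀ {k m} (A : Matrix F k m) → ∃[ r ] ∃[ s ] (HasRank F A r × HasDimAtLeast F (Kernel A) s × k ≤ s + r)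
  rank-nullity {k} {m} A = R.dim , K.dim , R.hasDim , proj₁ K.hasDim , LinIndep⇒≤ idEntry-LinIndep (λ i → inSpan (idEntry F i))
    where
    module R = Basis (rowSpaceBasis A)
    module K = Basis (basis (Kernel A) (λ x≗y e j → trans (lincomb-congˡ A (sym ∘ x≗y) j) (e j))
      (λ u → Finₚ.all? (λ j → lincomb F u A j ≟F 0#)))
    t : Fin R.dim → Vector F k
    t i = proj₁ (R.member i)
    inSpan : ∀ x → RowSpace F (K.vectors Vector.++ t) x
    inSpan x = b Vector.++ d , λ l → begin
      lincomb F (b Vector.++ d) (K.vectors Vector.++ t) l   ≡⟨ lincomb-++-++ b d K.vectors t l ⟩
      lincomb F b K.vectors l ⊕ lincomb F d t l             ≡⟨ cong (_⊕ lincomb F d t l) (proj₂ remainder l) ⟩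
      x l ⊕ ⊖ lincomb F d t l ⊕ lincomb F d t l             ≡⟨ x⊖y⊕y≡x (x l) (lincomb F d t l) ⟩
      x l                                                   ∎
      where
      image : RowSpace F R.vectors (lincomb F x A)
      image = R.spanning (lincomb F x A) (x , λ _ → refl)
      d : Fin R.dim → Carrier
      d = proj₁ image
      dtA≡xA : ∀ j → lincomb F (lincomb F d t) A j ≡ lincomb F x A j
      dtA≡xA j = begin
        lincomb F (lincomb F d t) A j           ≡⟨ lincomb-lincomb d t A j ⟨
        lincomb F d (λ i → lincomb F (t i) A) j ≡⟨ lincomb-congʳ d (λ i j → proj₂ (R.member i) j) j ⟩
        lincomb F d R.vectors j                 ≡⟨ proj₂ image j ⟩
        lincomb F x A j                         ∎
      remainder : RowSpace F K.vectors (λ l → x l ⊕ ⊖ lincomb F d t l)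
      remainder = K.spanning _ (λ j → trans (lincomb-⊖ x (lincomb F d t) A j) (x≡y⇒x⊖y≡0 (sym (dtA≡xA j))))
      b : Fin K.dim → Carrier
      b = proj₁ remainder

-- Polynomials over a finite field.

-- Coefficient lists in increasing degree; trailing zeros are identified by _≈_.
module Polynomial (L : FiniteField) where
  open FieldTheory L

  Poly : Set
  Poly = List Carrier

  coeff : Poly → ℕ → Carrier
  coeff []      n       = 0#
  coeff (a ∷ p) zero    = a
  coeff (a ∷ p) (suc n) = coeff p n

  infix 4 _≈_
  -- A record, so that `p` and `q` can be inferred from the type; the bare family of equations
  -- between coefficients would not determine them.
  record _≈_ (p q : Poly) : Set where
    constructor coeffwise
    field at : ∀ n → coeff p n ≡ coeff q n
  open _≈_ public

  infixl 6 _⊞_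
  infixl 7 _⊠_ _·_
  infix  8 ⊟_

  _⊞_ : Poly → Poly → Poly
  []      ⊞ q       = q
  (a ∷ p) ⊞ []      = a ∷ p
  (a ∷ p) ⊞ (b ∷ q) = a ⊕ b ∷ p ⊞ q

  _·_ : Carrier → Poly → Poly
  a · p = List.map (a ⊗_) p

  ⊟_ : Poly → Poly
  ⊟ p = List.map ⊖_ p

  _⊠_ : Poly → Poly → Poly
  []      ⊠ q = []
  (a ∷ p) ⊠ q = a · q ⊞ (0# ∷ p ⊠ q)

  ≈-refl : ∀ {p} → p ≈ p
  ≈-refl = coeffwise λ _ → refl

  ≈-sym : ∀ {p q} → p ≈ q → q ≈ p
  ≈-sym e = coeffwise λ n → sym (at e n)

  ≈-trans : ∀ {p q r} → p ≈ q → q ≈ r → p ≈ r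
  ≈-trans e f = coeffwise λ n → trans (at e n) (at f n)

  ⊖0≡0 : ⊖ 0# ≡ 0#
  ⊖0≡0 = trans (sym (+-identityˡ _)) (-‿inverseʳ 0#)

  coeff-⊞ : ∀ p q n → coeff (p ⊞ q) n ≡ coeff p n ⊕ coeff q n
  coeff-⊞ []      q       n       = sym (+-identityˡ _)
  coeff-⊞ (a ∷ p) []      n       = sym (+-identityʳ _)
  coeff-⊞ (a ∷ p) (b ∷ q) zero    = refl
  coeff-⊞ (a ∷ p) (b ∷ q) (suc n) = coeff-⊞ p q n

  coeff-· : ∀ a p n → coeff (a · p) n ≡ a ⊗ coeff p n
  coeff-· a []      n       = sym (zeroʳ a)
  coeff-· a (b ∷ p) zero    = refl
  coeff-· a (b ∷ p) (suc n) = coeff-· a p n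

  coeff-⊟ : ∀ p n → coeff (⊟ p) n ≡ ⊖ coeff p n
  coeff-⊟ []      n       = sym ⊖0≡0
  coeff-⊟ (b ∷ p) zero    = refl
  coeff-⊟ (b ∷ p) (suc n) = coeff-⊟ p n

  ∷-cong : ∀ {a b p q} → a ≡ b → p ≈ q → a ∷ p ≈ b ∷ q
  ∷-cong a≡b p≈q = coeffwise λ { zero → a≡b ; (suc n) → at p≈q n }

  0∷-zero : 0# ∷ [] ≈ []
  0∷-zero = coeffwise λ { zero → refl ; (suc n) → refl }

  ⊞-cong : ∀ {p p′ q q′} → p ≈ p′ → q ≈ q′ → p ⊞ q ≈ p′ ⊞ q′
  ⊞-cong {p} {p′} {q} {q′} e f = coeffwise λ n →
    trans (coeff-⊞ p q n) (trans (cong₂ _⊕_ (at e n) (at f n)) (sym (coeff-⊞ p′ q′ n)))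

  ·-cong : ∀ {a b p q} → a ≡ b → p ≈ q → a · p ≈ b · q
  ·-cong {a} {b} {p} {q} a≡b e = coeffwise λ n →
    trans (coeff-· a p n) (trans (cong₂ _⊗_ a≡b (at e n)) (sym (coeff-· b q n)))

  ⊟-cong : ∀ {p q} → p ≈ q → ⊟ p ≈ ⊟ q
  ⊟-cong {p} {q} e = coeffwise λ n → trans (coeff-⊟ p n) (trans (cong ⊖_ (at e n)) (sym (coeff-⊟ q n)))

  ⊞-assoc : ∀ p q r → (p ⊞ q) ⊞ r ≈ p ⊞ (q ⊞ r)
  ⊞-assoc []      q       r       = ≈-refl
  ⊞-assoc (a ∷ p) []      r       = ≈-refl
  ⊞-assoc (a ∷ p) (b ∷ q) []      = ≈-refl
  ⊞-assoc (a ∷ p) (b ∷ q) (c ∷ r) = ∷-cong (+-assoc a b c) (⊞-assoc p q r)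

  ⊞-comm : ∀ p q → p ⊞ q ≈ q ⊞ p
  ⊞-comm p q = coeffwise λ n → trans (coeff-⊞ p q n) (trans (+-comm _ _) (sym (coeff-⊞ q p n)))

  ⊞-identityʳ : ∀ p → p ⊞ [] ≈ p
  ⊞-identityʳ p = ⊞-comm p []

  ⊟-inverseʳ : ∀ p → p ⊞ ⊟ p ≈ []
  ⊟-inverseʳ p = coeffwise λ n → trans (coeff-⊞ p (⊟ p) n) (trans (cong (coeff p n ⊕_) (coeff-⊟ p n)) (-‿inverseʳ _))

  0·p≈0 : ∀ p → 0# · p ≈ []
  0·p≈0 p = coeffwise λ n → trans (coeff-· 0# p n) (zeroˡ _)

  1·p≈p : ∀ p → 1# · p ≈ p
  1·p≈p p = coeffwise λ n → trans (coeff-· 1# p n) (*-identityˡ _)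

  ·-⊞ : ∀ a p q → a · (p ⊞ q) ≈ a · p ⊞ a · q
  ·-⊞ a []      q       = ≈-refl
  ·-⊞ a (b ∷ p) []      = ≈-refl
  ·-⊞ a (b ∷ p) (c ∷ q) = ∷-cong (distribˡ a b c) (·-⊞ a p q)

  ⊕-· : ∀ a b p → (a ⊕ b) · p ≈ a · p ⊞ b · p
  ⊕-· a b []      = ≈-refl
  ⊕-· a b (c ∷ p) = ∷-cong (distribʳ c a b) (⊕-· a b p)

  ⊗-· : ∀ a b p → (a ⊗ b) · p ≈ a · (b · p)
  ⊗-· a b []      = ≈-refl
  ⊗-· a b (c ∷ p) = ∷-cong (*-assoc a b c) (⊗-· a b p)

  ⊞-interchange : ∀ p q r s → (p ⊞ q) ⊞ (r ⊞ s) ≈ (p ⊞ r) ⊞ (q ⊞ s)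
  ⊞-interchange p q r s = coeffwise λ n → trans (expand p q r s n)
    (trans (⊕-interchange _ _ _ _) (sym (expand p r q s n)))
    where
    expand : ∀ p q r s n → coeff ((p ⊞ q) ⊞ (r ⊞ s)) n ≡ (coeff p n ⊕ coeff q n) ⊕ (coeff r n ⊕ coeff s n)
    expand p q r s n = trans (coeff-⊞ (p ⊞ q) (r ⊞ s) n) (cong₂ _⊕_ (coeff-⊞ p q n) (coeff-⊞ r s n))

  shift-⊞ : ∀ p q → 0# ∷ (p ⊞ q) ≈ (0# ∷ p) ⊞ (0# ∷ q)
  shift-⊞ p q = ∷-cong (sym (+-identityˡ 0#)) ≈-refl

  shift-· : ∀ a p → 0# ∷ a · p ≈ a · (0# ∷ p)
  shift-· a p = ∷-cong (sym (zeroʳ a)) ≈-refl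

  ⊠-congˡ : ∀ p {q q′} → q ≈ q′ → p ⊠ q ≈ p ⊠ q′
  ⊠-congˡ []      e = ≈-refl
  ⊠-congˡ (a ∷ p) e = ⊞-cong (·-cong refl e) (∷-cong refl (⊠-congˡ p e))

  ⊠-zeroʳ : ∀ p → p ⊠ [] ≈ []
  ⊠-zeroʳ []      = ≈-refl
  ⊠-zeroʳ (a ∷ p) = ≈-trans (∷-cong refl (⊠-zeroʳ p)) 0∷-zero

  -- The mirror image of the recursion that defines `_⊠_`. It makes commutativity a plain induction,
  -- and commutativity then gives congruence in the first factor.
  ⊠-∷ʳ : ∀ p b q → p ⊠ (b ∷ q) ≈ b · p ⊞ (0# ∷ p ⊠ q)
  ⊠-∷ʳ []      b q = ≈-sym 0∷-zero
  ⊠-∷ʳ (a ∷ p) b q = ∷-cong (cong (_⊕ 0#) (*-comm a b)) (≈-trans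
    (⊞-cong {a · q} ≈-refl (⊠-∷ʳ p b q)) (≈-trans
    (≈-sym (⊞-assoc (a · q) (b · p) _)) (≈-trans
    (⊞-cong (⊞-comm (a · q) (b · p)) ≈-refl)
    (⊞-assoc (b · p) (a · q) _))))

  ⊠-comm : ∀ p q → p ⊠ q ≈ q ⊠ p
  ⊠-comm []      q = ≈-sym (⊠-zeroʳ q)
  ⊠-comm (a ∷ p) q = ≈-trans (⊞-cong {a · q} ≈-refl (∷-cong refl (⊠-comm p q))) (≈-sym (⊠-∷ʳ q a p))

  ⊠-cong : ∀ {p p′ q q′} → p ≈ p′ → q ≈ q′ → p ⊠ q ≈ p′ ⊠ q′
  ⊠-cong {p} {p′} {q} {q′} e f = ≈-trans (⊠-congˡ p f) (≈-trans (⊠-comm p q′)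
    (≈-trans (⊠-congˡ q′ e) (⊠-comm q′ p′)))

  ⊠-distribʳ : ∀ r p q → (p ⊞ q) ⊠ r ≈ p ⊠ r ⊞ q ⊠ r
  ⊠-distribʳ r []      q       = ≈-refl
  ⊠-distribʳ r (a ∷ p) []      = ≈-sym (⊞-identityʳ _)
  ⊠-distribʳ r (a ∷ p) (b ∷ q) = ≈-trans
    (⊞-cong (⊕-· a b r) (≈-trans (∷-cong refl (⊠-distribʳ r p q)) (shift-⊞ (p ⊠ r) (q ⊠ r))))
    (⊞-interchange (a · r) (b · r) _ _)

  ⊠-distribˡ : ∀ r p q → r ⊠ (p ⊞ q) ≈ r ⊠ p ⊞ r ⊠ q
  ⊠-distribˡ r p q = ≈-trans (⊠-comm r (p ⊞ q)) (≈-trans (⊠-distribʳ r p q)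
    (⊞-cong (⊠-comm p r) (⊠-comm q r)))

  ·-⊠ : ∀ a p q → (a · p) ⊠ q ≈ a · (p ⊠ q)
  ·-⊠ a []      q = ≈-refl
  ·-⊠ a (b ∷ p) q = ≈-trans
    (⊞-cong (⊗-· a b q) (≈-trans (∷-cong refl (·-⊠ a p q)) (shift-· a (p ⊠ q))))
    (≈-sym (·-⊞ a (b · q) _))

  shift-⊠ : ∀ p q → (0# ∷ p) ⊠ q ≈ 0# ∷ p ⊠ q
  shift-⊠ p q = ⊞-cong (0·p≈0 q) ≈-refl

  ⊠-assoc : ∀ p q r → (p ⊠ q) ⊠ r ≈ p ⊠ (q ⊠ r)
  ⊠-assoc []      q r = ≈-refl
  ⊠-assoc (a ∷ p) q r = ≈-trans (⊠-distribʳ r (a · q) (0# ∷ p ⊠ q))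
    (⊞-cong (·-⊠ a q r) (≈-trans (shift-⊠ (p ⊠ q) r) (∷-cong refl (⊠-assoc p q r))))

  ⊠-identityˡ : ∀ p → (1# ∷ []) ⊠ p ≈ p
  ⊠-identityˡ p = ≈-trans (⊞-cong (1·p≈p p) 0∷-zero) (⊞-identityʳ p)

  polyRing : CommutativeRing 0ℓ 0ℓ
  polyRing = record
    { Carrier = Poly ; _≈_ = _≈_ ; _+_ = _⊞_ ; _*_ = _⊠_ ; -_ = ⊟_ ; 0# = [] ; 1# = 1# ∷ []
    ; isCommutativeRing = record
      { isRing = record
        { +-isAbelianGroup = record
          { isGroup = record
            { isMonoid = record
              { isSemigroup = record
                { isMagma = record
                  { isEquivalence = record { refl = ≈-refl ; sym = ≈-sym ; trans = ≈-trans }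
                  ; ∙-cong = ⊞-cong }
                ; assoc = ⊞-assoc }
              ; identity = (λ _ → ≈-refl) , ⊞-identityʳ }
            ; inverse = (λ p → ≈-trans (⊞-comm (⊟ p) p) (⊟-inverseʳ p)) , ⊟-inverseʳ
            ; ⁻¹-cong = ⊟-cong }
          ; comm = ⊞-comm }
        ; *-cong = ⊠-cong
        ; *-assoc = ⊠-assoc
        ; *-identity = ⊠-identityˡ , λ p → ≈-trans (⊠-comm p _) (⊠-identityˡ p)
        ; distrib = ⊠-distribˡ , ⊠-distribʳ }
      ; *-comm = ⊠-comm } }

  ≈[]-∷ : ∀ {a p} → a ∷ p ≈ [] → a ≡ 0# × p ≈ []
  ≈[]-∷ e = at e 0 , coeffwise (λ n → at e (suc n))

-- Field homomorphisms and evaluation.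

record FieldHom (K L : FiniteField) : Set where
  private
    module K = FieldTheory K
    module L = FieldTheory L
  field
    ⟦_⟧    : K.Carrier → L.Carrier
    ⊕-homo : ∀ x y → ⟦ x K.⊕ y ⟧ ≡ ⟦ x ⟧ L.⊕ ⟦ y ⟧
    ⊗-homo : ∀ x y → ⟦ x K.⊗ y ⟧ ≡ ⟦ x ⟧ L.⊗ ⟦ y ⟧
    1-homo : ⟦ K.1# ⟧ ≡ L.1#

  0-homo : ⟦ K.0# ⟧ ≡ L.0#
  0-homo = begin
    ⟦ K.0# ⟧                                      ≡⟨ L.solve 1 (λ x → x L.:= (x L.:+ x) L.:- x) refl _ ⟩
    ⟦ K.0# ⟧ L.⊕ ⟦ K.0# ⟧ L.⊕ L.⊖ ⟦ K.0# ⟧       ≡⟨ cong (L._⊕ L.⊖ ⟦ K.0# ⟧) (⊕-homo _ _) ⟨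
    ⟦ K.0# K.⊕ K.0# ⟧ L.⊕ L.⊖ ⟦ K.0# ⟧           ≡⟨ cong (λ x → ⟦ x ⟧ L.⊕ L.⊖ ⟦ K.0# ⟧) (K.+-identityˡ _) ⟩
    ⟦ K.0# ⟧ L.⊕ L.⊖ ⟦ K.0# ⟧                    ≡⟨ L.-‿inverseʳ _ ⟩
    L.0#                                         ∎
    where open ≡-Reasoning

  ⊖-homo : ∀ x → ⟦ K.⊖ x ⟧ ≡ L.⊖ ⟦ x ⟧
  ⊖-homo x = begin
    ⟦ K.⊖ x ⟧                             ≡⟨ L.solve 2 (λ y z → y L.:= (y L.:+ z) L.:- z) refl _ ⟦ x ⟧ ⟩
    ⟦ K.⊖ x ⟧ L.⊕ ⟦ x ⟧ L.⊕ L.⊖ ⟦ x ⟧    ≡⟨ cong (L._⊕ L.⊖ ⟦ x ⟧) (trans (sym (⊕-homo _ _)) (trans (cong ⟦_⟧ (K.-‿inverseˡ x)) 0-homo)) ⟩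
    L.0# L.⊕ L.⊖ ⟦ x ⟧                   ≡⟨ L.+-identityˡ _ ⟩
    L.⊖ ⟦ x ⟧                            ∎
    where open ≡-Reasoning

  injective : ∀ {x y} → ⟦ x ⟧ ≡ ⟦ y ⟧ → x ≡ y
  injective {x} {y} e with x K.⊕ K.⊖ y K.≟F K.0#
  ... | yes z = K.x⊖y≡0⇒x≡y z
  ... | no nz with K.inverse _ nz
  ...   | w , i = contradiction (sym (begin
    L.1#                             ≡⟨ 1-homo ⟨
    ⟦ K.1# ⟧                         ≡⟨ cong ⟦_⟧ i ⟨
    ⟦ (x K.⊕ K.⊖ y) K.⊗ w ⟧          ≡⟨ ⊗-homo _ _ ⟩
    ⟦ x K.⊕ K.⊖ y ⟧ L.⊗ ⟦ w ⟧        ≡⟨ cong (L._⊗ ⟦ w ⟧) (trans (⊕-homo _ _) (trans (cong (⟦ x ⟧ L.⊕_) (⊖-homo y)) (L.x≡y⇒x⊖y≡0 e))) ⟩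
    L.0# L.⊗ ⟦ w ⟧                   ≡⟨ L.zeroˡ _ ⟩
    L.0#                             ∎)) L.0≢1
    where open ≡-Reasoning

idHom : ∀ K → FieldHom K K
idHom K = record { ⟦_⟧ = id ; ⊕-homo = λ _ _ → refl ; ⊗-homo = λ _ _ → refl ; 1-homo = refl }

_∘ʰ_ : ∀ {K L M} → FieldHom L M → FieldHom K L → FieldHom K M
g ∘ʰ f = record
  { ⟦_⟧ = g.⟦_⟧ ∘ f.⟦_⟧
  ; ⊕-homo = λ x y → trans (cong g.⟦_⟧ (f.⊕-homo x y)) (g.⊕-homo _ _)
  ; ⊗-homo = λ x y → trans (cong g.⟦_⟧ (f.⊗-homo x y)) (g.⊗-homo _ _)
  ; 1-homo = trans (cong g.⟦_⟧ f.1-homo) g.1-homo }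
  where
  module f = FieldHom f
  module g = FieldHom g

module Evaluation {K L : FiniteField} (φ : FieldHom K L) where
  private
    module K = FieldTheory K
  open FieldTheory L
  open Polynomial K
  open FieldHom φ
  open ≡-Reasoning

  -- Coefficients lie in `K` and points in `L`, so that one function covers evaluation inside a
  -- field, through `idHom`, and roots in an extension.
  eval : Poly → Carrier → Carrier
  eval []      x = 0#
  eval (a ∷ p) x = ⟦ a ⟧ ⊕ x ⊗ eval p x

  eval-≈[] : ∀ p x → p ≈ [] → eval p x ≡ 0#
  eval-≈[] []      x e = refl
  eval-≈[] (a ∷ p) x e with ≈[]-∷ e
  ... | refl , p≈[] = trans (cong₂ (λ y z → y ⊕ x ⊗ z) 0-homo (eval-≈[] p x p≈[]))
          (trans (+-identityˡ _) (zeroʳ x))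

  eval-⊞ : ∀ p q x → eval (p ⊞ q) x ≡ eval p x ⊕ eval q x
  eval-⊞ []      q       x = sym (+-identityˡ _)
  eval-⊞ (a ∷ p) []      x = sym (+-identityʳ _)
  eval-⊞ (a ∷ p) (b ∷ q) x = begin
    ⟦ a K.⊕ b ⟧ ⊕ x ⊗ eval (p ⊞ q) x               ≡⟨ cong₂ (λ y z → y ⊕ x ⊗ z) (⊕-homo a b) (eval-⊞ p q x) ⟩
    ⟦ a ⟧ ⊕ ⟦ b ⟧ ⊕ x ⊗ (eval p x ⊕ eval q x)      ≡⟨ solve 5 (λ a b x p q → a :+ b :+ x :* (p :+ q) := (a :+ x :* p) :+ (b :+ x :* q)) refl ⟦ a ⟧ ⟦ b ⟧ x (eval p x) (eval q x) ⟩
    (⟦ a ⟧ ⊕ x ⊗ eval p x) ⊕ (⟦ b ⟧ ⊕ x ⊗ eval q x) ∎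

  eval-· : ∀ a p x → eval (a · p) x ≡ ⟦ a ⟧ ⊗ eval p x
  eval-· a []      x = sym (zeroʳ _)
  eval-· a (b ∷ p) x = trans (cong₂ (λ y z → y ⊕ x ⊗ z) (⊗-homo a b) (eval-· a p x))
    (solve 4 (λ a b x p → a :* b :+ x :* (a :* p) := a :* (b :+ x :* p)) refl ⟦ a ⟧ ⟦ b ⟧ x (eval p x))

  eval-⊠ : ∀ p q x → eval (p ⊠ q) x ≡ eval p x ⊗ eval q x
  eval-⊠ []      q x = sym (zeroˡ _)
  eval-⊠ (a ∷ p) q x = begin
    eval (a · q ⊞ (K.0# ∷ p ⊠ q)) x                       ≡⟨ eval-⊞ (a · q) (K.0# ∷ p ⊠ q) x ⟩
    eval (a · q) x ⊕ (⟦ K.0# ⟧ ⊕ x ⊗ eval (p ⊠ q) x)      ≡⟨ cong₂ _⊕_ (eval-· a q x) (trans (cong₂ (λ y z → y ⊕ x ⊗ z) 0-homo (eval-⊠ p q x)) (+-identityˡ _)) ⟩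
    ⟦ a ⟧ ⊗ eval q x ⊕ x ⊗ (eval p x ⊗ eval q x)          ≡⟨ solve 4 (λ a x p q → a :* q :+ x :* (p :* q) := (a :+ x :* p) :* q) refl ⟦ a ⟧ x (eval p x) (eval q x) ⟩
    (⟦ a ⟧ ⊕ x ⊗ eval p x) ⊗ eval q x                     ∎

  eval-⊟ : ∀ p x → eval (⊟ p) x ≡ ⊖ eval p x
  eval-⊟ []      x = sym (trans (sym (+-identityˡ _)) (-‿inverseʳ 0#))
  eval-⊟ (a ∷ p) x = trans (cong₂ (λ y z → y ⊕ x ⊗ z) (⊖-homo a) (eval-⊟ p x))
    (solve 3 (λ a x p → :- a :+ x :* :- p := :- (a :+ x :* p)) refl ⟦ a ⟧ x (eval p x))

  -- Passing to `p ⊞ ⊟ q` leaves only the comparison with zero; a direct induction would have to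
  -- align lists of different lengths.
  eval-cong : ∀ {p q} x → p ≈ q → eval p x ≡ eval q x
  eval-cong {p} {q} x e = x⊖y≡0⇒x≡y (trans (cong (eval p x ⊕_) (sym (eval-⊟ q x)))
    (trans (sym (eval-⊞ p (⊟ q) x)) (eval-≈[] (p ⊞ ⊟ q) x (≈-trans (⊞-cong e ≈-refl) (⊟-inverseʳ q)))))

  eval-const : ∀ a x → eval (a ∷ []) x ≡ ⟦ a ⟧
  eval-const a x = trans (cong (⟦ a ⟧ ⊕_) (zeroʳ x)) (+-identityʳ _)

-- Roots, division with remainder, and the Euclidean algorithm.

module Division (L : FiniteField) where
  open FieldTheory L
  open Polynomial L
  open Evaluation (idHom L)
  private
    module P = RingIdentities polyRing
    module ≈-Reasoning = Relation.Binary.Reasoning.Setoid (CommutativeRing.setoid polyRing)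

  -- Only the lower coefficients are stored: the degree is then part of the type and the leading
  -- coefficient is 1 by construction.
  monic : ∀ {d} → Vec Carrier d → Poly
  monic v = Vec.toList v List.++ (1# ∷ [])

  X : Poly
  X = 0# ∷ 1# ∷ []

  X⊠ : ∀ p → X ⊠ p ≈ 0# ∷ p
  X⊠ p = ≈-trans (shift-⊠ (1# ∷ []) p) (∷-cong refl (⊠-identityˡ p))

  X-_ : Carrier → Poly
  X- a = ⊖ a ∷ 1# ∷ []

  eval-X- : ∀ a x → eval (X- a) x ≡ x ⊕ ⊖ a
  eval-X- a x = trans (cong (λ y → ⊖ a ⊕ x ⊗ y) (eval-const 1# x))
    (trans (cong (⊖ a ⊕_) (*-identityʳ x)) (+-comm _ _))

  X-⊠ : ∀ a s → (X- a) ⊠ s ≈ ⊖ a · s ⊞ (0# ∷ s)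
  X-⊠ a s = ⊞-cong ≈-refl (∷-cong refl (⊠-identityˡ s))

  -- Horner's scheme: the quotient of c ∷ p by X − a, which does not depend on c.
  quot : Carrier → Poly → Poly
  quot a []      = []
  quot a (b ∷ p) = eval (b ∷ p) a ∷ quot a p

  quot-correct : ∀ a c p → c ∷ p ≈ (X- a) ⊠ quot a p ⊞ (eval (c ∷ p) a ∷ [])
  quot-correct a c p = ≈-trans (go c p) (⊞-cong (≈-sym (X-⊠ a (quot a p))) ≈-refl)
    where
    go : ∀ c p → c ∷ p ≈ ⊖ a · quot a p ⊞ (0# ∷ quot a p) ⊞ (eval (c ∷ p) a ∷ [])
    go c []      = ∷-cong (sym (trans (+-identityˡ _) (trans (cong (c ⊕_) (zeroʳ a)) (+-identityʳ c)))) ≈-refl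
    go c (b ∷ p) = ∷-cong
      (sym (trans (cong (_⊕ (c ⊕ a ⊗ e)) (+-identityʳ _)) (solve 3 (λ a c e → :- a :* e :+ (c :+ a :* e) := c) refl a c e)))
      (≈-trans (go b p) (≈-trans (⊞-assoc (⊖ a · s) (0# ∷ s) (e ∷ []))
        (≈-trans (⊞-cong {⊖ a · s} ≈-refl (∷-cong (+-identityˡ e) (⊞-identityʳ s))) (≈-sym (⊞-identityʳ _)))))
      where
      e = eval (b ∷ p) a
      s = quot a p

  eval-quot : ∀ a c p x → eval (c ∷ p) x ≡ (x ⊕ ⊖ a) ⊗ eval (quot a p) x ⊕ eval (c ∷ p) a
  eval-quot a c p x = begin
    eval (c ∷ p) x                                                            ≡⟨ eval-cong x (quot-correct a c p) ⟩
    eval ((X- a) ⊠ quot a p ⊞ (eval (c ∷ p) a ∷ [])) x                        ≡⟨ eval-⊞ ((X- a) ⊠ quot a p) _ x ⟩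
    eval ((X- a) ⊠ quot a p) x ⊕ eval (eval (c ∷ p) a ∷ []) x                 ≡⟨ cong₂ _⊕_ (eval-⊠ (X- a) (quot a p) x) (eval-const _ x) ⟩
    eval (X- a) x ⊗ eval (quot a p) x ⊕ eval (c ∷ p) a                        ≡⟨ cong (λ y → y ⊗ eval (quot a p) x ⊕ eval (c ∷ p) a) (eval-X- a x) ⟩
    (x ⊕ ⊖ a) ⊗ eval (quot a p) x ⊕ eval (c ∷ p) a                            ∎
    where open ≡-Reasoning

  quot-root : ∀ {a x} c p → a ≢ x → eval (c ∷ p) a ≡ 0# → eval (c ∷ p) x ≡ 0# → eval (quot a p) x ≡ 0#
  quot-root {a} {x} c p a≢x pa≡0 px≡0 = x⊗y≡0⇒y≡0 (λ e → a≢x (sym (x⊖y≡0⇒x≡y e))) (begin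
    (x ⊕ ⊖ a) ⊗ eval (quot a p) x                     ≡⟨ +-identityʳ _ ⟨
    (x ⊕ ⊖ a) ⊗ eval (quot a p) x ⊕ 0#                ≡⟨ cong ((x ⊕ ⊖ a) ⊗ eval (quot a p) x ⊕_) pa≡0 ⟨
    (x ⊕ ⊖ a) ⊗ eval (quot a p) x ⊕ eval (c ∷ p) a    ≡⟨ eval-quot a c p x ⟨
    eval (c ∷ p) x                                    ≡⟨ px≡0 ⟩
    0#                                                ∎)
    where open ≡-Reasoning

  length-quot : ∀ a p → List.length (quot a p) ≡ List.length p
  length-quot a []      = refl
  length-quot a (b ∷ p) = cong suc (length-quot a p)

  quot-∷-root : ∀ a c p → eval (c ∷ p) a ≡ 0# → c ∷ p ≈ (X- a) ⊠ quot a p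
  quot-∷-root a c p e = ≈-trans (quot-correct a c p)
    (≈-trans (⊞-cong ≈-refl (≈-trans (∷-cong e ≈-refl) 0∷-zero)) (⊞-identityʳ _))

  -- Each step divides off one root, and the other points, being different from it, remain roots of
  -- the quotient. The length of a list exceeds the degree by one, so `N` roots are too many for a
  -- nonzero list of length at most `N`.
  root-bound : ∀ N p → List.length p ≤ N → (y : Fin N → Carrier) → (∀ {i j} → y i ≡ y j → i ≡ j) →
    (∀ i → eval p (y i) ≡ 0#) → p ≈ []
  root-bound N       []      _         y inj root = ≈-refl
  root-bound (suc N) (c ∷ p) (s≤s len) y inj root = ≈-trans (quot-∷-root (y zero) c p (root zero))
    (≈-trans (⊠-congˡ (X- y zero) (root-bound N (quot (y zero) p)
        (subst (_≤ N) (sym (length-quot (y zero) p)) len) (y ∘ suc) (Finₚ.suc-injective ∘ inj)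
        (λ i → quot-root c p (λ e → case inj e of λ ()) (root zero) (root (suc i)))))
      (⊠-zeroʳ (X- y zero)))

  quotMonic : ∀ {d} → Carrier → Vec Carrier d → Vec Carrier d
  quotMonic a []      = []
  quotMonic a (b ∷ v) = eval (monic (b ∷ v)) a ∷ quotMonic a v

  quot-monic : ∀ {d} a (v : Vec Carrier d) → quot a (monic v) ≈ monic (quotMonic a v)
  quot-monic a []      = ∷-cong (eval-const 1# a) ≈-refl
  quot-monic a (b ∷ v) = ∷-cong refl (quot-monic a v)

  -- All roots are divided off in turn. The last component keeps, for every root, a factorization
  -- with a multiple of `monic w` next to its linear factor: if `w` vanished there as well, the root
  -- would be double.
  split-roots : ∀ M {d} (v : Vec Carrier (M + d)) (y : Fin M → Carrier) → (∀ {i j} → y i ≡ y j → i ≡ j) →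
    (∀ i → eval (monic v) (y i) ≡ 0#) →
    Σ (Vec Carrier d) λ w → (∃[ h ] monic v ≈ h ⊠ monic w) × (∀ i → ∃[ h ] monic v ≈ (X- y i) ⊠ (h ⊠ monic w))
  split-roots zero    v       y inj root = v , (1# ∷ [] , ≈-sym (⊠-identityˡ (monic v))) , λ ()
  split-roots (suc M) {d} (c ∷ v) y inj root = w
      , (x₀ ⊠ h , ≈-trans v≈ (≈-trans (⊠-congˡ x₀ v′≈hw) (≈-sym (⊠-assoc x₀ h (monic w)))))
      , λ { zero → h , ≈-trans v≈ (⊠-congˡ x₀ v′≈hw)
          ; (suc i) → x₀ ⊠ proj₁ (factors i) , ≈-trans v≈ (≈-trans (⊠-congˡ x₀ (proj₂ (factors i)))
              (P.exchange-factors x₀ (X- y (suc i)) (proj₁ (factors i)) (monic w))) }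
    where
    x₀ : Poly
    x₀ = X- y zero
    v′ : Vec Carrier (M + d)
    v′ = quotMonic (y zero) v
    v≈ : c ∷ monic v ≈ x₀ ⊠ monic v′
    v≈ = ≈-trans (quot-∷-root (y zero) c (monic v) (root zero)) (⊠-congˡ x₀ (quot-monic (y zero) v))
    root′ : ∀ i → eval (monic v′) (y (suc i)) ≡ 0#
    root′ i = trans (sym (eval-cong (y (suc i)) (quot-monic (y zero) v)))
      (quot-root c (monic v) (λ e → case inj e of λ ()) (root zero) (root (suc i)))
    rec : Σ (Vec Carrier d) λ w → (∃[ h ] monic v′ ≈ h ⊠ monic w) × (∀ i → ∃[ h ] monic v′ ≈ (X- y (suc i)) ⊠ (h ⊠ monic w))
    rec = split-roots M v′ (y ∘ suc) (Finₚ.suc-injective ∘ inj) root′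
    w : Vec Carrier d
    w = proj₁ rec
    h : Poly
    h = proj₁ (proj₁ (proj₂ rec))
    v′≈hw : monic v′ ≈ h ⊠ monic w
    v′≈hw = proj₂ (proj₁ (proj₂ rec))
    factors : ∀ i → ∃[ h ] monic v′ ≈ (X- y (suc i)) ⊠ (h ⊠ monic w)
    factors = proj₂ (proj₂ rec)

  coeff-monic-top : ∀ {d} (v : Vec Carrier d) → coeff (monic v) d ≡ 1#
  coeff-monic-top []      = refl
  coeff-monic-top (_ ∷ v) = coeff-monic-top v

  coeff-monic-high : ∀ {d} (v : Vec Carrier d) n → coeff (monic v) (d + suc n) ≡ 0#
  coeff-monic-high []      n = refl
  coeff-monic-high (_ ∷ v) n = coeff-monic-high v n

  coeff-toList-high : ∀ {d} (v : Vec Carrier d) n → coeff (Vec.toList v) (d + n) ≡ 0#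
  coeff-toList-high []      n = refl
  coeff-toList-high (_ ∷ v) n = coeff-toList-high v n

  toList-injective : ∀ {d} (v w : Vec Carrier d) → Vec.toList v ≈ Vec.toList w → v ≡ w
  toList-injective []      []      e = refl
  toList-injective (a ∷ v) (b ∷ w) e = cong₂ _∷_ (at e 0) (toList-injective v w (coeffwise (λ n → at e (suc n))))

  -- Multiplication by a monic polynomial carries the top coefficient of `s` unchanged to a position
  -- from `d` on. In the induction, `a · m` has nothing above position `d`, so the tail `s` vanishes
  -- first, and position `d` then holds `a`.
  multiple-of-monic : ∀ {d} (v : Vec Carrier d) s → (∀ n → coeff (s ⊠ monic v) (d + n) ≡ 0#) → s ≈ []
  multiple-of-monic {d} v []      high = ≈-refl
  multiple-of-monic {d} v (a ∷ s) high = ≈-trans (∷-cong a≡0 s≈[]) 0∷-zero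
    where
    open ≡-Reasoning
    m = monic v
    s≈[] : s ≈ []
    s≈[] = multiple-of-monic v s λ n → begin
      coeff (s ⊠ m) (d + n)                                          ≡⟨ cong (coeff (0# ∷ s ⊠ m)) (ℕₚ.+-suc d n) ⟨
      coeff (0# ∷ s ⊠ m) (d + suc n)                                 ≡⟨ +-identityˡ _ ⟨
      0# ⊕ coeff (0# ∷ s ⊠ m) (d + suc n)                            ≡⟨ cong (_⊕ coeff (0# ∷ s ⊠ m) (d + suc n)) (trans (coeff-· a m (d + suc n)) (trans (cong (a ⊗_) (coeff-monic-high v n)) (zeroʳ a))) ⟨
      coeff (a · m) (d + suc n) ⊕ coeff (0# ∷ s ⊠ m) (d + suc n)     ≡⟨ coeff-⊞ (a · m) (0# ∷ s ⊠ m) (d + suc n) ⟨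
      coeff ((a ∷ s) ⊠ m) (d + suc n)                                ≡⟨ high (suc n) ⟩
      0#                                                             ∎
    a≡0 : a ≡ 0#
    a≡0 = begin
      a                                                  ≡⟨ trans (+-identityʳ _) (*-identityʳ a) ⟨
      a ⊗ 1# ⊕ 0#                                        ≡⟨ cong₂ (λ x y → a ⊗ x ⊕ y) (coeff-monic-top v) (at (≈-trans (∷-cong refl (⊠-cong {q = m} s≈[] ≈-refl)) 0∷-zero) d) ⟨
      a ⊗ coeff m d ⊕ coeff (0# ∷ s ⊠ m) d               ≡⟨ cong (_⊕ coeff (0# ∷ s ⊠ m) d) (coeff-· a m d) ⟨
      coeff (a · m) d ⊕ coeff (0# ∷ s ⊠ m) d             ≡⟨ coeff-⊞ (a · m) (0# ∷ s ⊠ m) d ⟨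
      coeff ((a ∷ s) ⊠ m) d                              ≡⟨ cong (coeff ((a ∷ s) ⊠ m)) (ℕₚ.+-identityʳ d) ⟨
      coeff ((a ∷ s) ⊠ m) (d + 0)                        ≡⟨ high 0 ⟩
      0#                                                 ∎

  monic-cancel : ∀ {d} (v : Vec Carrier d) s → s ⊠ monic v ≈ [] → s ≈ []
  monic-cancel v s e = multiple-of-monic v s (λ n → at e _)

  remainder-unique : ∀ {d} (g v w : Vec Carrier d) s → Vec.toList v ≈ Vec.toList w ⊞ s ⊠ monic g → v ≡ w
  remainder-unique {d} g v w s e = toList-injective v w (≈-trans e
    (≈-trans (⊞-cong ≈-refl (⊠-cong {q = monic g} s≈[] ≈-refl)) (⊞-identityʳ (Vec.toList w))))
    where
    open ≡-Reasoning
    s≈[] : s ≈ []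
    s≈[] = multiple-of-monic g s λ n → begin
      coeff (s ⊠ monic g) (d + n)                                   ≡⟨ +-identityˡ _ ⟨
      0# ⊕ coeff (s ⊠ monic g) (d + n)                              ≡⟨ cong (_⊕ coeff (s ⊠ monic g) (d + n)) (coeff-toList-high w n) ⟨
      coeff (Vec.toList w) (d + n) ⊕ coeff (s ⊠ monic g) (d + n)    ≡⟨ coeff-⊞ (Vec.toList w) (s ⊠ monic g) (d + n) ⟨
      coeff (Vec.toList w ⊞ s ⊠ monic g) (d + n)                    ≡⟨ at e (d + n) ⟨
      coeff (Vec.toList v) (d + n)                                  ≡⟨ coeff-toList-high v n ⟩
      0#                                                            ∎

  -- The step of long division: a remainder multiplied by X, plus a new constant `a`, has one
  -- coefficient too many, and a multiple of `monic g` removes it.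
  reduce-top : ∀ {d} (g : Vec Carrier d) a (r : Vec Carrier d) →
    Σ Carrier λ l → Σ (Vec Carrier d) λ r′ → a ∷ Vec.toList r ≈ l · monic g ⊞ Vec.toList r′
  reduce-top []      a []      = a , [] , ∷-cong (sym (*-identityʳ a)) ≈-refl
  reduce-top (b ∷ g) a (x ∷ r) with reduce-top g x r
  ... | l , r′ , e = l , a ⊕ ⊖ (l ⊗ b) ∷ r′ , ∷-cong (solve 2 (λ a y → a := y :+ (a :- y)) refl a (l ⊗ b)) e

  zeros : ∀ {d} → Vec Carrier d
  zeros = Vec.replicate _ 0#

  zeros≈[] : ∀ d → Vec.toList (zeros {d}) ≈ []
  zeros≈[] zero    = ≈-refl
  zeros≈[] (suc d) = ≈-trans (∷-cong refl (zeros≈[] d)) 0∷-zero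

  divMod : ∀ {d} (g : Vec Carrier d) p → Σ Poly λ s → Σ (Vec Carrier d) λ r → p ≈ s ⊠ monic g ⊞ Vec.toList r
  divMod g [] = [] , zeros , ≈-sym (zeros≈[] _)
  divMod g (a ∷ p) with divMod g p
  ... | s , r , p≈ with reduce-top g a r
  ...   | l , r′ , e = l ∷ s , r′ , (begin
    a ∷ p                                                ≈⟨ ∷-cong (sym (+-identityˡ a)) p≈ ⟩
    (0# ∷ s ⊠ m) ⊞ (a ∷ Vec.toList r)                    ≈⟨ ⊞-cong {0# ∷ s ⊠ m} ≈-refl e ⟩
    (0# ∷ s ⊠ m) ⊞ (l · m ⊞ Vec.toList r′)               ≈⟨ P.exchange-summands (0# ∷ s ⊠ m) (l · m) (Vec.toList r′) ⟩
    l · m ⊞ (0# ∷ s ⊠ m) ⊞ Vec.toList r′                 ∎)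
    where
    open ≈-Reasoning
    m = monic g

  -- A remainder has a fixed length and hence an unknown degree. Exposing its degree and leading
  -- coefficient lets the Euclidean algorithm continue with a monic divisor.
  normalise : ∀ {d} (v : Vec Carrier d) → v ≡ zeros ⊎
    (Σ ℕ λ e → Σ (Vec Carrier e) λ r → Σ Carrier λ c → e < d × c ≢ 0# × Vec.toList v ≈ c · monic r)
  normalise []      = inj₁ refl
  normalise (a ∷ v) with normalise v
  ... | inj₂ (e , r , c , e<d , c≢0 , v≈) = inj₂ (suc e , c⁻¹ ⊗ a ∷ r , c , s≤s e<d , c≢0
          , ∷-cong (trans (sym (*-identityˡ a)) (trans (cong (_⊗ a) (sym cc⁻¹≡1)) (*-assoc c c⁻¹ a))) v≈)
    where
    c⁻¹ = proj₁ (inverse c c≢0)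
    cc⁻¹≡1 = proj₂ (inverse c c≢0)
  ... | inj₁ refl with a ≟F 0#
  ...   | yes refl = inj₁ refl
  ...   | no a≢0 = inj₂ (0 , [] , a , s≤s z≤n , a≢0 , ∷-cong (sym (*-identityʳ a)) (zeros≈[] _))

  module _ {e} (g : Vec Carrier (suc e)) where
    InvertibleMod : Poly → Set
    InvertibleMod p = Σ Poly λ u → Σ Poly λ s → u ⊠ p ≈ (1# ∷ []) ⊞ s ⊠ monic g

    -- The degree `suc d` is positive, so that the factor can be given a root, and smaller than that
    -- of `g`, so that the descent to factors ends.
    ProperFactor : Set
    ProperFactor = Σ ℕ λ d → Σ (Vec Carrier (suc d)) λ w → d < e × (Σ Poly λ t → monic g ≈ t ⊠ monic w)

    scale-invertible : ∀ {p q} c → c ≢ 0# → q ≈ c · p → InvertibleMod p → InvertibleMod q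
    scale-invertible {p} {q} c c≢0 q≈cp (u , s , up≈) with inverse c c≢0
    ... | c⁻¹ , cc⁻¹≡1 = c⁻¹ · u , s , (begin
      (c⁻¹ · u) ⊠ q                 ≈⟨ ⊠-congˡ (c⁻¹ · u) q≈cp ⟩
      (c⁻¹ · u) ⊠ (c · p)           ≈⟨ ·-⊠ c⁻¹ u (c · p) ⟩
      c⁻¹ · (u ⊠ (c · p))           ≈⟨ ·-cong refl (≈-trans (⊠-comm u (c · p)) (·-⊠ c p u)) ⟩
      c⁻¹ · (c · (p ⊠ u))           ≈⟨ ⊗-· c⁻¹ c (p ⊠ u) ⟨
      (c⁻¹ ⊗ c) · (p ⊠ u)           ≈⟨ ·-cong (trans (*-comm c⁻¹ c) cc⁻¹≡1) ≈-refl ⟩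
      1# · (p ⊠ u)                  ≈⟨ 1·p≈p (p ⊠ u) ⟩
      p ⊠ u                         ≈⟨ ⊠-comm p u ⟩
      u ⊠ p                         ≈⟨ up≈ ⟩
      (1# ∷ []) ⊞ s ⊠ monic g       ∎)
      where open ≈-Reasoning

    -- The Euclidean algorithm, stopped as soon as a remainder divides g.
    invertible-or-factor : ∀ bound {d} → d < bound → d ≤ e → (v : Vec Carrier d) → InvertibleMod (monic v) ⊎ ProperFactor
    invertible-or-factor (suc bound) d<b d≤e [] = inj₁ (1# ∷ [] , [] , ⊠-identityˡ (1# ∷ []))
    invertible-or-factor (suc bound) (s≤s d<b) d≤e v@(_ ∷ _) with divMod v (monic g)
    ... | s , r , g≈ with normalise r
    ...   | inj₁ refl = inj₂ (_ , v , d≤e , s , ≈-trans g≈ (≈-trans (⊞-cong ≈-refl (zeros≈[] _)) (⊞-identityʳ _)))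
    ...   | inj₂ (d′ , r′ , c , d′<d , c≢0 , r≈) with invertible-or-factor bound (ℕₚ.<-≤-trans d′<d d<b) (ℕₚ.≤-trans (ℕₚ.<⇒≤ d′<d) d≤e) r′
    ...     | inj₂ factor = inj₂ factor
    ...     | inj₁ inv with scale-invertible {q = Vec.toList r} c c≢0 r≈ inv
    -- `monic g` equals s v + r, so s v is -r modulo `g`; as `u` inverts r, -u s inverts v.
    ...       | u , t , ur≈ = inj₁ (⊟ (u ⊠ s) , t ⊞ ⊟ u , (begin
      ⊟ (u ⊠ s) ⊠ monic v
        ≈⟨ P.euclid-step u s (monic v) (Vec.toList r) ⟩
      u ⊠ Vec.toList r ⊞ ⊟ (u ⊠ (s ⊠ monic v ⊞ Vec.toList r))
        ≈⟨ ⊞-cong ur≈ (⊟-cong (⊠-congˡ u (≈-sym g≈))) ⟩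
      (1# ∷ []) ⊞ t ⊠ monic g ⊞ ⊟ (u ⊠ monic g)
        ≈⟨ P.collect (1# ∷ []) t (monic g) u ⟩
      (1# ∷ []) ⊞ (t ⊞ ⊟ u) ⊠ monic g ∎))
      where open ≈-Reasoning

-- Quotient rings and the adjunction of a root.

module Ideal {c ℓ} (R : CommutativeRing c ℓ) (g : CommutativeRing.Carrier R) where
  private
    module R = CommutativeRing R
  open R using (Carrier; _≈_) renaming (_+_ to infixl 6 _⊕_; _*_ to infixl 7 _⊗_; -_ to infix 8 ⊖_)
  open Solver R

  infix 4 _∼_
  _∼_ : Carrier → Carrier → Set _
  x ∼ y = ∃[ s ] x ≈ y ⊕ s ⊗ g

  ≈⇒∼ : ∀ {x y} → x ≈ y → x ∼ y
  ≈⇒∼ {x} {y} e = R.0# , R.trans e (R.trans (R.sym (R.+-identityʳ y)) (R.+-congˡ (R.sym (R.zeroˡ g))))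

  ∼-sym : ∀ {x y} → x ∼ y → y ∼ x
  ∼-sym {x} {y} (s , e) = ⊖ s , R.trans
    (solve 3 (λ y s g → y := y :+ s :* g :+ :- s :* g) R.refl y s g) (R.+-congʳ (R.sym e))

  ∼-trans : ∀ {x y z} → x ∼ y → y ∼ z → x ∼ z
  ∼-trans {z = z} (s , e) (t , f) = t ⊕ s , R.trans e (R.trans (R.+-congʳ f)
    (solve 4 (λ z s t g → z :+ t :* g :+ s :* g := z :+ (t :+ s) :* g) R.refl z s t g))

  +-cong∼ : ∀ {x x′ y y′} → x ∼ x′ → y ∼ y′ → x ⊕ y ∼ x′ ⊕ y′
  +-cong∼ {x′ = x′} {y′ = y′} (s , e) (t , f) = s ⊕ t , R.trans (R.+-cong e f)
    (solve 5 (λ x y s t g → x :+ s :* g :+ (y :+ t :* g) := x :+ y :+ (s :+ t) :* g) R.refl x′ y′ s t g)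

  *-cong∼ : ∀ {x x′ y y′} → x ∼ x′ → y ∼ y′ → x ⊗ y ∼ x′ ⊗ y′
  *-cong∼ {x′ = x′} {y′ = y′} (s , e) (t , f) = x′ ⊗ t ⊕ s ⊗ y′ ⊕ s ⊗ g ⊗ t , R.trans (R.*-cong e f)
    (solve 5 (λ x y s t g → (x :+ s :* g) :* (y :+ t :* g) := x :* y :+ (x :* t :+ s :* y :+ s :* g :* t) :* g) R.refl x′ y′ s t g)

  -‿cong∼ : ∀ {x x′} → x ∼ x′ → ⊖ x ∼ ⊖ x′
  -‿cong∼ {x′ = x′} (s , e) = ⊖ s , R.trans (R.-‿cong e)
    (solve 3 (λ x s g → :- (x :+ s :* g) := :- x :+ :- s :* g) R.refl x′ s g)

  quotientRing : CommutativeRing c _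
  quotientRing = record
    { Carrier = Carrier ; _≈_ = _∼_ ; _+_ = _⊕_ ; _*_ = _⊗_ ; -_ = ⊖_ ; 0# = R.0# ; 1# = R.1#
    ; isCommutativeRing = record
      { isRing = record
        { +-isAbelianGroup = record
          { isGroup = record
            { isMonoid = record
              { isSemigroup = record
                { isMagma = record
                  { isEquivalence = record { refl = ≈⇒∼ R.refl ; sym = ∼-sym ; trans = ∼-trans }
                  ; ∙-cong = +-cong∼ }
                ; assoc = λ x y z → ≈⇒∼ (R.+-assoc x y z) }
              ; identity = (λ x → ≈⇒∼ (R.+-identityˡ x)) , (λ x → ≈⇒∼ (R.+-identityʳ x)) }
            ; inverse = (λ x → ≈⇒∼ (R.-‿inverseˡ x)) , (λ x → ≈⇒∼ (R.-‿inverseʳ x))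
            ; ⁻¹-cong = -‿cong∼ }
          ; comm = λ x y → ≈⇒∼ (R.+-comm x y) }
        ; *-cong = *-cong∼
        ; *-assoc = λ x y z → ≈⇒∼ (R.*-assoc x y z)
        ; *-identity = (λ x → ≈⇒∼ (R.*-identityˡ x)) , (λ x → ≈⇒∼ (R.*-identityʳ x))
        ; distrib = (λ x y z → ≈⇒∼ (R.distribˡ x y z)) , (λ x y z → ≈⇒∼ (R.distribʳ x y z)) }
      ; *-comm = λ x y → ≈⇒∼ (R.*-comm x y) } }

-- Moves the ring structure of a quotient to normal forms, because a `FiniteField` takes
-- propositional equality as its equality.
module NormalForms {c ℓ} (R : CommutativeRing c ℓ) {V : Set}
  (norm : CommutativeRing.Carrier R → V) (rep : V → CommutativeRing.Carrier R)
  (norm-cong : ∀ {x y} → CommutativeRing._≈_ R x y → norm x ≡ norm y)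
  (norm-rep : ∀ v → norm (rep v) ≡ v)
  (rep-norm : ∀ x → CommutativeRing._≈_ R (rep (norm x)) x) where
  private
    module R = CommutativeRing R

  add mul : V → V → V
  add v w = norm (rep v R.+ rep w)
  mul v w = norm (rep v R.* rep w)

  neg : V → V
  neg v = norm (R.- rep v)

  add-norm : ∀ x y → add (norm x) (norm y) ≡ norm (x R.+ y)
  add-norm x y = norm-cong (R.+-cong (rep-norm x) (rep-norm y))

  mul-norm : ∀ x y → mul (norm x) (norm y) ≡ norm (x R.* y)
  mul-norm x y = norm-cong (R.*-cong (rep-norm x) (rep-norm y))

  isCommutativeRing : IsCommutativeRing _≡_ add mul neg (norm R.0#) (norm R.1#)
  isCommutativeRing = record
    { isRing = record
      { +-isAbelianGroup = record
        { isGroup = record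
          { isMonoid = record
            { isSemigroup = record
              { isMagma = record
                { isEquivalence = Relation.Binary.PropositionalEquality.isEquivalence
                ; ∙-cong = cong₂ add }
              ; assoc = λ x y z → norm-cong (R.trans (R.+-congʳ (rep-norm _))
                  (R.trans (R.+-assoc _ _ _) (R.+-congˡ (R.sym (rep-norm _))))) }
            ; identity =
                (λ x → trans (norm-cong (R.trans (R.+-congʳ (rep-norm _)) (R.+-identityˡ _))) (norm-rep x))
              , (λ x → trans (norm-cong (R.trans (R.+-congˡ (rep-norm _)) (R.+-identityʳ _))) (norm-rep x)) }
          ; inverse = (λ x → norm-cong (R.trans (R.+-congʳ (rep-norm _)) (R.-‿inverseˡ _)))
                    , (λ x → norm-cong (R.trans (R.+-congˡ (rep-norm _)) (R.-‿inverseʳ _)))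
          ; ⁻¹-cong = cong neg }
        ; comm = λ x y → norm-cong (R.+-comm _ _) }
      ; *-cong = cong₂ mul
      ; *-assoc = λ x y z → norm-cong (R.trans (R.*-congʳ (rep-norm _))
          (R.trans (R.*-assoc _ _ _) (R.*-congˡ (R.sym (rep-norm _)))))
      ; *-identity =
          (λ x → trans (norm-cong (R.trans (R.*-congʳ (rep-norm _)) (R.*-identityˡ _))) (norm-rep x))
        , (λ x → trans (norm-cong (R.trans (R.*-congˡ (rep-norm _)) (R.*-identityʳ _))) (norm-rep x))
      ; distrib =
          (λ x y z → norm-cong (R.trans (R.*-congˡ (rep-norm _))
            (R.trans (R.distribˡ _ _ _) (R.sym (R.+-cong (rep-norm _) (rep-norm _))))))
        , (λ x y z → norm-cong (R.trans (R.*-congʳ (rep-norm _))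
            (R.trans (R.distribʳ _ _ _) (R.sym (R.+-cong (rep-norm _) (rep-norm _)))))) }
    ; *-comm = λ x y → norm-cong (R.*-comm _ _) }

-- The field L[X]/(g), carried by the remainders modulo `g`. Irreducibility enters as invertibility
-- of the nonzero remainders, the form in which `field-or-factor` delivers it.
module Adjunction (L : FiniteField) {e : ℕ} (g : Vec (FiniteField.Carrier L) (suc e))
  (invertible : ∀ (v : Vec (FiniteField.Carrier L) (suc e)) → v ≢ Division.zeros L {suc e} → Division.InvertibleMod L g (Vec.toList v)) where
  open FieldTheory L
  open Polynomial L
  open Division L
  open Ideal polyRing (monic g)
  private
    module Q = CommutativeRing quotientRing

  residue : Poly → Vec Carrier (suc e)
  residue p = proj₁ (proj₂ (divMod g p))

  rep-residue : ∀ p → Vec.toList (residue p) ∼ p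
  rep-residue p = ∼-sym (proj₁ (divMod g p) , ≈-trans (proj₂ (proj₂ (divMod g p))) (⊞-comm _ (Vec.toList (residue p))))

  residue-cong : ∀ {p q} → p ∼ q → residue p ≡ residue q
  residue-cong {p} {q} p∼q = remainder-unique g (residue p) (residue q) (proj₁ r) (proj₂ r)
    where
    r : Vec.toList (residue p) ∼ Vec.toList (residue q)
    r = ∼-trans (rep-residue p) (∼-trans p∼q (∼-sym (rep-residue q)))

  residue-rep : ∀ v → residue (Vec.toList v) ≡ v
  residue-rep v = remainder-unique g (residue (Vec.toList v)) v (proj₁ r) (proj₂ r)
    where
    r : Vec.toList (residue (Vec.toList v)) ∼ Vec.toList v
    r = rep-residue (Vec.toList v)

  open NormalForms quotientRing residue Vec.toList residue-cong residue-rep rep-residue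

  1≁0 : ¬ ((1# ∷ []) ∼ [])
  1≁0 (s , 1≈sg) = 0≢1 (sym (at (≈-trans 1≈sg (⊠-cong {q = monic g} s≈[] ≈-refl)) 0))
    where
    s≈[] : s ≈ []
    s≈[] = multiple-of-monic g s (λ n → sym (at 1≈sg (suc (e + n))))

  extension : FiniteField
  extension = record
    { Carrier = Vec Carrier (suc e)
    ; _⊕_ = add ; _⊗_ = mul ; ⊖_ = neg ; 0# = residue [] ; 1# = residue (1# ∷ [])
    ; isCommutativeRing = isCommutativeRing
    ; 0≢1 = λ e → 1≁0 (Q.trans (Q.sym (rep-residue (1# ∷ []))) (Q.trans (Q.reflexive (cong Vec.toList (sym e))) (rep-residue [])))
    ; inverse = λ v v≢0 → let (u , s , uv≈) = invertible v v≢0 in residue u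
        , residue-cong {Vec.toList v ⊠ Vec.toList (residue u)} (Q.trans (Q.*-congˡ {Vec.toList v} (rep-residue u)) (s , ≈-trans (⊠-comm (Vec.toList v) u) uv≈))
    ; _≟_ = Vecₚ.≡-dec _≟F_
    ; size = size ^ suc e
    ; enumeration = mk↔ₛ′ (λ i → Vec.tabulate (decode {suc e} i)) (λ v → encode (Vec.lookup v))
        (λ v → trans (Vecₚ.tabulate-cong (decode-encode (Vec.lookup v))) (Vecₚ.tabulate∘lookup v))
        (λ i → decode-injective {suc e} (λ l → trans (decode-encode (Vec.lookup (Vec.tabulate (decode {suc e} i))) l) (Vecₚ.lookup∘tabulate (decode {suc e} i) l)))
    }

  embedding : FieldHom L extension
  embedding = record
    { ⟦_⟧ = λ a → residue (a ∷ [])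
    ; ⊕-homo = λ a b → sym (add-norm (a ∷ []) (b ∷ []))
    ; ⊗-homo = λ a b → sym (trans (mul-norm (a ∷ []) (b ∷ [])) (residue-cong {(a ∷ []) ⊠ (b ∷ [])} (≈⇒∼ (∷-cong (+-identityʳ (a ⊗ b)) ≈-refl))))
    ; 1-homo = refl }

  open Evaluation embedding

  -- Horner's rule at the class of X is the residue of Horner's rule at X itself; for `p = monic g`
  -- the residue is zero.
  eval-X : ∀ p → eval p (residue X) ≡ residue p
  eval-X []      = refl
  eval-X (a ∷ p) = trans (cong (λ r → add (residue (a ∷ [])) (mul (residue X) r)) (eval-X p))
    (trans (cong (add (residue (a ∷ []))) (mul-norm X p))
    (trans (add-norm (a ∷ []) (X ⊠ p)) (residue-cong (≈⇒∼
      (≈-trans (⊞-cong {a ∷ []} ≈-refl (X⊠ p))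
        (∷-cong (+-identityʳ a) ≈-refl))))))

  X-root : eval (monic g) (residue X) ≡ FiniteField.0# extension
  X-root = trans (eval-X (monic g)) (residue-cong {monic g} {[]} (1# ∷ [] , ≈-sym (⊠-identityˡ (monic g))))

RootExtension : (L : FiniteField) → List (FiniteField.Carrier L) → Set₁
RootExtension L p = Σ FiniteField λ L′ → Σ (FieldHom L L′) λ φ →
  Σ (FiniteField.Carrier L′) λ x → Evaluation.eval φ p x ≡ FiniteField.0# L′

all-or : ∀ {n} {P : Fin n → Set} {Q : Set} → (∀ i → P i ⊎ Q) → (∀ i → P i) ⊎ Q
all-or {zero}  f = inj₁ λ ()
all-or {suc n} f with f zero | all-or (f ∘ suc)
... | inj₂ q | _      = inj₂ q
... | inj₁ p | inj₂ q = inj₂ q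
... | inj₁ p | inj₁ h = inj₁ λ { zero → p ; (suc i) → h i }

module _ (L : FiniteField) where
  open FieldTheory L
  open Polynomial L
  open Division L

  -- Takes the place of a factorization into irreducibles: the Euclidean algorithm is run on all of
  -- the finitely many remainders, and if no run meets a proper factor, all nonzero remainders are
  -- invertible.
  field-or-factor : ∀ {e} (g : Vec Carrier (suc e)) →
    (∀ v → v ≢ zeros → InvertibleMod g (Vec.toList v)) ⊎ ProperFactor g
  field-or-factor {e} g with all-or {P = λ i → vec i ≢ zeros → InvertibleMod g (Vec.toList (vec i))} (test ∘ vec)
    where
    vec : Fin (size ^ suc e) → Vec Carrier (suc e)
    vec i = Vec.tabulate (decode {suc e} i)
    test : ∀ v → (v ≢ zeros → InvertibleMod g (Vec.toList v)) ⊎ ProperFactor g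
    test v with normalise v
    ... | inj₁ v≡0 = inj₁ λ v≢0 → contradiction v≡0 v≢0
    ... | inj₂ (d , r , c , d<e , c≢0 , v≈) with invertible-or-factor g (suc e) d<e (ℕₚ.≤-pred d<e) r
    ...   | inj₁ inv    = inj₁ λ _ → scale-invertible g c c≢0 v≈ inv
    ...   | inj₂ factor = inj₂ factor
  ... | inj₂ factor = inj₂ factor
  ... | inj₁ inv = inj₁ λ v → subst (λ v → v ≢ zeros → InvertibleMod g (Vec.toList v))
          (trans (Vecₚ.tabulate-cong (decode-encode (Vec.lookup v))) (Vecₚ.tabulate∘lookup v))
          (inv (encode (Vec.lookup v)))

  -- When `g` does not define a field, it has a proper factor of smaller degree, and a root of the
  -- factor is a root of `g`.
  rootExtension : ∀ {e} (g : Vec Carrier (suc e)) → RootExtension L (monic g)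
  rootExtension {e} g = go (suc e) ℕₚ.≤-refl g
    where
    go : ∀ bound {e} → e < bound → (g : Vec Carrier (suc e)) → RootExtension L (monic g)
    go (suc bound) (s≤s e≤) g with field-or-factor g
    ... | inj₁ inv = extension , embedding , residue X , X-root
      where open Adjunction L g inv
    ... | inj₂ (d , w , d<e , t , g≈) with go bound (ℕₚ.<-≤-trans d<e e≤) w
    ...   | L′ , φ , x , root = L′ , φ , x , (begin
      eval (monic g) x              ≡⟨ eval-cong x g≈ ⟩
      eval (t ⊠ monic w) x          ≡⟨ eval-⊠ t (monic w) x ⟩
      eval t x L′.⊗ eval (monic w) x ≡⟨ cong (eval t x L′.⊗_) root ⟩
      eval t x L′.⊗ L′.0#           ≡⟨ L′.zeroʳ _ ⟩
      L′.0#                         ∎)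
      where
      module L′ = FieldTheory L′
      open Evaluation φ
      open ≡-Reasoning

-- Additivity of the Frobenius map.

module BinomialEnds {c ℓ} (R : CommutativeRing c ℓ) where
  open CommutativeRing R hiding (zero) renaming (refl to ≈-refl; sym to ≈-sym; trans to ≈-trans; _+_ to infixl 6 _⊕_; _*_ to infixl 7 _⊗_)
  open Algebra.Properties.Semiring.Exp semiring using () renaming (_^_ to infixr 8 _^ᴿ_)
  open Algebra.Properties.Semiring.Mult semiring using (×-homo-1; ×-assoc-*) renaming (_×_ to infixr 8 _⋆_)
  open Algebra.Properties.Semiring.Sum semiring using (sum; sum-cong-≋; sum-init-last; sum-replicate-zero)
  open Algebra.Properties.CommutativeSemiring.Binomial commutativeSemiring using (theorem; binomialTerm)

  -- The binomial coefficients of exponent m + 1 in R, without the two at the ends. `inject₁`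
  -- matches the indices that `sum-init-last` produces.
  inner : ∀ m → Fin m → Carrier
  inner m i = (suc m C suc (toℕ (Fin.inject₁ i))) ⋆ 1#

  binomial-ends : ∀ m x y → (x ⊕ y) ^ᴿ suc m ≈
    y ^ᴿ suc m ⊕ (sum (λ i → inner m i ⊗ (x ^ᴿ suc (toℕ (Fin.inject₁ i)) ⊗ y ^ᴿ (m ∸ toℕ (Fin.inject₁ i)))) ⊕ x ^ᴿ suc m)
  binomial-ends m x y = ≈-trans (theorem (suc m) x y)
    (+-cong first (≈-trans (sum-init-last (term ∘ suc)) (+-cong (sum-cong-≋ middle) last)))
    where
    term : Fin (suc (suc m)) → Carrier
    term = binomialTerm x y (suc m)
    first : term zero ≈ y ^ᴿ suc m
    first = ≈-trans (×-homo-1 _) (*-identityˡ _)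
    middle : ∀ i → term (suc (Fin.inject₁ i)) ≈ inner m i ⊗ (x ^ᴿ suc (toℕ (Fin.inject₁ i)) ⊗ y ^ᴿ (m ∸ toℕ (Fin.inject₁ i)))
    middle i = ≈-sym (≈-trans (×-assoc-* (suc m C suc (toℕ (Fin.inject₁ i))) 1# _) (×-congʳ′ (suc m C suc (toℕ (Fin.inject₁ i))) (*-identityˡ _)))
      where open Algebra.Properties.Semiring.Mult semiring using () renaming (×-congʳ to ×-congʳ′)
    last : term (suc (Fin.fromℕ m)) ≈ x ^ᴿ suc m
    last rewrite Finₚ.toℕ-fromℕ m | nCn≡1 (suc m) | ℕₚ.n∸n≡0 m = ≈-trans (×-homo-1 _) (*-identityʳ _)

  additive : ∀ m → (∀ i → inner m i ≈ 0#) → ∀ x y → (x ⊕ y) ^ᴿ suc m ≈ x ^ᴿ suc m ⊕ y ^ᴿ suc m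
  additive m inner≈0 x y = ≈-trans (binomial-ends m x y) (≈-trans (+-congˡ (≈-trans
    (+-congʳ (≈-trans (sum-cong-≋ (λ i → ≈-trans (*-congʳ (inner≈0 i)) (zeroˡ _))) (sum-replicate-zero m))) (+-identityˡ _))) (+-comm _ _))

module Fermat (F : FiniteField) where
  open FieldTheory F
  open Polynomial F
  open Evaluation (idHom F)
  open ≡-Reasoning
  private
    module ∏ = Algebra.Properties.CommutativeMonoid.Sum (CommutativeRing.*-commutativeMonoid ring)
    module ∑ = Algebra.Properties.Semiring.Sum semiring

  1^ : ∀ n → 1# ^F n ≡ 1#
  1^ zero    = refl
  1^ (suc n) = trans (*-identityˡ _) (1^ n)

  -- The factor in front makes up for the exceptional index. With the position of 0 as exception
  -- this is a · a^(q-1) = a^q without a subtraction in the exponent.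
  ∏-one-exception : ∀ {n} a (j : Fin n) (f : Fin n → Carrier) → f j ≡ 1# → (∀ i → i ≢ j → f i ≡ a) → a ⊗ ∏.sum f ≡ a ^F n
  ∏-one-exception {suc n} a zero f fj≡1 f≡a = cong (a ⊗_) (begin
    f zero ⊗ ∏.sum (f ∘ suc)   ≡⟨ cong (_⊗ ∏.sum (f ∘ suc)) fj≡1 ⟩
    1# ⊗ ∏.sum (f ∘ suc)       ≡⟨ *-identityˡ _ ⟩
    ∏.sum (f ∘ suc)            ≡⟨ const n (f ∘ suc) (λ i → f≡a (suc i) λ ()) ⟩
    a ^F n                     ∎)
    where
    const : ∀ n (g : Fin n → Carrier) → (∀ i → g i ≡ a) → ∏.sum g ≡ a ^F n
    const zero    g e = refl
    const (suc n) g e = cong₂ _⊗_ (e zero) (const n (g ∘ suc) (e ∘ suc))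
  ∏-one-exception {suc n} a (suc j) f fj≡1 f≡a = cong (a ⊗_) (trans
    (cong (_⊗ ∏.sum (f ∘ suc)) (f≡a zero λ ()))
    (∏-one-exception a j (f ∘ suc) fj≡1 (λ i i≢j → f≡a (suc i) (i≢j ∘ Finₚ.suc-injective))))

  0^ : ∀ {n} → 1 ≤ n → 0# ^F n ≡ 0#
  0^ (s≤s _) = zeroˡ _

  -- Multiplication by a permutes the nonzero elements, so their product is multiplied by a ^ (q ∸ 1) and unchanged.
  fermat : ∀ a → a ^F size ≡ a
  fermat a with a ≟F 0#
  ... | yes refl = 0^ (ℕₚ.≤-trans (s≤s z≤n) 2≤size)
  ... | no a≢0 = begin
    a ^F size                    ≡⟨ ∏-one-exception a (toFin 0#) factor (factor-0 _ (fromFin-toFin 0#)) (λ i i≢ → factor-≢0 i (λ e → i≢ (trans (sym (toFin-fromFin i)) (cong toFin e)))) ⟨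
    a ⊗ ∏.sum factor             ≡⟨ cong (a ⊗_) ∏factor≡1 ⟩
    a ⊗ 1#                       ≡⟨ *-identityʳ a ⟩
    a                            ∎
    where
    a⁻¹ : Carrier
    a⁻¹ = proj₁ (inverse a a≢0)
    aa⁻¹≡1 : a ⊗ a⁻¹ ≡ 1#
    aa⁻¹≡1 = proj₂ (inverse a a≢0)
    cancel : ∀ {x y} z → x ⊗ y ≡ 1# → x ⊗ (y ⊗ z) ≡ z
    cancel z e = trans (sym (*-assoc _ _ z)) (trans (cong (_⊗ z) e) (*-identityˡ z))
    π : Permutation size size
    π = permutation (λ i → toFin (a ⊗ fromFin i)) (λ i → toFin (a⁻¹ ⊗ fromFin i))
      (λ i → trans (cong (λ x → toFin (a ⊗ x)) (fromFin-toFin _)) (trans (cong toFin (cancel (fromFin i) aa⁻¹≡1)) (toFin-fromFin i)))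
      (λ i → trans (cong (λ x → toFin (a⁻¹ ⊗ x)) (fromFin-toFin _)) (trans (cong toFin (cancel (fromFin i) (trans (*-comm a⁻¹ a) aa⁻¹≡1))) (toFin-fromFin i)))
    -- `unit` replaces 0 by 1, so that a product over the whole enumeration is one over the nonzero
    -- elements. `factor` is the amount by which multiplication by `a` changes `unit`: 1 at zero and
    -- `a` elsewhere.
    unit : Carrier → Carrier
    unit x with x ≟F 0#
    ... | yes _ = 1#
    ... | no  _ = x
    unit≢0 : ∀ x → unit x ≢ 0#
    unit≢0 x with x ≟F 0#
    ... | yes _ = 0≢1 ∘ sym
    ... | no x≢0 = x≢0
    factor : Fin size → Carrier
    factor i with fromFin i ≟F 0#
    ... | yes _ = 1#
    ... | no  _ = a
    factor-0 : ∀ i → fromFin i ≡ 0# → factor i ≡ 1#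
    factor-0 i e with fromFin i ≟F 0#
    ... | yes _ = refl
    ... | no ne = contradiction e ne
    factor-≢0 : ∀ i → fromFin i ≢ 0# → factor i ≡ a
    factor-≢0 i ne with fromFin i ≟F 0#
    ... | yes e = contradiction e ne
    ... | no  _ = refl
    unit-⊗ : ∀ i → unit (a ⊗ fromFin i) ≡ factor i ⊗ unit (fromFin i)
    unit-⊗ i with fromFin i ≟F 0# | a ⊗ fromFin i ≟F 0#
    ... | yes _   | yes _ = sym (*-identityˡ 1#)
    ... | yes e   | no ne = contradiction (trans (cong (a ⊗_) e) (zeroʳ a)) ne
    ... | no ne   | yes e = contradiction (x⊗y≡0⇒y≡0 a≢0 e) ne
    ... | no _    | no _  = refl
    ∏units≢0 : ∀ {n} (f : Fin n → Carrier) → ∏.sum (unit ∘ f) ≢ 0#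
    ∏units≢0 {zero}  f e = 0≢1 (sym e)
    ∏units≢0 {suc n} f e = ∏units≢0 (f ∘ suc) (x⊗y≡0⇒y≡0 (unit≢0 (f zero)) e)
    p : Carrier
    p = ∏.sum (unit ∘ fromFin)
    ∏factor≡1 : ∏.sum factor ≡ 1#
    ∏factor≡1 = ⊗-cancelˡ (∏units≢0 fromFin) (begin
      p ⊗ ∏.sum factor                                  ≡⟨ *-comm p _ ⟩
      ∏.sum factor ⊗ p                                  ≡⟨ ∏.∑-distrib-+ factor (unit ∘ fromFin) ⟨
      ∏.sum (λ i → factor i ⊗ unit (fromFin i))         ≡⟨ ∏.sum-cong-≗ (λ i → trans (sym (unit-⊗ i)) (cong unit (sym (fromFin-toFin _)))) ⟩
      ∏.sum (λ i → unit (fromFin (π ⟨$⟩ʳ i)))           ≡⟨ ∏.sum-permute (unit ∘ fromFin) π ⟨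
      p                                                 ≡⟨ *-identityʳ p ⟨
      p ⊗ 1#                                            ∎)

  eval-tabulate : ∀ {n} (f : Fin n → Carrier) x → eval (List.tabulate f) x ≡ ∑.sum (λ i → f i ⊗ x ^F toℕ i)
  eval-tabulate {zero}  f x = refl
  eval-tabulate {suc n} f x = cong₂ _⊕_ (sym (*-identityʳ (f zero))) (begin
    x ⊗ eval (List.tabulate (f ∘ suc)) x                    ≡⟨ cong (x ⊗_) (eval-tabulate (f ∘ suc) x) ⟩
    x ⊗ ∑.sum (λ i → f (suc i) ⊗ x ^F toℕ i)                ≡⟨ ∑.*-distribˡ-sum x (λ i → f (suc i) ⊗ x ^F toℕ i) ⟩
    ∑.sum (λ i → x ⊗ (f (suc i) ⊗ x ^F toℕ i))              ≡⟨ ∑.sum-cong-≗ (λ i → solve 3 (λ x a y → x :* (a :* y) := a :* (x :* y)) refl x (f (suc i)) (x ^F toℕ i)) ⟩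
    ∑.sum (λ i → f (suc i) ⊗ x ^F toℕ (Fin.suc i))          ∎)

  coeff-tabulate : ∀ {n} (f : Fin n → Carrier) i → coeff (List.tabulate f) (toℕ i) ≡ f i
  coeff-tabulate f zero    = refl
  coeff-tabulate f (suc i) = coeff-tabulate (f ∘ suc) i

  open BinomialEnds ring using (inner; binomial-ends)

  -- By fermat, (X + 1)^q − X^q − 1 vanishes on all of F although its degree is less than q.
  inner≡0 : ∀ m → size ≡ suc m → ∀ i → inner m i ≡ 0#
  inner≡0 m size≡ i = trans (sym (coeff-tabulate (inner m) i)) (at p≈[] (suc (toℕ i)))
    where
    -- The terms of degree 0 and q are absent from (X + 1)^q - X^q - 1, so exactly q coefficients
    -- are listed, as many as there are points.
    p : Poly
    p = 0# ∷ List.tabulate (inner m)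
    fermat′ : ∀ x → x ^F suc m ≡ x
    fermat′ x = trans (cong (x ^F_) (sym size≡)) (fermat x)
    eval-p : ∀ x → eval p x ≡ 0#
    eval-p x = begin
      0# ⊕ x ⊗ eval (List.tabulate (inner m)) x                      ≡⟨ +-identityˡ _ ⟩
      x ⊗ eval (List.tabulate (inner m)) x                           ≡⟨ cong (x ⊗_) (eval-tabulate (inner m) x) ⟩
      x ⊗ ∑.sum (λ i → inner m i ⊗ x ^F toℕ i)                       ≡⟨ ∑.*-distribˡ-sum x (λ i → inner m i ⊗ x ^F toℕ i) ⟩
      ∑.sum (λ i → x ⊗ (inner m i ⊗ x ^F toℕ i))                     ≡⟨ ∑.sum-cong-≗ term ⟩
      s                                                              ≡⟨ solve 3 (λ s x o → s := (o :+ (s :+ x)) :- (x :+ o)) refl s x 1# ⟩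
      (1# ⊕ (s ⊕ x)) ⊕ ⊖ (x ⊕ 1#)                                    ≡⟨ x≡y⇒x⊖y≡0 expand ⟩
      0#                                                             ∎
      where
      s : Carrier
      s = ∑.sum (λ i → inner m i ⊗ (x ^F suc (toℕ (Fin.inject₁ i)) ⊗ 1# ^F (m ∸ toℕ (Fin.inject₁ i))))
      term : ∀ i → x ⊗ (inner m i ⊗ x ^F toℕ i) ≡ inner m i ⊗ (x ^F suc (toℕ (Fin.inject₁ i)) ⊗ 1# ^F (m ∸ toℕ (Fin.inject₁ i)))
      term i rewrite Finₚ.toℕ-inject₁ i | 1^ (m ∸ toℕ i) = trans
        (solve 3 (λ x a y → x :* (a :* y) := a :* (x :* y)) refl x (inner′ i) (x ^F toℕ i))
        (cong (inner′ i ⊗_) (sym (*-identityʳ _)))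
        where
        inner′ : Fin m → Carrier
        inner′ i = Algebra.Properties.Semiring.Mult._×_ semiring (suc m C suc (toℕ i)) 1#
      expand : 1# ⊕ (s ⊕ x) ≡ x ⊕ 1#
      expand = begin
        1# ⊕ (s ⊕ x)                          ≡⟨ cong₂ (λ y z → y ⊕ (s ⊕ z)) (sym (fermat′ 1#)) (sym (fermat′ x)) ⟩
        1# ^F suc m ⊕ (s ⊕ x ^F suc m)        ≡⟨ binomial-ends m x 1# ⟨
        (x ⊕ 1#) ^F suc m                     ≡⟨ fermat′ (x ⊕ 1#) ⟩
        x ⊕ 1#                                ∎
    p≈[] : p ≈ []
    p≈[] = Division.root-bound F size p (ℕₚ.≤-reflexive (trans (cong suc (Listₚ.length-tabulate (inner m))) (sym size≡)))
      fromFin (λ {i} {j} e → trans (sym (toFin-fromFin i)) (trans (cong toFin e) (toFin-fromFin j))) (λ i → eval-p (fromFin i))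

-- A multiple of 1 that vanishes in F vanishes in every ring with a map from F that respects 0, 1
-- and sums. R will be an extension field in one place and a polynomial ring in another.
module Frobenius (F : FiniteField) {c ℓ} (R : CommutativeRing c ℓ)
  (ι : FiniteField.Carrier F → CommutativeRing.Carrier R)
  (ι-0 : CommutativeRing._≈_ R (ι (FieldTheory.0# F)) (CommutativeRing.0# R))
  (ι-1 : CommutativeRing._≈_ R (ι (FieldTheory.1# F)) (CommutativeRing.1# R))
  (ι-⊕ : ∀ x y → CommutativeRing._≈_ R (ι (FieldTheory._⊕_ F x y)) (CommutativeRing._+_ R (ι x) (ι y))) where
  private
    module F = FieldTheory F
    module R = CommutativeRing R
    module Fₘ = Algebra.Properties.Semiring.Mult F.semiring
    module Rₘ = Algebra.Properties.Semiring.Mult R.semiring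
  open R using (Carrier; _≈_) renaming (_+_ to infixl 6 _⊕_)
  open Algebra.Properties.Semiring.Exp R.semiring renaming (_^_ to infixr 8 _^ᴿ_)
  open BinomialEnds R using (inner; additive)

  ι-× : ∀ n → ι (n Fₘ.× F.1#) ≈ n Rₘ.× R.1#
  ι-× zero    = ι-0
  ι-× (suc n) = R.trans (ι-⊕ _ _) (R.+-cong ι-1 (ι-× n))

  frobenius-⊕ : ∀ x y → (x ⊕ y) ^ᴿ F.size ≈ x ^ᴿ F.size ⊕ y ^ᴿ F.size
  frobenius-⊕ x y with F.size in size≡ | F.2≤size
  ... | suc m | _ = additive m (λ i → R.trans (R.sym (ι-× (suc m C suc (toℕ (Fin.inject₁ i)))))
          (R.trans (R.reflexive (cong ι (Fermat.inner≡0 F m size≡ i))) ι-0)) x y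

  frobenius^-⊕ : ∀ j x y → (x ⊕ y) ^ᴿ (F.size ^ j) ≈ x ^ᴿ (F.size ^ j) ⊕ y ^ᴿ (F.size ^ j)
  frobenius^-⊕ zero    x y = R.trans (R.*-identityʳ _) (R.sym (R.+-cong (R.*-identityʳ _) (R.*-identityʳ _)))
  frobenius^-⊕ (suc j) x y = R.trans (R.sym (^-assocʳ (x ⊕ y) F.size (F.size ^ j)))
    (R.trans (^-congˡ (F.size ^ j) (frobenius-⊕ x y)) (R.trans (frobenius^-⊕ j _ _)
    (R.+-cong (^-assocʳ x F.size (F.size ^ j)) (^-assocʳ y F.size (F.size ^ j)))))

-- Linear combinations over a subfield.

module FieldExtension {F L : FiniteField} (φ : FieldHom F L) where
  private
    module F = FieldTheory F
  open FieldTheory L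
  open FieldHom φ
  open Algebra.Properties.Semiring.Exp semiring using (^-assocʳ)
  open Algebra.Properties.CommutativeSemiring.Exp (CommutativeRing.commutativeSemiring ring) using (^-distrib-*)
  open Frobenius F ring ⟦_⟧ 0-homo 1-homo ⊕-homo public using (frobenius^-⊕)
  open ≡-Reasoning

  comb : ∀ {r} → (Fin r → F.Carrier) → (Fin r → Carrier) → Carrier
  comb {r} c α = ∑ L r (λ i → ⟦ c i ⟧ ⊗ α i)

  Independent : ∀ {r} → (Fin r → Carrier) → Set
  Independent {r} α = ∀ (c : Fin r → F.Carrier) → comb c α ≡ 0# → ∀ i → c i ≡ F.0#

  comb-⊖ : ∀ {r} (c d : Fin r → F.Carrier) α → comb (λ i → c i F.⊕ F.⊖ d i) α ≡ comb c α ⊕ ⊖ comb d α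
  comb-⊖ {r} c d α = begin
    ∑ L r (λ i → ⟦ c i F.⊕ F.⊖ d i ⟧ ⊗ α i)
      ≡⟨ ∑-cong r (λ i → trans (cong (_⊗ α i) (trans (⊕-homo _ _) (cong (⟦ c i ⟧ ⊕_) (⊖-homo _))))
           (solve 3 (λ x y a → (x :- y) :* a := x :* a :+ :- (y :* a)) refl ⟦ c i ⟧ ⟦ d i ⟧ (α i))) ⟩
    ∑ L r (λ i → ⟦ c i ⟧ ⊗ α i ⊕ ⊖ (⟦ d i ⟧ ⊗ α i))
      ≡⟨ ∑-⊕ r _ _ ⟩
    comb c α ⊕ ∑ L r (λ i → ⊖ (⟦ d i ⟧ ⊗ α i))
      ≡⟨ cong (comb c α ⊕_) (∑-⊖ r _) ⟩
    comb c α ⊕ ⊖ comb d α ∎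

  comb-congˡ : ∀ {r} {c d : Fin r → F.Carrier} α → (∀ i → c i ≡ d i) → comb c α ≡ comb d α
  comb-congˡ {r} α e = ∑-cong r (λ i → cong (λ x → ⟦ x ⟧ ⊗ α i) (e i))

  comb-congʳ : ∀ {r} (c : Fin r → F.Carrier) {α β} → (∀ i → α i ≡ β i) → comb c α ≡ comb c β
  comb-congʳ {r} c e = ∑-cong r (λ i → cong (⟦ c i ⟧ ⊗_) (e i))

  comb-0 : ∀ {r} {c : Fin r → F.Carrier} α → (∀ i → c i ≡ F.0#) → comb c α ≡ 0#
  comb-0 {r} α e = ∑-0 r (λ i → trans (cong (_⊗ α i) (trans (cong ⟦_⟧ (e i)) 0-homo)) (zeroˡ _))

  Independent⇒injective : ∀ {r} {α : Fin r → Carrier} → Independent α → ∀ c d → comb c α ≡ comb d α → ∀ i → c i ≡ d i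
  Independent⇒injective {α = α} ind c d e i =
    F.x⊖y≡0⇒x≡y (ind (λ i → c i F.⊕ F.⊖ d i) (trans (comb-⊖ c d α) (x≡y⇒x⊖y≡0 e)) i)

  homo-∑ : ∀ r (f : Fin r → F.Carrier) → ⟦ ∑ F r f ⟧ ≡ ∑ L r (λ i → ⟦ f i ⟧)
  homo-∑ zero    f = 0-homo
  homo-∑ (suc r) f = trans (⊕-homo _ _) (cong (⟦ f zero ⟧ ⊕_) (homo-∑ r (f ∘ suc)))

  comb-lincomb : ∀ {r s} (c : Fin r → F.Carrier) (M : Fin r → Fin s → F.Carrier) α →
    comb (lincomb F c M) α ≡ comb c (λ i → comb (M i) α)
  comb-lincomb {r} {s} c M α = begin
    ∑ L s (λ l → ⟦ ∑ F r (λ i → c i F.⊗ M i l) ⟧ ⊗ α l)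
      ≡⟨ ∑-cong s (λ l → trans (cong (_⊗ α l) (homo-∑ r _)) (sym (∑-⊗ʳ r (α l) _))) ⟩
    ∑ L s (λ l → ∑ L r (λ i → ⟦ c i F.⊗ M i l ⟧ ⊗ α l))
      ≡⟨ ∑-swap s r _ ⟩
    ∑ L r (λ i → ∑ L s (λ l → ⟦ c i F.⊗ M i l ⟧ ⊗ α l))
      ≡⟨ ∑-cong r (λ i → trans (∑-cong s (λ l → trans (cong (_⊗ α l) (⊗-homo _ _)) (*-assoc _ _ _))) (∑-⊗ˡ s ⟦ c i ⟧ _)) ⟩
    ∑ L r (λ i → ⟦ c i ⟧ ⊗ ∑ L s (λ l → ⟦ M i l ⟧ ⊗ α l)) ∎

  ^-homo : ∀ x n → ⟦ x F.^F n ⟧ ≡ ⟦ x ⟧ ^F n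
  ^-homo x zero    = 1-homo
  ^-homo x (suc n) = trans (⊗-homo _ _) (cong (⟦ x ⟧ ⊗_) (^-homo x n))

  fermat^ : ∀ x j → ⟦ x ⟧ ^F (F.size ^ j) ≡ ⟦ x ⟧
  fermat^ x zero    = *-identityʳ _
  fermat^ x (suc j) = begin
    ⟦ x ⟧ ^F (F.size * F.size ^ j)      ≡⟨ ^-assocʳ ⟦ x ⟧ F.size (F.size ^ j) ⟨
    (⟦ x ⟧ ^F F.size) ^F (F.size ^ j)   ≡⟨ cong (_^F (F.size ^ j)) (trans (sym (^-homo x F.size)) (cong ⟦_⟧ (Fermat.fermat F x))) ⟩
    ⟦ x ⟧ ^F (F.size ^ j)               ≡⟨ fermat^ x j ⟩
    ⟦ x ⟧                               ∎

  frobenius^-∑ : ∀ j r (f : Fin r → Carrier) → ∑ L r f ^F (F.size ^ j) ≡ ∑ L r (λ i → f i ^F (F.size ^ j))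
  frobenius^-∑ j zero    f = Fermat.0^ L (ℕₚ.m^n>0 F.size {{F.size≢0}} j)
  frobenius^-∑ j (suc r) f = trans (frobenius^-⊕ j _ _) (cong (f zero ^F (F.size ^ j) ⊕_) (frobenius^-∑ j r (f ∘ suc)))

  -- The exponents q^j fix the image of F, which upgrades additivity to F-linearity.
  frobenius^-comb : ∀ j {r} (c : Fin r → F.Carrier) α → comb c α ^F (F.size ^ j) ≡ comb c (λ i → α i ^F (F.size ^ j))
  frobenius^-comb j {r} c α = trans (frobenius^-∑ j r _) (∑-cong r (λ i →
    trans (^-distrib-* ⟦ c i ⟧ (α i) (F.size ^ j)) (cong (_⊗ α i ^F (F.size ^ j)) (fermat^ (c i) j))))

  -- A numbering of the span of `α`. For independent `α` it lists q^r distinct elements, ready to be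
  -- counted or divided off as roots.
  element : ∀ {r} → (Fin r → Carrier) → Fin (F.size ^ r) → Carrier
  element {r} α j = comb (F.decode {r} j) α

  element-injective : ∀ {r} {α : Fin r → Carrier} → Independent α → ∀ {i j} → element α i ≡ element α j → i ≡ j
  element-injective {r} ind {i} {j} e = F.decode-injective {r} (Independent⇒injective ind (F.decode {r} i) (F.decode {r} j) e)

  comb∈element : ∀ {r} (c : Fin r → F.Carrier) α → element α (F.encode c) ≡ comb c α
  comb∈element c α = comb-congˡ α (F.decode-encode c)

  element-fixed : ∀ m {r} {α : Fin r → Carrier} → (∀ i → α i ^F (F.size ^ m) ≡ α i) → ∀ j → element α j ^F (F.size ^ m) ≡ element α j
  element-fixed m {r} {α} fixed j = trans (frobenius^-comb m (F.decode {r} j) α) (comb-congʳ (F.decode {r} j) fixed)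

  Independent-∷ : ∀ {r} {α : Fin r → Carrier} {b} → Independent α → (∀ c → b ≢ comb c α) → Independent (b Vector.∷ α)
  Independent-∷ {r} {α} {b} ind b∉ c e = λ { zero → c₀≡0 ; (suc i) → ind (c ∘ suc) rest i }
    where
    c₀≡0 : c zero ≡ F.0#
    c₀≡0 with c zero F.≟F F.0#
    ... | yes c₀≡0 = c₀≡0
    ... | no c₀≢0 = contradiction (sym eq) (b∉ _)
      where
      y : F.Carrier
      y = proj₁ (F.inverse (c zero) c₀≢0)
      c₀y≡1 : ⟦ c zero ⟧ ⊗ ⟦ y ⟧ ≡ 1#
      c₀y≡1 = trans (sym (⊗-homo _ _)) (trans (cong ⟦_⟧ (proj₂ (F.inverse (c zero) c₀≢0))) 1-homo)
      s : Carrier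
      s = comb (c ∘ suc) α
      eq : comb (λ i → F.⊖ y F.⊗ c (suc i)) α ≡ b
      eq = begin
        ∑ L r (λ i → ⟦ F.⊖ y F.⊗ c (suc i) ⟧ ⊗ α i)
          ≡⟨ ∑-cong r (λ i → trans (cong (_⊗ α i) (trans (⊗-homo _ _) (cong (_⊗ ⟦ c (suc i) ⟧) (⊖-homo y)))) (*-assoc _ _ _)) ⟩
        ∑ L r (λ i → ⊖ ⟦ y ⟧ ⊗ (⟦ c (suc i) ⟧ ⊗ α i))
          ≡⟨ ∑-⊗ˡ r (⊖ ⟦ y ⟧) _ ⟩
        ⊖ ⟦ y ⟧ ⊗ s
          ≡⟨ solve 4 (λ y s c x → :- y :* s := c :* y :* x :- y :* (c :* x :+ s)) refl ⟦ y ⟧ s ⟦ c zero ⟧ b ⟩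
        ⟦ c zero ⟧ ⊗ ⟦ y ⟧ ⊗ b ⊕ ⊖ (⟦ y ⟧ ⊗ (⟦ c zero ⟧ ⊗ b ⊕ s))
          ≡⟨ cong₂ (λ u v → u ⊗ b ⊕ ⊖ (⟦ y ⟧ ⊗ v)) c₀y≡1 e ⟩
        1# ⊗ b ⊕ ⊖ (⟦ y ⟧ ⊗ 0#)
          ≡⟨ cong₂ (λ u v → u ⊕ ⊖ v) (trans (*-identityˡ b) (sym (+-identityʳ b))) (zeroʳ ⟦ y ⟧) ⟩
        b ⊕ 0# ⊕ ⊖ 0#
          ≡⟨ solve 2 (λ x z → x :+ z :- z := x) refl b 0# ⟩
        b ∎
    rest : comb (c ∘ suc) α ≡ 0#
    rest = begin
      comb (c ∘ suc) α                      ≡⟨ +-identityˡ _ ⟨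
      0# ⊕ comb (c ∘ suc) α                 ≡⟨ cong (_⊕ comb (c ∘ suc) α) (trans (cong (_⊗ b) (trans (cong ⟦_⟧ c₀≡0) 0-homo)) (zeroˡ b)) ⟨
      ⟦ c zero ⟧ ⊗ b ⊕ comb (c ∘ suc) α     ≡⟨ e ⟩
      0#                                    ∎

module _ {F L M : FiniteField} (ψ : FieldHom L M) (φ : FieldHom F L) where
  private
    module φ = FieldExtension φ
    module ψφ = FieldExtension (ψ ∘ʰ φ)
    module ψ = FieldHom ψ
    module M = FieldTheory M

  comb-∘ : ∀ {r} (c : Fin r → FiniteField.Carrier F) α → ψφ.comb c (ψ.⟦_⟧ ∘ α) ≡ ψ.⟦ φ.comb c α ⟧
  comb-∘ {r} c α = trans (M.∑-cong r (λ i → sym (ψ.⊗-homo _ _))) (sym (FieldExtension.homo-∑ ψ r _))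

  Independent-∘ : ∀ {r} {α : Fin r → FiniteField.Carrier L} → φ.Independent α → ψφ.Independent (ψ.⟦_⟧ ∘ α)
  Independent-∘ {α = α} ind c e = ind c (ψ.injective (trans (sym (comb-∘ c α)) (trans e (sym ψ.0-homo))))

module _ {K L : FiniteField} (φ : FieldHom K L) where
  private
    module K = FieldTheory K
  open FieldTheory L
  open FieldHom φ
  open Evaluation φ

  eval-homo : ∀ p a → eval p ⟦ a ⟧ ≡ ⟦ Evaluation.eval (idHom K) p a ⟧
  eval-homo []      a = sym 0-homo
  eval-homo (b ∷ p) a = trans (cong (λ y → ⟦ b ⟧ ⊕ ⟦ a ⟧ ⊗ y) (eval-homo p a))
    (trans (cong (⟦ b ⟧ ⊕_) (sym (⊗-homo _ _))) (sym (⊕-homo _ _)))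

  eval-monic-zeros : ∀ n x → eval (Division.monic K (Division.zeros K {n})) x ≡ x ^F n
  eval-monic-zeros zero    x = trans (eval-const K.1# x) 1-homo
  eval-monic-zeros (suc n) x = trans (cong₂ (λ y z → y ⊕ x ⊗ z) 0-homo (eval-monic-zeros n x)) (+-identityˡ _)

-- Roots of X^(q^m) - X.

module FixedPoints (L : FiniteField) where
  open FieldTheory L
  open Polynomial L
  open Division L
  private
    module P = CommutativeRing polyRing
    module Pᵢ = RingIdentities polyRing
  open Algebra.Properties.Semiring.Exp P.semiring using () renaming (_^_ to infixr 8 _^ᴾ_)

  -- The lower coefficients of X^(n + 2) − X.
  fixer : ∀ n → Vec Carrier (2 + n)
  fixer n = 0# ∷ ⊖ 1# ∷ zeros

  eval-fixer : ∀ {M} (φ : FieldHom L M) n x → Evaluation.eval φ (monic (fixer n)) x ≡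
    FieldTheory._⊕_ M (FieldTheory._^F_ M x (2 + n)) (FieldTheory.⊖_ M x)
  eval-fixer {M} φ n x = begin
    ⟦ 0# ⟧ M.⊕ x M.⊗ (⟦ ⊖ 1# ⟧ M.⊕ x M.⊗ Evaluation.eval φ (monic (zeros {n})) x)
      ≡⟨ cong₂ (λ y z → y M.⊕ x M.⊗ z) 0-homo (cong₂ (λ y z → y M.⊕ x M.⊗ z) (trans (⊖-homo 1#) (cong M.⊖_ 1-homo)) (eval-monic-zeros φ n x)) ⟩
    M.0# M.⊕ x M.⊗ (M.⊖ M.1# M.⊕ x M.⊗ y)
      ≡⟨ M.+-identityˡ _ ⟩
    x M.⊗ (M.⊖ M.1# M.⊕ x M.⊗ y)
      ≡⟨ M.solve 3 (λ x o y → x M.:* (M.:- o M.:+ x M.:* y) M.:= x M.:* (x M.:* y) M.:- o M.:* x) refl x M.1# y ⟩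
    x M.⊗ (x M.⊗ y) M.⊕ M.⊖ (M.1# M.⊗ x)
      ≡⟨ cong (λ z → x M.⊗ (x M.⊗ y) M.⊕ M.⊖ z) (M.*-identityˡ x) ⟩
    x M.⊗ (x M.⊗ y) M.⊕ M.⊖ x ∎
    where
    open ≡-Reasoning
    open FieldHom φ
    module M = FieldTheory M
    y : M.Carrier
    y = x M.^F n

  monic-zeros : ∀ n → monic (zeros {n}) ≈ X ^ᴾ n
  monic-zeros zero    = ≈-refl
  monic-zeros (suc n) = ≈-trans (∷-cong refl (monic-zeros n)) (≈-sym (X⊠ (X ^ᴾ n)))

  fixer≈ : ∀ n → monic (fixer n) ≈ X ^ᴾ (2 + n) ⊞ ⊟ X
  fixer≈ n = ≈-trans
    (∷-cong (sym (trans (cong (0# ⊕_) ⊖0≡0) (+-identityʳ 0#))) (≈-trans (∷-cong (sym (+-identityˡ (⊖ 1#))) (≈-sym (⊞-identityʳ (monic (zeros {n})))))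
      ≈-refl))
    (⊞-cong (≈-trans (∷-cong refl (∷-cong refl (monic-zeros n))) (≈-trans (∷-cong refl (≈-sym (X⊠ (X ^ᴾ n)))) (≈-sym (X⊠ (X ^ᴾ suc n))))) ≈-refl)

  const^ : ∀ a n → (a ∷ []) ^ᴾ n ≈ a ^F n ∷ []
  const^ a zero    = ≈-refl
  const^ a (suc n) = ≈-trans (⊠-congˡ (a ∷ []) (const^ a n)) (∷-cong (+-identityʳ _) ≈-refl)

  -- Writing t = X − a, additivity of the Frobenius gives X^N − X = t^N − t, which t² does not divide.
  no-double-root : ∀ n a → a ^F (2 + n) ≡ a →
    (∀ p q → (p ⊞ q) ^ᴾ (2 + n) ≈ p ^ᴾ (2 + n) ⊞ q ^ᴾ (2 + n)) →
    ∀ u → monic (fixer n) ≈ (X- a) ⊠ u → Evaluation.eval (idHom L) u a ≢ 0#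
  no-double-root n a fixed additive u f≈tu u[a]≡0 = 0≢1 (sym (begin
    1#                                              ≡⟨ trans (sym (+-identityʳ 1#)) (solve 2 (λ o z → o :+ z := z :- (z :- o :- z)) refl 1# 0#) ⟩
    0# ⊕ ⊖ (0# ⊕ ⊖ 1# ⊕ ⊖ 0#)                       ≡⟨ cong (λ y → 0# ⊕ ⊖ y) evaluated ⟨
    0# ⊕ ⊖ eval (t ^ᴾ suc n ⊞ ⊟ (1# ∷ []) ⊞ ⊟ u) a  ≡⟨ cong (λ y → 0# ⊕ ⊖ y) (eval-≈[] (t ^ᴾ suc n ⊞ ⊟ (1# ∷ []) ⊞ ⊟ u) a cancelled) ⟩
    0# ⊕ ⊖ 0#                                       ≡⟨ -‿inverseʳ 0# ⟩
    0#                                              ∎))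
    where
    open Evaluation (idHom L)
    open ≡-Reasoning
    t c 1ₚ : Poly
    t = X- a
    c = a ∷ []
    1ₚ = 1# ∷ []
    X≈ : X ≈ t ⊞ c
    X≈ = ∷-cong (sym (-‿inverseˡ a)) ≈-refl
    X^≈ : X ^ᴾ (2 + n) ≈ t ⊠ t ^ᴾ suc n ⊞ c
    X^≈ = ≈-trans (Algebra.Properties.Semiring.Exp.^-congˡ P.semiring (2 + n) X≈)
      (≈-trans (additive t c) (⊞-cong ≈-refl (≈-trans (const^ a (2 + n)) (∷-cong fixed ≈-refl))))
    f≈ : (t ⊠ t ^ᴾ suc n ⊞ c) ⊞ ⊟ (t ⊠ 1ₚ ⊞ c) ≈ t ⊠ u
    f≈ = ≈-trans (⊞-cong (≈-sym X^≈) (⊟-cong (≈-trans (⊞-cong {q = c} (P.*-identityʳ t) ≈-refl) (≈-sym X≈))))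
      (≈-trans (≈-sym (fixer≈ n)) f≈tu)
    -- Up to the constant `c`, which occurs on both sides of the difference, `f≈` says t·t^(n+1) - t
    -- = t·u. Cancelling t gives t^(n+1) - 1 = u, and at `a` both t and `u` vanish, which leaves -1
    -- = 0.
    cancelled : t ^ᴾ suc n ⊞ ⊟ 1ₚ ⊞ ⊟ u ≈ []
    cancelled = monic-cancel (⊖ a ∷ []) _ (≈-trans (⊠-comm (t ^ᴾ suc n ⊞ ⊟ 1ₚ ⊞ ⊟ u) t)
      (≈-trans (Pᵢ.separate t (t ^ᴾ suc n) 1ₚ c u) (≈-trans (⊞-cong f≈ ≈-refl) (⊟-inverseʳ (t ⊠ u)))))
    evaluated : eval (t ^ᴾ suc n ⊞ ⊟ 1ₚ ⊞ ⊟ u) a ≡ 0# ⊕ ⊖ 1# ⊕ ⊖ 0#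
    evaluated = begin
      eval (t ^ᴾ suc n ⊞ ⊟ 1ₚ ⊞ ⊟ u) a                      ≡⟨ eval-⊞ (t ^ᴾ suc n ⊞ ⊟ 1ₚ) (⊟ u) a ⟩
      eval (t ^ᴾ suc n ⊞ ⊟ 1ₚ) a ⊕ eval (⊟ u) a             ≡⟨ cong₂ _⊕_ (eval-⊞ (t ^ᴾ suc n) (⊟ 1ₚ) a) (eval-⊟ u a) ⟩
      eval (t ^ᴾ suc n) a ⊕ eval (⊟ 1ₚ) a ⊕ ⊖ eval u a      ≡⟨ cong₂ (λ y z → eval (t ^ᴾ suc n) a ⊕ y ⊕ ⊖ z) (trans (eval-⊟ 1ₚ a) (cong ⊖_ (eval-const 1# a))) u[a]≡0 ⟩
      eval (t ^ᴾ suc n) a ⊕ ⊖ 1# ⊕ ⊖ 0#                     ≡⟨ cong (λ y → y ⊕ ⊖ 1# ⊕ ⊖ 0#) (eval-⊠ t (t ^ᴾ n) a) ⟩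
      eval t a ⊗ eval (t ^ᴾ n) a ⊕ ⊖ 1# ⊕ ⊖ 0#              ≡⟨ cong (λ y → y ⊗ eval (t ^ᴾ n) a ⊕ ⊖ 1# ⊕ ⊖ 0#) (trans (eval-X- a a) (-‿inverseʳ a)) ⟩
      0# ⊗ eval (t ^ᴾ n) a ⊕ ⊖ 1# ⊕ ⊖ 0#                    ≡⟨ cong (λ y → y ⊕ ⊖ 1# ⊕ ⊖ 0#) (zeroˡ _) ⟩
      0# ⊕ ⊖ 1# ⊕ ⊖ 0#                                      ∎

-- The state of the construction. The field belongs to the record because it changes with each new
-- root.
record FixedFamily (F : FiniteField) (m r : ℕ) : Set₁ where
  field
    L           : FiniteField
    φ           : FieldHom F L
    α           : Fin r → FiniteField.Carrier L
    independent : FieldExtension.Independent φ α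
    fixed       : ∀ i → FieldTheory._^F_ L (α i) (FiniteField.size F ^ m) ≡ α i

-- Split off from X^(q^m) − X the roots in the span of the family and adjoin a root of what is left;
-- the new root is not in the span because X^(q^m) − X has no double roots.
module Enlarge {F : FiniteField} {m r : ℕ} (r<m : r < m) (E : FixedFamily F m r) where
  open FixedFamily E
  private
    module F = FieldTheory F
  open FieldTheory L
  open Polynomial L
  open Division L
  open FixedPoints L
  open FieldExtension φ using (element; element-injective; element-fixed; comb∈element; comb)
  open ≡-Reasoning

  private
    instance
      size-nonZero : ℕ.NonZero F.size
      size-nonZero = F.size≢0

  q^r<q^m : F.size ^ r < F.size ^ m
  q^r<q^m = ℕₚ.^-monoʳ-< F.size F.2≤size r<m

  abstract
    -- q^m is written as 2 + n to fit `fixer` and as q^r + (1 + d) to fit `split-roots`. As q^r <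
    -- q^m, the cofactor has positive degree and can be given a root.
    n d : ℕ
    n = proj₁ (ℕₚ.m≤n⇒∃[o]m+o≡n (ℕₚ.≤-trans (s≤s (ℕₚ.m^n>0 F.size r)) q^r<q^m))
    d = proj₁ (ℕₚ.m≤n⇒∃[o]m+o≡n q^r<q^m)

    2+n≡q^m : 2 + n ≡ F.size ^ m
    2+n≡q^m = proj₂ (ℕₚ.m≤n⇒∃[o]m+o≡n (ℕₚ.≤-trans (s≤s (ℕₚ.m^n>0 F.size r)) q^r<q^m))

    2+n≡q^r+1+d : 2 + n ≡ F.size ^ r + suc d
    2+n≡q^r+1+d = trans 2+n≡q^m (trans (sym (proj₂ (ℕₚ.m≤n⇒∃[o]m+o≡n q^r<q^m))) (sym (ℕₚ.+-suc _ d)))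

  f : Vec Carrier (F.size ^ r + suc d)
  f = subst (Vec Carrier) 2+n≡q^r+1+d (fixer n)

  monic-f : monic f ≡ monic (fixer n)
  monic-f = monic-subst 2+n≡q^r+1+d
    where
    monic-subst : ∀ {k} (e : 2 + n ≡ k) → monic (subst (Vec Carrier) e (fixer n)) ≡ monic (fixer n)
    monic-subst refl = refl

  element-fixed′ : ∀ j → element α j ^F (2 + n) ≡ element α j
  element-fixed′ j = trans (cong (element α j ^F_) 2+n≡q^m) (element-fixed m fixed j)

  element-root : ∀ j → Evaluation.eval (idHom L) (monic f) (element α j) ≡ 0#
  element-root j = trans (cong (λ p → Evaluation.eval (idHom L) p (element α j)) monic-f)
    (trans (eval-fixer (idHom L) n (element α j)) (x≡y⇒x⊖y≡0 (element-fixed′ j)))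

  abstract
    splitting : Σ (Vec Carrier (suc d)) λ w → (∃[ h ] monic f ≈ h ⊠ monic w) × (∀ i → ∃[ h ] monic f ≈ (X- element α i) ⊠ (h ⊠ monic w))
    splitting = split-roots (F.size ^ r) f (element α) (element-injective independent) element-root

  w : Vec Carrier (suc d)
  w = proj₁ splitting

  -- The instance of the Frobenius identity in L[X], which receives F as constants through `φ`.
  additive : ∀ p p′ → Algebra.Properties.Semiring.Exp._^_ (CommutativeRing.semiring polyRing) (p ⊞ p′) (2 + n) ≈
    Algebra.Properties.Semiring.Exp._^_ (CommutativeRing.semiring polyRing) p (2 + n) ⊞
    Algebra.Properties.Semiring.Exp._^_ (CommutativeRing.semiring polyRing) p′ (2 + n)
  additive p p′ = subst (λ k → (p ⊞ p′) ^ᴾ k ≈ p ^ᴾ k ⊞ p′ ^ᴾ k) (sym 2+n≡q^m)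
    (Frobenius.frobenius^-⊕ F polyRing (λ a → ⟦ a ⟧ ∷ []) (≈-trans (∷-cong 0-homo ≈-refl) 0∷-zero)
      (∷-cong 1-homo ≈-refl) (λ x y → ∷-cong (⊕-homo x y) ≈-refl) m p p′)
    where
    open FieldHom φ
    open Algebra.Properties.Semiring.Exp (CommutativeRing.semiring polyRing) using () renaming (_^_ to _^ᴾ_)

  -- A zero of `w` at an element of the span would make the cofactor of its linear factor vanish
  -- there too, which `no-double-root` forbids.
  element-not-root : ∀ j → Evaluation.eval (idHom L) (monic w) (element α j) ≢ 0#
  element-not-root j root = no-double-root n (element α j) (element-fixed′ j) additive (h ⊠ monic w)
    (subst (_≈ (X- element α j) ⊠ (h ⊠ monic w)) monic-f (proj₂ (proj₂ (proj₂ splitting) j)))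
    (trans (Evaluation.eval-⊠ (idHom L) h (monic w) (element α j)) (trans (cong (Evaluation.eval (idHom L) h (element α j) ⊗_) root) (zeroʳ _)))
    where
    h : Poly
    h = proj₁ (proj₂ (proj₂ splitting) j)

  abstract
    extension : RootExtension L (monic w)
    extension = rootExtension L w

  L′ : FiniteField
  L′ = proj₁ extension

  ψ : FieldHom L L′
  ψ = proj₁ (proj₂ extension)

  b : FiniteField.Carrier L′
  b = proj₁ (proj₂ (proj₂ extension))

  private
    module L′ = FieldTheory L′
    module ψ = FieldHom ψ

  b-root : Evaluation.eval ψ (monic w) b ≡ L′.0#
  b-root = proj₂ (proj₂ (proj₂ extension))

  b-fixed : b L′.^F (F.size ^ m) ≡ b
  b-fixed = trans (cong (b L′.^F_) (sym 2+n≡q^m)) (L′.x⊖y≡0⇒x≡y (begin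
    b L′.^F (2 + n) L′.⊕ L′.⊖ b                      ≡⟨ eval-fixer ψ n b ⟨
    eval (monic (fixer n)) b                         ≡⟨ cong (λ p → eval p b) monic-f ⟨
    eval (monic f) b                                 ≡⟨ eval-cong b (proj₂ (proj₁ (proj₂ splitting))) ⟩
    eval (h ⊠ monic w) b                             ≡⟨ eval-⊠ h (monic w) b ⟩
    eval h b L′.⊗ eval (monic w) b                   ≡⟨ cong (eval h b L′.⊗_) b-root ⟩
    eval h b L′.⊗ L′.0#                              ≡⟨ L′.zeroʳ _ ⟩
    L′.0#                                            ∎))
    where
    open Evaluation ψ
    h : Poly
    h = proj₁ (proj₁ (proj₂ splitting))

  -- A combination of the old family comes from L, so it would be a root of `w` in L already.
  b∉span : ∀ c → b ≢ FieldExtension.comb (ψ ∘ʰ φ) c (ψ.⟦_⟧ ∘ α)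
  b∉span c b≡ = element-not-root (F.encode c) (ψ.injective (begin
    ψ.⟦ Evaluation.eval (idHom L) (monic w) (element α (F.encode c)) ⟧   ≡⟨ eval-homo ψ (monic w) (element α (F.encode c)) ⟨
    Evaluation.eval ψ (monic w) ψ.⟦ element α (F.encode c) ⟧             ≡⟨ cong (Evaluation.eval ψ (monic w)) (trans (cong ψ.⟦_⟧ (comb∈element c α)) (trans (sym (comb-∘ ψ φ c α)) (sym b≡))) ⟩
    Evaluation.eval ψ (monic w) b                                        ≡⟨ b-root ⟩
    L′.0#                                                                ≡⟨ ψ.0-homo ⟨
    ψ.⟦ 0# ⟧                                                             ∎))

  enlarged : FixedFamily F m (suc r)
  enlarged = record
    { L = L′
    ; φ = ψ ∘ʰ φ
    ; α = b Vector.∷ (ψ.⟦_⟧ ∘ α)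
    ; independent = FieldExtension.Independent-∷ (ψ ∘ʰ φ) (Independent-∘ ψ φ independent) b∉span
    ; fixed = λ { zero → b-fixed
                ; (suc i) → trans (sym (FieldExtension.^-homo ψ (α i) (F.size ^ m))) (cong ψ.⟦_⟧ (fixed i)) }
    }

fixedFamily : ∀ F {m} r → r ≤ m → FixedFamily F m r
fixedFamily F zero    _   = record { L = F ; φ = idHom F ; α = λ () ; independent = λ _ _ () ; fixed = λ () }
fixedFamily F (suc r) r<m = Enlarge.enlarged r<m (fixedFamily F r (ℕₚ.<⇒≤ r<m))

-- Linearized polynomials and Gabidulin codes.

module Linearized {F L : FiniteField} (φ : FieldHom F L) where
  private
    module F = FieldTheory F
  open FieldTheory L
  open FieldHom φ
  open FieldExtension φ
  open Polynomial L
  open Evaluation (idHom L)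
  open ≡-Reasoning

  linearized : ∀ {κ} → (Fin κ → Carrier) → Carrier → Carrier
  linearized {κ} f x = ∑ L κ (λ i → f i ⊗ x ^F (F.size ^ toℕ i))

  linearized-comb : ∀ {κ r} (f : Fin κ → Carrier) (c : Fin r → F.Carrier) β →
    linearized f (comb c β) ≡ comb c (linearized f ∘ β)
  linearized-comb {κ} {r} f c β = begin
    ∑ L κ (λ i → f i ⊗ comb c β ^F (F.size ^ toℕ i))
      ≡⟨ ∑-cong κ (λ i → trans (cong (f i ⊗_) (frobenius^-comb (toℕ i) c β)) (sym (∑-⊗ˡ r (f i) _))) ⟩
    ∑ L κ (λ i → ∑ L r (λ a → f i ⊗ (⟦ c a ⟧ ⊗ β a ^F (F.size ^ toℕ i))))
      ≡⟨ ∑-swap κ r _ ⟩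
    ∑ L r (λ a → ∑ L κ (λ i → f i ⊗ (⟦ c a ⟧ ⊗ β a ^F (F.size ^ toℕ i))))
      ≡⟨ ∑-cong r (λ a → trans
           (∑-cong κ (λ i → solve 3 (λ f c x → f :* (c :* x) := c :* (f :* x)) refl (f i) ⟦ c a ⟧ (β a ^F (F.size ^ toℕ i))))
           (∑-⊗ˡ κ ⟦ c a ⟧ _)) ⟩
    ∑ L r (λ a → ⟦ c a ⟧ ⊗ linearized f (β a)) ∎

  exponent : ∀ {κ} → Fin κ → Fin (F.size ^ κ)
  exponent i = Fin.fromℕ< (ℕₚ.^-monoʳ-< F.size F.2≤size (Finₚ.toℕ<n i))

  toℕ-exponent : ∀ {κ} (i : Fin κ) → toℕ (exponent i) ≡ F.size ^ toℕ i
  toℕ-exponent i = Finₚ.toℕ-fromℕ< _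

  exponent-injective : ∀ {κ} {i j : Fin κ} → exponent i ≡ exponent j → i ≡ j
  exponent-injective {i = i} {j} e = Finₚ.toℕ-injective (ℕₚ.≤-antisym (cancel eq) (cancel (sym eq)))
    where
    eq : F.size ^ toℕ i ≡ F.size ^ toℕ j
    eq = trans (sym (toℕ-exponent i)) (trans (cong toℕ e) (toℕ-exponent j))
    cancel : ∀ {a b} → F.size ^ a ≡ F.size ^ b → a ≤ b
    cancel e = F.size^-cancel-≤ (ℕₚ.≤-reflexive e)

  -- The same polynomial as an ordinary coefficient list: `f i` at position q^i and zero elsewhere.
  -- The sum over `idEntry` avoids deciding whether a position is a power of q.
  coefficients : ∀ {κ} → (Fin κ → Carrier) → Fin (F.size ^ κ) → Carrier
  coefficients {κ} f e = ∑ L κ (λ i → f i ⊗ idEntry L (exponent i) e)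

  coefficients-exponent : ∀ {κ} (f : Fin κ → Carrier) i → coefficients f (exponent i) ≡ f i
  coefficients-exponent {κ} f i = trans (∑-cong κ (λ j → cong (f j ⊗_) (idEntry-injective j i))) (∑-idEntryʳ f i)
    where
    idEntry-injective : ∀ j i → idEntry L (exponent j) (exponent i) ≡ idEntry L j i
    idEntry-injective j i with exponent j Fin.≟ exponent i | j Fin.≟ i
    ... | yes _ | yes _ = refl
    ... | no  _ | no  _ = refl
    ... | yes e | no ne = contradiction (exponent-injective e) ne
    ... | no ne | yes e = contradiction (cong exponent e) ne

  eval-coefficients : ∀ {κ} (f : Fin κ → Carrier) x → eval (List.tabulate (coefficients f)) x ≡ linearized f x
  eval-coefficients {κ} f x = begin
    eval (List.tabulate (coefficients f)) x
      ≡⟨ trans (Fermat.eval-tabulate L (coefficients f) x) (sum≡∑ (F.size ^ κ) _) ⟩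
    ∑ L (F.size ^ κ) (λ e → coefficients f e ⊗ x ^F toℕ e)
      ≡⟨ ∑-cong (F.size ^ κ) (λ e → trans (sym (∑-⊗ʳ κ _ _)) (∑-cong κ (λ i → *-assoc _ _ _))) ⟩
    ∑ L (F.size ^ κ) (λ e → ∑ L κ (λ i → f i ⊗ (idEntry L (exponent i) e ⊗ x ^F toℕ e)))
      ≡⟨ ∑-swap (F.size ^ κ) κ _ ⟩
    ∑ L κ (λ i → ∑ L (F.size ^ κ) (λ e → f i ⊗ (idEntry L (exponent i) e ⊗ x ^F toℕ e)))
      ≡⟨ ∑-cong κ (λ i → trans (∑-⊗ˡ (F.size ^ κ) (f i) _) (cong (f i ⊗_)
           (trans (∑-idEntryˡ (λ e → x ^F toℕ e) (exponent i)) (cong (x ^F_) (toℕ-exponent i))))) ⟩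
    linearized f x ∎

  -- By F-linearity the polynomial vanishes on all q^κ combinations of `β`, as many points as its
  -- list has coefficients.
  linearized≡0 : ∀ {κ} (f : Fin κ → Carrier) {β : Fin κ → Carrier} → Independent β →
    (∀ t → linearized f (β t) ≡ 0#) → ∀ i → f i ≡ 0#
  linearized≡0 {κ} f {β} ind root i = trans (sym (coefficients-exponent f i))
    (trans (sym (Fermat.coeff-tabulate L (coefficients f) (exponent i))) (at p≈[] (toℕ (exponent i))))
    where
    p≈[] : List.tabulate (coefficients f) ≈ []
    p≈[] = Division.root-bound L (F.size ^ κ) _ (ℕₚ.≤-reflexive (Listₚ.length-tabulate (coefficients f)))
      (element β) (element-injective ind) (λ j → begin
        eval (List.tabulate (coefficients f)) (element β j)   ≡⟨ eval-coefficients f (element β j) ⟩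
        linearized f (element β j)                            ≡⟨ linearized-comb f (F.decode {κ} j) β ⟩
        comb (F.decode {κ} j) (linearized f ∘ β)              ≡⟨ ∑-0 κ (λ t → trans (cong (⟦ F.decode {κ} j t ⟧ ⊗_) (root t)) (zeroʳ _)) ⟩
        0#                                                    ∎)

module Gabidulin (F : FiniteField) {k m κ : ℕ} (1≤m : 1 ≤ m) (k≤m : k ≤ m) (E : FixedFamily F m m) where
  open FixedFamily E
  private
    module F = FieldTheory F
  open FieldTheory L
  open FieldHom φ
  open FieldExtension φ
  open Linearized φ
  open LinearAlgebra F using (Kernel)
  open Algebra.Properties.Semiring.Exp semiring using (^-assocʳ)
  open Algebra.Properties.CommutativeSemiring.Exp (CommutativeRing.commutativeSemiring ring) using (^-distrib-*)
  open ≡-Reasoning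

  Fixed : Carrier → Set
  Fixed x = x ^F (F.size ^ m) ≡ x

  -- Combinations of fixed elements are fixed, so `β` yields q^r roots of X^(q^m) - X. If r > m,
  -- these are more than its degree allows, and its leading coefficient 1 would be 0.
  fixed-bound : ∀ {r} {β : Fin r → Carrier} → Independent β → (∀ i → Fixed (β i)) → r ≤ m
  fixed-bound {r} {β} ind β-fixed with r ℕ.≤? m
  ... | yes r≤m = r≤m
  ... | no  r≰m = contradiction (trans (sym (coeff-monic-top (fixer n))) (at f≈[] (2 + n))) (0≢1 ∘ sym)
    where
    open Polynomial L
    open Division L
    open FixedPoints L
    q^m<q^r : F.size ^ m < F.size ^ r
    q^m<q^r = ℕₚ.^-monoʳ-< F.size F.2≤size (ℕₚ.≰⇒> r≰m)
    -- For m = 0 the polynomial would be X - X; `1≤m` makes the exponent at least 2, the form that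
    -- `fixer` has.
    2≤q^m : 2 ≤ F.size ^ m
    2≤q^m = ℕₚ.≤-trans F.2≤size (ℕₚ.≤-trans (ℕₚ.≤-reflexive (sym (ℕₚ.^-identityʳ F.size)))
      (ℕₚ.^-monoʳ-≤ F.size {{F.size≢0}} 1≤m))
    n : ℕ
    n = proj₁ (ℕₚ.m≤n⇒∃[o]m+o≡n 2≤q^m)
    2+n≡q^m : 2 + n ≡ F.size ^ m
    2+n≡q^m = proj₂ (ℕₚ.m≤n⇒∃[o]m+o≡n 2≤q^m)
    length-monic : ∀ {d} (v : Vec Carrier d) → List.length (monic v) ≡ suc d
    length-monic []      = refl
    length-monic (_ ∷ v) = cong suc (length-monic v)
    f≈[] : monic (fixer n) ≈ []
    f≈[] = root-bound (F.size ^ r) (monic (fixer n))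
      (subst (_≤ F.size ^ r) (sym (trans (length-monic (fixer n)) (cong suc 2+n≡q^m))) q^m<q^r)
      (element β) (element-injective ind)
      (λ j → trans (eval-fixer (idHom L) n (element β j)) (x≡y⇒x⊖y≡0
        (trans (cong (element β j ^F_) 2+n≡q^m) (element-fixed m β-fixed j))))

  -- By `fixed-bound`, the m elements of `α` cannot be extended, so they give coordinates for every
  -- fixed element even when L is larger.
  inSpan : ∀ y → Fixed y → ∃[ c ] comb c α ≡ y
  inSpan y y-fixed with F.any-vector? {P = λ c → comb c α ≡ y} (λ c≗d e → trans (sym (comb-congˡ α c≗d)) e) (λ c → comb c α ≟F y)
  ... | yes found = found
  ... | no none = contradiction
          (fixed-bound {β = y Vector.∷ α} (Independent-∷ independent (λ c e → none (c , sym e))) (λ { zero → y-fixed ; (suc i) → fixed i }))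
          (ℕₚ.<⇒≱ ℕₚ.≤-refl)

  γ : Fin k → Carrier
  γ a = α (Fin.inject≤ a k≤m)

  -- The value at `γ a` of the monomial α_l x^(q^i). These m κ monomials are an F-basis of the
  -- linearized polynomials with κ coefficients from the span of `α`.
  entry : Fin m → Fin κ → Fin k → Carrier
  entry l i a = α l ⊗ γ a ^F (F.size ^ toℕ i)

  entry-fixed : ∀ l i a → Fixed (entry l i a)
  entry-fixed l i a = begin
    (α l ⊗ γ a ^F q^i) ^F Q          ≡⟨ ^-distrib-* (α l) (γ a ^F q^i) Q ⟩
    α l ^F Q ⊗ (γ a ^F q^i) ^F Q     ≡⟨ cong₂ _⊗_ (fixed l) (trans (^-assocʳ (γ a) q^i Q) (trans (cong (γ a ^F_) (ℕₚ.*-comm q^i Q)) (sym (^-assocʳ (γ a) Q q^i)))) ⟩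
    α l ⊗ (γ a ^F Q) ^F q^i          ≡⟨ cong (λ x → α l ⊗ x ^F q^i) (fixed _) ⟩
    α l ⊗ γ a ^F q^i                 ∎
    where
    Q = F.size ^ m
    q^i = F.size ^ toℕ i

  abstract
    coordinates : Fin m → Fin κ → Fin k → Fin m → F.Carrier
    coordinates l i a = proj₁ (inSpan (entry l i a) (entry-fixed l i a))

    comb-coordinates : ∀ l i a → comb (coordinates l i a) α ≡ entry l i a
    comb-coordinates l i a = proj₂ (inSpan (entry l i a) (entry-fixed l i a))

  codeBasis : Fin (m * κ) → Matrix F k m
  codeBasis x a = coordinates (proj₁ (remQuot {m} κ x)) (proj₂ (remQuot {m} κ x)) a

  codeword : (Fin (m * κ) → F.Carrier) → Matrix F k m
  codeword c a j = ∑ F (m * κ) (λ x → c x F.⊗ codeBasis x a j)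

  symbol : (Fin (m * κ) → F.Carrier) → Fin κ → Carrier
  symbol c i = comb (λ l → c (combine l i)) α

  -- Reading the rows of a codeword as elements of the span of α, the codeword is the evaluation
  -- of the linearized polynomial with coefficients symbol c at the points γ.
  comb-codeword : ∀ c a → comb (codeword c a) α ≡ linearized (symbol c) (γ a)
  comb-codeword c a = begin
    comb (codeword c a) α
      ≡⟨ comb-lincomb c (λ x → codeBasis x a) α ⟩
    ∑ L (m * κ) (λ x → ⟦ c x ⟧ ⊗ comb (codeBasis x a) α)
      ≡⟨ ∑-cong (m * κ) (λ x → cong (⟦ c x ⟧ ⊗_) (comb-coordinates _ _ a)) ⟩
    ∑ L (m * κ) (λ x → ⟦ c x ⟧ ⊗ entry (proj₁ (remQuot {m} κ x)) (proj₂ (remQuot {m} κ x)) a)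
      ≡⟨ ∑-* m κ (λ x → ⟦ c x ⟧ ⊗ entry (proj₁ (remQuot {m} κ x)) (proj₂ (remQuot {m} κ x)) a) ⟩
    ∑ L m (λ l → ∑ L κ (λ i → ⟦ c (combine l i) ⟧ ⊗ entry (proj₁ (remQuot {m} κ (combine l i))) (proj₂ (remQuot {m} κ (combine l i))) a))
      ≡⟨ ∑-cong m (λ l → ∑-cong κ (λ i → trans
           (cong (λ (li : Fin m × Fin κ) → ⟦ c (combine l i) ⟧ ⊗ entry (proj₁ li) (proj₂ li) a) (Finₚ.remQuot-combine l i))
           (sym (*-assoc _ _ _)))) ⟩
    ∑ L m (λ l → ∑ L κ (λ i → ⟦ c (combine l i) ⟧ ⊗ α l ⊗ γ a ^F (F.size ^ toℕ i)))
      ≡⟨ ∑-swap m κ _ ⟩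
    ∑ L κ (λ i → ∑ L m (λ l → ⟦ c (combine l i) ⟧ ⊗ α l ⊗ γ a ^F (F.size ^ toℕ i)))
      ≡⟨ ∑-cong κ (λ i → ∑-⊗ʳ m _ _) ⟩
    linearized (symbol c) (γ a) ∎

  γ-independent : Independent γ
  γ-independent c e i = subst (λ x → x ≡ F.0#) (padded-inject≤ i) (independent padded (trans comb-padded e) (Fin.inject≤ i k≤m))
    where
    -- `c` extended by zero to the members of `α` that do not occur in `γ`.
    padded : Fin m → F.Carrier
    padded j = ∑ F k (λ i → c i F.⊗ idEntry F (Fin.inject≤ i k≤m) j)
    idEntry-inject≤ : ∀ i i′ → idEntry F (Fin.inject≤ i k≤m) (Fin.inject≤ i′ k≤m) ≡ idEntry F i i′
    idEntry-inject≤ i i′ with Fin.inject≤ i k≤m Fin.≟ Fin.inject≤ i′ k≤m | i Fin.≟ i′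
    ... | yes _ | yes _ = refl
    ... | no  _ | no  _ = refl
    ... | yes e | no ne = contradiction (Finₚ.inject≤-injective k≤m k≤m i i′ e) ne
    ... | no ne | yes e = contradiction (cong (λ x → Fin.inject≤ x k≤m) e) ne
    padded-inject≤ : ∀ i → padded (Fin.inject≤ i k≤m) ≡ c i
    padded-inject≤ i = trans (F.∑-cong k (λ i′ → cong (c i′ F.⊗_) (idEntry-inject≤ i′ i))) (F.∑-idEntryʳ c i)
    comb-idEntry : ∀ j → comb (idEntry F j) α ≡ α j
    comb-idEntry j = trans (∑-cong m (λ l → cong (_⊗ α l) (homo-idEntry j l))) (∑-idEntryˡ α j)
      where
      homo-idEntry : ∀ {n} (j l : Fin n) → ⟦ idEntry F j l ⟧ ≡ idEntry L j l
      homo-idEntry j l with j Fin.≟ l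
      ... | yes _ = 1-homo
      ... | no  _ = 0-homo
    comb-padded : comb padded α ≡ comb c γ
    comb-padded = trans (comb-lincomb c (λ i → idEntry F (Fin.inject≤ i k≤m)) α) (comb-congʳ c (λ i → comb-idEntry (Fin.inject≤ i k≤m)))

  -- A vector u in the left kernel gives the root Σ u_a γ_a of the linearized polynomial. With κ
  -- independent ones, all its coefficients `symbol c` vanish, and independence of `α` then gives c
  -- = 0.
  codeword-kernel : ∀ c → HasDimAtLeast F (Kernel (codeword c)) κ → ∀ x → c x ≡ F.0#
  codeword-kernel c (u , u-ind , u∈ker) x = begin
    c x                                                             ≡⟨ cong c (Finₚ.combine-remQuot {m} κ x) ⟨
    c (combine (proj₁ (remQuot {m} κ x)) (proj₂ (remQuot {m} κ x)))         ≡⟨ independent (λ l → c (combine l (proj₂ (remQuot {m} κ x)))) (symbol≡0 (proj₂ (remQuot {m} κ x))) (proj₁ (remQuot {m} κ x)) ⟩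
    F.0#                                                            ∎
    where
    β : Fin κ → Carrier
    β t = comb (u t) γ
    β-independent : Independent β
    β-independent d e = u-ind d (γ-independent (lincomb F d u) (trans (comb-lincomb d u γ) e))
    root : ∀ t → linearized (symbol c) (β t) ≡ 0#
    root t = begin
      linearized (symbol c) (comb (u t) γ)        ≡⟨ linearized-comb (symbol c) (u t) γ ⟩
      comb (u t) (linearized (symbol c) ∘ γ)      ≡⟨ comb-congʳ (u t) (λ a → sym (comb-codeword c a)) ⟩
      comb (u t) (λ a → comb (codeword c a) α)    ≡⟨ comb-lincomb (u t) (codeword c) α ⟨
      comb (lincomb F (u t) (codeword c)) α       ≡⟨ comb-0 α (u∈ker t) ⟩
      0#                                          ∎
    symbol≡0 : ∀ i → symbol c i ≡ 0#
    symbol≡0 = linearized≡0 (symbol c) β-independent root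

-- Row spaces of systematic matrices and their distances.

-- Generator matrices (I ∣ A) up to the order of the columns; split sends a column to its position in I or in A.
module Systematic (F : FiniteField) {k m n : ℕ} (split : Fin n → Fin k ⊎ Fin m)
  (left : Fin k → Fin n) (right : Fin m → Fin n)
  (split-left : ∀ i → split (left i) ≡ inj₁ i) (split-right : ∀ j → split (right j) ≡ inj₂ j) where
  open FieldTheory F
  open LinearAlgebra F
  open ≡-Reasoning

  systematic : Matrix F k m → Matrix F k n
  systematic A i j = [ idEntry F i , A i ]′ (split j)

  lincomb-left : ∀ A c i → lincomb F c (systematic A) (left i) ≡ c i
  lincomb-left A c i = trans (∑-cong k (λ l → cong (λ x → c l ⊗ [ idEntry F l , A l ]′ x) (split-left i))) (∑-idEntryʳ c i)

  lincomb-right : ∀ A c j → lincomb F c (systematic A) (right j) ≡ lincomb F c A j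
  lincomb-right A c j = ∑-cong k (λ l → cong (λ x → c l ⊗ [ idEntry F l , A l ]′ x) (split-right j))

  systematic-rank : ∀ A → HasRank F (systematic A) k
  systematic-rank A = (systematic A , (λ c e i → trans (sym (lincomb-left A c i)) (e (left i)))
      , λ i → idEntry F i , λ j → ∑-idEntryˡ (λ l → systematic A l j) i)
    , λ (v , ind , v∈) → contradiction (LinIndep⇒≤ ind v∈) (ℕₚ.<-irrefl refl)

  coefficients-LinIndep : ∀ A {w} {x : Fin w → Vector F n} → LinIndep F x → (x∈ : ∀ i → RowSpace F (systematic A) (x i)) →
    LinIndep F (λ i → proj₁ (x∈ i))
  coefficients-LinIndep A {x = x} ind x∈ c e = ind c (λ j → begin
    lincomb F c x j                                                   ≡⟨ lincomb-congʳ c (λ i j → sym (proj₂ (x∈ i) j)) j ⟩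
    lincomb F c (λ i → lincomb F (proj₁ (x∈ i)) (systematic A)) j     ≡⟨ lincomb-lincomb c (λ i → proj₁ (x∈ i)) (systematic A) j ⟩
    lincomb F (lincomb F c (λ i → proj₁ (x∈ i))) (systematic A) j     ≡⟨ lincomb-0 (systematic A) e j ⟩
    0#                                                                ∎)

  -- The identity block forces equal coefficients over both matrices, and the other columns then put
  -- them into the kernel of the difference, which `kernel+image≤` weighs against its rank.
  systematic-intersection : ∀ A B {r w} → HasRank F (_-M_ F A B) r →
    HasDimAtLeast F (λ x → RowSpace F (systematic A) x × RowSpace F (systematic B) x) w → w + r ≤ k
  systematic-intersection A B {r} {w} ((y , y-ind , y∈) , _) (x , x-ind , x∈) = kernel+image≤ A-B {u = u}
    (coefficients-LinIndep A x-ind (λ i → proj₁ (x∈ i))) u∈ker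
    (λ c e → y-ind c (λ j → trans (lincomb-congʳ c (λ i j → sym (proj₂ (y∈ i) j)) j) (e j)))
    where
    A-B : Matrix F k m
    A-B = _-M_ F A B
    u u′ : Fin w → Vector F k
    u i = proj₁ (proj₁ (x∈ i))
    u′ i = proj₁ (proj₂ (x∈ i))
    u≗u′ : ∀ i l → u i l ≡ u′ i l
    u≗u′ i l = begin
      u i l                                       ≡⟨ lincomb-left A (u i) l ⟨
      lincomb F (u i) (systematic A) (left l)     ≡⟨ proj₂ (proj₁ (x∈ i)) (left l) ⟩
      x i (left l)                                ≡⟨ proj₂ (proj₂ (x∈ i)) (left l) ⟨
      lincomb F (u′ i) (systematic B) (left l)    ≡⟨ lincomb-left B (u′ i) l ⟩
      u′ i l                                      ∎
    u∈ker : ∀ i → Kernel A-B (u i)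
    u∈ker i j = begin
      ∑ F k (λ l → u i l ⊗ (A l j ⊕ ⊖ B l j))
        ≡⟨ ∑-cong k (λ l → trans (solve 3 (λ c a b → c :* (a :- b) := c :* a :+ :- (c :* b)) refl (u i l) (A l j) (B l j))
             (cong (λ c → u i l ⊗ A l j ⊕ ⊖ (c ⊗ B l j)) (u≗u′ i l))) ⟩
      ∑ F k (λ l → u i l ⊗ A l j ⊕ ⊖ (u′ i l ⊗ B l j))
        ≡⟨ trans (∑-⊕ k _ _) (cong (lincomb F (u i) A j ⊕_) (∑-⊖ k _)) ⟩
      lincomb F (u i) A j ⊕ ⊖ lincomb F (u′ i) B j
        ≡⟨ x≡y⇒x⊖y≡0 (begin
             lincomb F (u i) A j                         ≡⟨ lincomb-right A (u i) j ⟨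
             lincomb F (u i) (systematic A) (right j)    ≡⟨ proj₂ (proj₁ (x∈ i)) (right j) ⟩
             x i (right j)                               ≡⟨ proj₂ (proj₂ (x∈ i)) (right j) ⟨
             lincomb F (u′ i) (systematic B) (right j)   ≡⟨ lincomb-right B (u′ i) j ⟩
             lincomb F (u′ i) B j                        ∎) ⟩
      0# ∎

module SubspaceDistance (F : FiniteField) where
  open FieldTheory F
  open LinearAlgebra F

  -- The distance of two k-dimensional spaces is 2 (k - dim), with dim the dimension of their
  -- intersection. The bound is assumed for all `w` because that dimension is computed only here.
  distance≥ : ∀ {k n δ} (G H : Matrix F k n) → HasRank F G k → HasRank F H k →
    (∀ w → HasDimAtLeast F (λ x → RowSpace F G x × RowSpace F H x) w → w + δ ≤ k) →
    ∃[ e ] (HasSubspaceDist F G H e × 2 * δ ≤ e)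
  distance≥ {k} {n} {δ} G H rankG rankH small = (k + k) ∸ 2 * dim
    , (k , k , dim , rankG , rankH , hasDim , refl)
    , ℕₚ.m+n≤o⇒m≤o∸n (2 * δ) (subst₂ _≤_ double (cong (k +_) (ℕₚ.+-identityʳ k)) (ℕₚ.*-monoʳ-≤ 2 (small dim (proj₁ hasDim))))
    where
    open Relation.Binary.PropositionalEquality using (subst₂)
    RowSpace-resp : ∀ (G : Matrix F k n) {x y} → (∀ j → x j ≡ y j) → RowSpace F G x → RowSpace F G y
    RowSpace-resp G x≗y (c , e) = c , λ j → trans (e j) (x≗y j)
    open Basis (basis (λ x → RowSpace F G x × RowSpace F H x)
      (λ x≗y (g , h) → RowSpace-resp G x≗y g , RowSpace-resp H x≗y h)
      (λ x → RowSpace? G x Decidable.×-dec RowSpace? H x))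
    double : 2 * (dim + δ) ≡ 2 * δ + 2 * dim
    double = trans (ℕₚ.*-distribˡ-+ 2 dim δ) (ℕₚ.+-comm (2 * dim) (2 * δ))

  RowSpace-cong : ∀ {k n} {G H : Matrix F k n} → (∀ i j → G i j ≡ H i j) → SameRowSpace F G H
  RowSpace-cong G≗H x = (λ (c , e) → c , λ j → trans (lincomb-congʳ c (λ i j → sym (G≗H i j)) j) (e j))
                      , (λ (c , e) → c , λ j → trans (lincomb-congʳ c G≗H j) (e j))

module _ (F : FiniteField) {k m N : ℕ} where
  open FieldTheory F

  span : (Fin N → Matrix F k m) → (Fin N → Carrier) → Matrix F k m
  span B c i j = ∑ F N (λ x → c x ⊗ B x i j)

  -- For κ = k + 1 - δ this is the rank bound of an MRD code, seen through the left kernel. Its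
  -- conclusion concerns the coefficients and not just the matrix, so for δ ≥ 1 it contains the
  -- independence of `B`.
  NullityBelow : ℕ → (Fin N → Matrix F k m) → Set
  NullityBelow κ B = ∀ c → HasDimAtLeast F (LinearAlgebra.Kernel F (span B c)) κ → ∀ x → c x ≡ 0#

module RankCode (F : FiniteField) {k m δ N : ℕ} (1≤δ : 1 ≤ δ) (B : Fin N → Matrix F k m)
  (kernel-bound : NullityBelow F (suc k ∸ δ) B) where
  open FieldTheory F
  open LinearAlgebra F

  codeword : (Fin N → Carrier) → Matrix F k m
  codeword = span F B

  -- All of F^k is in the kernel of the zero matrix, and k + 1 - δ ≤ k as δ ≥ 1.
  linIndepMat : LinIndepMat F B
  linIndepMat c e = kernel-bound c (HasDimAtLeast-≤ {U = Kernel (codeword c)} (ℕₚ.∸-monoʳ-≤ (suc k) 1≤δ)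
    (idEntry F , idEntry-LinIndep , λ i j → trans (∑-idEntryˡ (λ l → codeword c l j) i) (e i j)))

  kernel-bound-cong : ∀ A c → (∀ i j → codeword c i j ≡ A i j) → HasDimAtLeast F (Kernel A) (suc k ∸ δ) → ∀ x → c x ≡ 0#
  kernel-bound-cong A c cB≡A (u , u-ind , u∈ker) =
    kernel-bound c (u , u-ind , λ i j → trans (lincomb-congʳ (u i) cB≡A j) (u∈ker i j))

  nullity≥ : ∀ {r s} → k ≤ s + r → r < δ → suc k ∸ δ ≤ s
  nullity≥ {r} {s} k≤s+r r<δ = ℕₚ.m≤n+o⇒m∸n≤o (suc k) δ (ℕₚ.≤-trans (s≤s k≤s+r)
    (ℕₚ.≤-trans (ℕₚ.≤-reflexive (cong suc (ℕₚ.+-comm s r))) (ℕₚ.+-monoˡ-≤ s r<δ)))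

  rank≥δ : ∀ A c → (∀ i j → codeword c i j ≡ A i j) → ¬ (∀ x → c x ≡ 0#) → ∃[ r ] (HasRank F A r × δ ≤ r)
  rank≥δ A c cB≡A c≢0 = r , proj₁ (proj₂ (proj₂ (rank-nullity A))) , ℕₚ.≮⇒≥ λ r<δ → c≢0
    (kernel-bound-cong A c cB≡A (HasDimAtLeast-≤ {U = Kernel A} (nullity≥ (proj₂ (proj₂ (proj₂ (proj₂ (rank-nullity A))))) r<δ)
      (proj₁ (proj₂ (proj₂ (proj₂ (rank-nullity A)))))))
    where
    r : ℕ
    r = proj₁ (rank-nullity A)

  rankDistance : ∀ b c → ¬ (∀ x → b x ≡ c x) → RankDistAtLeast F (codeword b) (codeword c) δ
  rankDistance b c b≢c = rank≥δ _ (λ x → b x ⊕ ⊖ c x) difference (λ z → b≢c (λ x → x⊖y≡0⇒x≡y (z x)))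
    where
    difference : ∀ i j → codeword (λ x → b x ⊕ ⊖ c x) i j ≡ codeword b i j ⊕ ⊖ codeword c i j
    difference i j = lincomb-⊖ b c (λ x → B x i) j

-- `N` is kept apart from `m * κ` so that the index type of `IsMRD`, written with maximum and
-- minimum, can be supplied directly.
mrd-code : (F : FiniteField) → ∀ {k m κ N} → 1 ≤ m → k ≤ m → N ≡ m * κ → Σ (Fin N → Matrix F k m) (NullityBelow F κ)
mrd-code F {m = m} 1≤m k≤m refl = codeBasis , codeword-kernel
  where open Gabidulin F 1≤m k≤m (fixedFamily F m ℕₚ.≤-refl)

-- The constant dimension code.

-- The maxima are expressed by a construction: since `D` is an arbitrary rank metric code with the
-- required ranks and distances, a largest one may be taken, and the code obtained bounds the
-- left-hand maximum from below.
theorem2p6 : (F : FiniteField) → (n k δ : ℕ) → 1 ≤ k → 1 ≤ δ →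
    2 * k ≤ n → 2 * δ ≤ 2 * k → (k≤n : k ≤ n) →
    (s : ℕ) (D : Fin s → Matrix F k (n ∸ k)) →
    (∀ i → RankIn F (D i) 0 (k ∸ δ)) →
    (∀ i j → i ≢ j → RankDistAtLeast F (D i) (D j) δ) →
    ∃[ t ] Σ (Fin t → Matrix F k n) λ C →
    IsCDC F n (2 * δ) k C ×
    Σ _ λ B → IsMRD F k (n ∸ k) δ B ×
    (∀ A → InSpan F B A → ∃[ i ] SameRowSpace F (C i) (lift F k≤n A)) ×
    (FiniteField.size F ^ ((n ∸ k) * (k ∸ δ + 1)) + s ≤ t)
theorem2p6 F n k δ 1≤k 1≤δ 2k≤n 2δ≤2k k≤n s D D-rank D-dist =
  size ^ N + s , C , (C-rank , C-dist) , B , (linIndepMat , B-rank) , C-lift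
  , ℕₚ.≤-reflexive (cong (λ e → size ^ e + s) (sym N≡))
  where
  open FieldTheory F
  open LinearAlgebra F
  open SubspaceDistance F
  m κ N : ℕ
  m = n ∸ k
  κ = suc k ∸ δ
  N = (k ℕ.⊔ m) * (suc (k ℕ.⊓ m) ∸ δ)
  δ≤k : δ ≤ k
  δ≤k = ℕₚ.*-cancelˡ-≤ 2 2δ≤2k
  k≤m : k ≤ m
  k≤m = ℕₚ.m+n≤o⇒m≤o∸n k (subst (_≤ n) (cong (k +_) (ℕₚ.+-identityʳ k)) 2k≤n)
  N≡mκ : N ≡ m * κ
  N≡mκ = cong₂ (λ a b → a * (suc b ∸ δ)) (ℕₚ.m≤n⇒m⊔n≡n k≤m) (ℕₚ.m≤n⇒m⊓n≡m k≤m)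
  N≡ : N ≡ m * (k ∸ δ + 1)
  N≡ = trans N≡mκ (cong (m *_) (trans (ℕₚ.+-∸-assoc 1 δ≤k) (ℕₚ.+-comm 1 (k ∸ δ))))
  abstract
    mrd : Σ (Fin N → Matrix F k m) (NullityBelow F κ)
    mrd = mrd-code F (ℕₚ.≤-trans 1≤k k≤m) k≤m N≡mκ
  B : Fin N → Matrix F k m
  B = proj₁ mrd
  open RankCode F {δ = δ} 1≤δ B (proj₂ mrd)
  k+m≡n : k + m ≡ n
  k+m≡n = ℕₚ.m+[n∸m]≡n k≤n
  m+k≡n : m + k ≡ n
  m+k≡n = trans (ℕₚ.+-comm m k) k+m≡n
  cast-cast : ∀ {a b} (e : a ≡ b) (x : Fin a) → cast (sym e) (cast e x) ≡ x
  cast-cast refl x = trans (Finₚ.cast-is-id refl _) (Finₚ.cast-is-id refl x)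
  module Left = Systematic F {k} {m} {n} (λ j → splitAt k (cast (sym k+m≡n) j))
    (λ i → cast k+m≡n (i ↑ˡ m)) (λ j → cast k+m≡n (k ↑ʳ j))
    (λ i → trans (cong (splitAt k) (cast-cast k+m≡n _)) (Finₚ.splitAt-↑ˡ k i m))
    (λ j → trans (cong (splitAt k) (cast-cast k+m≡n _)) (Finₚ.splitAt-↑ʳ k m j))
  -- In (D ∣ I) the identity occupies the last k columns. `swap` presents it as the first summand,
  -- so that the rank and intersection lemmas for (I ∣ A) apply to this arrangement too.
  module Right = Systematic F {k} {m} {n} (λ j → swap (splitAt m (cast (sym m+k≡n) j)))
    (λ i → cast m+k≡n (m ↑ʳ i)) (λ j → cast m+k≡n (j ↑ˡ k))
    (λ i → cong swap (trans (cong (splitAt m) (cast-cast m+k≡n _)) (Finₚ.splitAt-↑ʳ m k i)))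
    (λ j → cong swap (trans (cong (splitAt m) (cast-cast m+k≡n _)) (Finₚ.splitAt-↑ˡ m j k)))

  generator : Fin (size ^ N) ⊎ Fin s → Matrix F k n
  generator = [ (λ i → Left.systematic (codeword (decode {N} i))) , (λ i → Right.systematic (D i)) ]′

  C : Fin (size ^ N + s) → Matrix F k n
  C i = generator (splitAt (size ^ N) i)

  generator-rank : ∀ x → HasRank F (generator x) k
  generator-rank (inj₁ i) = Left.systematic-rank (codeword (decode {N} i))
  generator-rank (inj₂ i) = Right.systematic-rank (D i)

  C-rank : ∀ i → HasRank F (C i) k
  C-rank i = generator-rank (splitAt (size ^ N) i)

  near : ∀ {w r} → w + r ≤ k → δ ≤ r → w + δ ≤ k
  near {w} w+r≤k δ≤r = ℕₚ.≤-trans (ℕₚ.+-monoʳ-≤ w δ≤r) w+r≤k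

  -- As k ≤ m, the first k columns of (D ∣ I) lie in D, while a vector of the row space of (I ∣ A)
  -- is determined by its first k coordinates.
  cross : ∀ A i w → HasDimAtLeast F (λ x → RowSpace F (Left.systematic A) x × RowSpace F (Right.systematic (D i)) x) w → w + δ ≤ k
  cross A i w (x , x-ind , x∈) = ℕₚ.≤-trans (ℕₚ.+-monoˡ-≤ δ w≤) (ℕₚ.≤-reflexive (ℕₚ.m∸n+n≡m δ≤k))
    where
    open ≡-Reasoning
    u t : Fin w → Vector F k
    u l = proj₁ (proj₁ (x∈ l))
    t l = proj₁ (proj₂ (x∈ l))
    z : Fin w → Vector F m
    z l = lincomb F (t l) (D i)
    -- Since k ≤ m, one and the same column belongs to I in (I ∣ A) and to D in (D ∣ I).
    position : ∀ a → cast k+m≡n (a ↑ˡ m) ≡ cast m+k≡n (Fin.inject≤ a k≤m ↑ˡ k)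
    position a = Finₚ.toℕ-injective (begin
      toℕ (cast k+m≡n (a ↑ˡ m))                  ≡⟨ trans (Finₚ.toℕ-cast k+m≡n _) (Finₚ.toℕ-↑ˡ a m) ⟩
      toℕ a                                      ≡⟨ Finₚ.toℕ-inject≤ a k≤m ⟨
      toℕ (Fin.inject≤ a k≤m)                    ≡⟨ trans (Finₚ.toℕ-cast m+k≡n _) (Finₚ.toℕ-↑ˡ (Fin.inject≤ a k≤m) k) ⟨
      toℕ (cast m+k≡n (Fin.inject≤ a k≤m ↑ˡ k))  ∎)
    u≡z : ∀ l a → u l a ≡ z l (Fin.inject≤ a k≤m)
    u≡z l a = begin
      u l a                                                                             ≡⟨ Left.lincomb-left A (u l) a ⟨
      lincomb F (u l) (Left.systematic A) (cast k+m≡n (a ↑ˡ m))                         ≡⟨ proj₂ (proj₁ (x∈ l)) _ ⟩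
      x l (cast k+m≡n (a ↑ˡ m))                                                         ≡⟨ cong (x l) (position a) ⟩
      x l (cast m+k≡n (Fin.inject≤ a k≤m ↑ˡ k))                                         ≡⟨ proj₂ (proj₂ (x∈ l)) _ ⟨
      lincomb F (t l) (Right.systematic (D i)) (cast m+k≡n (Fin.inject≤ a k≤m ↑ˡ k))    ≡⟨ Right.lincomb-right (D i) (t l) _ ⟩
      z l (Fin.inject≤ a k≤m)                                                           ∎
    -- Restricting a relation among the `z l` to the first k coordinates gives one among the
    -- coefficient vectors `u l`, which are independent because the `x l` are.
    z-ind : LinIndep F z
    z-ind c e = Left.coefficients-LinIndep A x-ind (λ l → proj₁ (x∈ l)) c
      (λ a → trans (lincomb-congʳ c {w = λ l a → z l (Fin.inject≤ a k≤m)} u≡z a) (e (Fin.inject≤ a k≤m)))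
    w≤ : w ≤ k ∸ δ
    w≤ = ℕₚ.≤-trans (HasDim⇒≤ {U = RowSpace F (D i)} (proj₁ (proj₂ (D-rank i))) (z , z-ind , λ l → t l , λ _ → refl))
      (proj₂ (proj₂ (proj₂ (D-rank i))))

  generator-dist : ∀ x y → x ≢ y → ∃[ e ] (HasSubspaceDist F (generator x) (generator y) e × 2 * δ ≤ e)
  generator-dist x y x≢y = distance≥ (generator x) (generator y) (generator-rank x) (generator-rank y) (small x y x≢y)
    where
    small : ∀ x y → x ≢ y → ∀ w → HasDimAtLeast F (λ v → RowSpace F (generator x) v × RowSpace F (generator y) v) w → w + δ ≤ k
    small (inj₁ i) (inj₁ j) i≢j w h =
      near (Left.systematic-intersection (codeword (decode {N} i)) (codeword (decode {N} j)) (proj₁ (proj₂ d)) h) (proj₂ (proj₂ d))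
      where
      d : RankDistAtLeast F (codeword (decode {N} i)) (codeword (decode {N} j)) δ
      d = rankDistance (decode {N} i) (decode {N} j) (λ e → i≢j (cong inj₁ (decode-injective {N} e)))
    small (inj₂ i) (inj₂ j) i≢j w h =
      near (Right.systematic-intersection (D i) (D j) (proj₁ (proj₂ d)) h) (proj₂ (proj₂ d))
      where
      d : RankDistAtLeast F (D i) (D j) δ
      d = D-dist i j (i≢j ∘ cong inj₂)
    small (inj₁ i) (inj₂ j) _ w h = cross (codeword (decode {N} i)) j w h
    small (inj₂ i) (inj₁ j) _ w (v , ind , v∈) =
      cross (codeword (decode {N} j)) i w (v , ind , λ l → proj₂ (v∈ l) , proj₁ (v∈ l))

  C-dist : ∀ i j → i ≢ j → ∃[ e ] (HasSubspaceDist F (C i) (C j) e × 2 * δ ≤ e)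
  C-dist i j i≢j = generator-dist (splitAt (size ^ N) i) (splitAt (size ^ N) j) (λ e → i≢j (trans
    (sym (Finₚ.join-splitAt (size ^ N) s i)) (trans (cong (Fin.join (size ^ N) s) e) (Finₚ.join-splitAt (size ^ N) s j))))

  B-rank : ∀ A → InSpan F B A → (∃[ i ] ∃[ j ] (A i j ≢ 0#)) → ∃[ r ] (HasRank F A r × δ ≤ r)
  B-rank A (c , cB≡A) (i , j , Aij≢0) = rank≥δ A c cB≡A
    (λ c≡0 → Aij≢0 (trans (sym (cB≡A i j)) (lincomb-0 (λ x → B x i) c≡0 j)))

  lift≡systematic : ∀ A i j → lift F k≤n A i j ≡ Left.systematic A i j
  lift≡systematic A i j with splitAt k (cast (sym (ℕₚ.m+[n∸m]≡n k≤n)) j)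
  ... | inj₁ _ = refl
  ... | inj₂ _ = refl

  C-lift : ∀ A → InSpan F B A → ∃[ i ] SameRowSpace F (C i) (lift F k≤n A)
  C-lift A (c , cB≡A) = encode c ↑ˡ s , RowSpace-cong (λ i j → begin
    generator (splitAt (size ^ N) (encode c ↑ˡ s)) i j        ≡⟨ cong (λ x → generator x i j) (Finₚ.splitAt-↑ˡ (size ^ N) (encode c) s) ⟩
    Left.systematic (codeword (decode (encode c))) i j        ≡⟨ systematic-cong (λ i j → trans (lincomb-congˡ (λ x → B x i) (decode-encode c) j) (cB≡A i j)) i j ⟩
    Left.systematic A i j                                     ≡⟨ lift≡systematic A i j ⟨
    lift F k≤n A i j                                          ∎)
    where
    open ≡-Reasoning
    systematic-cong : ∀ {A A′ : Matrix F k m} → (∀ i j → A i j ≡ A′ i j) → ∀ i j → Left.systematic A i j ≡ Left.systematic A′ i j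
    systematic-cong A≗A′ i j with splitAt k (cast (sym k+m≡n) j)
    ... | inj₁ _  = refl
    ... | inj₂ j′ = A≗A′ i j′
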